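{- There is an absolute constant $C>0$ such that the following holds. Let $n\ge 1$ and let $X$ be a (weighted) graph of order $n$ with Hermitian adjacency matrix $A\in\mathbb{C}^{n\times n}$ such that $0$ is a simple eigenvalue of $A$ with corresponding eigenvector $\mathbf{1}_n$ (the all-one vector). Let $\widehat{X}=K_1+X$ be the cone of $X$, with adjacency matrix $$A(\widehat{X})=\begin{pmatrix}0&\mathbf{1}_n^T\\ \mathbf{1}_n&A\end{pmatrix}.$$ Then $\widehat{X}$ has probabilistic (Las Vegas) uniform mixing in expected time $O(n^{3/2})$: for every start vertex $u$ of $\widehat{X}$ there is a measured-walk protocol on $\widehat{X}$, with generator $H=\frac1n A(\widehat{X})$, which starts in the state $e_u$, stops with probability $1$, always stops in a uniform state, and whose expected total evolution time is at most $C\,n^{3/2}$.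
   Context: Weighted graphs are identified with their Hermitian adjacency matrices (complex weights allowed). The cone $\widehat{X}$ is obtained from $X$ by adding one new vertex (the conical vertex) joined to every vertex of $X$ by an edge of weight $1$. For a graph $Y$ with vertex set $V$, $|V|=N$, states are unit vectors in $\mathbb{C}^V$, and $e_v$ denotes the standard basis vector of $v\in V$. For a Hermitian generator $H$ on $\mathbb{C}^V$ (the adjacency matrix of $Y$ or a positive real multiple of it), evolving for time $t\ge0$ maps $\psi$ to $e^{ -itH}\psi$. The partial measurement relative to a vertex $a$ uses the projections $P_1=e_ae_a^T$ and $P_0=I-e_ae_a^T$: applied to a state $\psi$ it returns outcome $j\in\{0,1\}$ with probability $\|P_j\psi\|^2$, after which the state is $P_j\psi/\|P_j\psi\|$. A measured-walk protocol is an adaptive sequence of steps, each being either an evolution for some chosen time $t\ge 0$ or an (instantaneous) partial measurement relative to some chosen vertex, together with a stopping rule; all choices may depend on the start vertex and on previous measurement outcomes. Its total evolution time is the random variable given by the sum of the durations of the evolution steps before stopping. A state $\psi$ is uniform if $|\psi(v)|^2=1/N$ for all $v\in V$. Times are measured with the adjacency matrix scaled by $1/n$ (so that the generator has bounded norm for unit-modulus weights). -}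

module Defs where

open import Algebra.Bundles using (CommutativeRing; RawRing)
import Algebra.Definitions.RawMonoid as RawMonoid
open import Data.Bool using (Bool; true; false; if_then_else_)
open import Data.Fin using (Fin; zero; suc; toℕ; _≟_)
open import Data.List using (List; []; _∷_)
open import Data.Nat as ℕ using (ℕ; zero; suc; _!)
open import Data.Product using (∃-syntax; _×_)
open import Data.Vec.Functional using (Vector)
open import Level using (0ℓ)
open import Relation.Binary using (Rel; IsDecTotalOrder)
import Relation.Binary.Construct.NonStrictToStrict as NonStrictToStrict
open import Relation.Binary.PropositionalEquality using (_≡_)
open import Relation.Nullary using (¬_; does)
open import Relation.Unary using (Pred; _∈_; Satisfiable)

-- The axioms of the real numbers, which determine them up to isomorphism.
-- They are read classically: the order is decidable, and ⁻¹ and sup are total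
-- operations about which nothing is assumed at 0, respectively on predicates
-- that are empty or unbounded above.
record CompleteOrderedField : Set₁ where
  infix  4 _≤_
  infixl 8 _⁻¹
  field
    commutativeRing : CommutativeRing 0ℓ 0ℓ

  open CommutativeRing commutativeRing public

  field
    _≤_             : Rel Carrier 0ℓ
    isDecTotalOrder : IsDecTotalOrder _≈_ _≤_
    0≉1             : ¬ 0# ≈ 1#
    +-monoʳ-≤       : ∀ x {y z} → y ≤ z → x + y ≤ x + z
    *-nonNegative   : ∀ {x y} → 0# ≤ x → 0# ≤ y → 0# ≤ x * y
    _⁻¹             : Carrier → Carrier
    ⁻¹-inverseʳ     : ∀ x → ¬ x ≈ 0# → x * x ⁻¹ ≈ 1#

  open NonStrictToStrict _≈_ _≤_ public using (_<_)
  open RawMonoid +-rawMonoid public using () renaming (_×_ to _·_)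

  fromℕ : ℕ → Carrier
  fromℕ n = n · 1#

  UpperBound : Pred Carrier 0ℓ → Pred Carrier 0ℓ
  UpperBound P b = ∀ x → x ∈ P → x ≤ b

  field
    sup       : Pred Carrier 0ℓ → Carrier
    sup-upper : ∀ P → Satisfiable P → Satisfiable (UpperBound P) →
                UpperBound P (sup P)
    sup-least : ∀ P → Satisfiable P → ∀ b → UpperBound P b → sup P ≤ b
    -- Follows from the supremum axioms, but not constructively.
    archimedean : ∀ x → ∃[ n ] x ≤ fromℕ n

module MeasuredWalk (R : CompleteOrderedField) where

  open CompleteOrderedField R renaming (Carrier to ℝ)

  -- Meaningful for x ≥ 0.
  √_ : ℝ → ℝ
  √ x = sup (λ y → y * y ≤ x)

  _⟶_ : (ℕ → ℝ) → ℝ → Set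
  a ⟶ l = ∀ ε → 0# < ε →
    ∃[ N ] (∀ m → N ℕ.≤ m → l - ε ≤ a m × a m ≤ l + ε)

  -- The limit inferior, which is the limit whenever the sequence converges.
  lim : (ℕ → ℝ) → ℝ
  lim a = sup (λ x → ∃[ N ] (∀ m → N ℕ.≤ m → x ≤ a m))

  infix 6 _+i_
  record ℂ : Set where
    constructor _+i_
    field
      re im : ℝ

  open ℂ public

  ℂ-rawRing : RawRing 0ℓ 0ℓ
  ℂ-rawRing = record
    { Carrier = ℂ
    ; _≈_     = λ z w → re z ≈ re w × im z ≈ im w
    ; _+_     = λ z w → (re z + re w) +i (im z + im w)
    ; _*_     = λ z w →
        (re z * re w - im z * im w) +i (re z * im w + im z * re w)
    ; -_      = λ z → (- re z) +i (- im z)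
    ; 0#      = 0# +i 0#
    ; 1#      = 1# +i 0#
    }

  open RawRing ℂ-rawRing public using () renaming
    (_≈_ to _≈ᶜ_; _+_ to _+ᶜ_; _*_ to _*ᶜ_; -_ to -ᶜ_; 0# to 0ᶜ; 1# to 1ᶜ;
     +-rawMonoid to +ᶜ-rawMonoid)

  open RawMonoid +-rawMonoid public using () renaming (sum to Σ)
  open RawMonoid +ᶜ-rawMonoid public using () renaming (sum to Σᶜ)

  infixr 7 _•_
  _•_ : ℝ → ℂ → ℂ
  r • z = (r * re z) +i (r * im z)

  conj : ℂ → ℂ
  conj z = re z +i (- im z)

  ∣_∣² : ℂ → ℝ
  ∣ z ∣² = re z * re z + im z * im z

  ℂ^_ : ℕ → Set
  ℂ^ N = Vector ℂ N

  Matrix : ℕ → Set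
  Matrix N = Fin N → Fin N → ℂ

  _≈ᵛ_ : ∀ {N} → ℂ^ N → ℂ^ N → Set
  ψ ≈ᵛ φ = ∀ v → ψ v ≈ᶜ φ v

  𝟘 𝟏 : ∀ {N} → ℂ^ N
  𝟘 _ = 0ᶜ
  𝟏 _ = 1ᶜ

  basis : ∀ {N} → Fin N → ℂ^ N
  basis v w = if does (v ≟ w) then 1ᶜ else 0ᶜ

  _•ᵛ_ : ∀ {N} → ℂ → ℂ^ N → ℂ^ N
  (c •ᵛ ψ) v = c *ᶜ ψ v

  ∥_∥² : ∀ {N} → ℂ^ N → ℝ
  ∥ ψ ∥² = Σ (λ v → ∣ ψ v ∣²)

  I : ∀ {N} → Matrix N
  I = basis

  _•ᵐ_ : ∀ {N} → ℂ → Matrix N → Matrix N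
  (c •ᵐ M) v w = c *ᶜ M v w

  _*ᵐ_ : ∀ {N} → Matrix N → Matrix N → Matrix N
  (L *ᵐ M) v w = Σᶜ (λ x → L v x *ᶜ M x w)

  _*ᵛ_ : ∀ {N} → Matrix N → ℂ^ N → ℂ^ N
  (M *ᵛ ψ) v = Σᶜ (λ w → M v w *ᶜ ψ w)

  _^ᵐ_ : ∀ {N} → Matrix N → ℕ → Matrix N
  M ^ᵐ zero  = I
  M ^ᵐ suc k = M *ᵐ (M ^ᵐ k)

  -- Partial sums of the exponential series, taken entrywise.
  expSum : ∀ {N} → Matrix N → ℕ → Matrix N
  expSum M m v w = Σᶜ {m} (λ k → fromℕ (toℕ k !) ⁻¹ • (M ^ᵐ toℕ k) v w)

  exp : ∀ {N} → Matrix N → Matrix N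
  exp M v w =
    lim (λ m → re (expSum M m v w)) +i lim (λ m → im (expSum M m v w))

  IsHermitian : ∀ {N} → Matrix N → Set
  IsHermitian M = ∀ v w → M v w ≈ᶜ conj (M w v)

  IsEigenvector : ∀ {N} → Matrix N → ℂ → ℂ^ N → Set
  IsEigenvector M c ψ = ¬ ψ ≈ᵛ 𝟘 × (M *ᵛ ψ) ≈ᵛ (c •ᵛ ψ)

  -- The eigenspace is one-dimensional.  The notion is only used for Hermitian
  -- matrices, where geometric and algebraic multiplicities coincide.
  IsSimpleEigenvalue : ∀ {N} → Matrix N → ℂ → Set
  IsSimpleEigenvalue M c = ∃[ ψ ] (IsEigenvector M c ψ ×
    (∀ φ → (M *ᵛ φ) ≈ᵛ (c •ᵛ φ) → ∃[ a ] φ ≈ᵛ (a •ᵛ ψ)))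

  -- The conical vertex is zero.
  cone : ∀ {n} → Matrix n → Matrix (suc n)
  cone A zero    zero    = 0ᶜ
  cone A zero    (suc j) = 1ᶜ
  cone A (suc i) zero    = 1ᶜ
  cone A (suc i) (suc j) = A i j

  propagator : ∀ {N} → Matrix N → ℝ → Matrix N
  propagator H t = exp ((0# +i (- t)) •ᵐ H)

  projection : ∀ {N} → Fin N → Bool → Matrix N
  projection a true  v w = basis a v *ᶜ basis a w
  projection a false v w = I v w +ᶜ (-ᶜ (basis a v *ᶜ basis a w))

  outcomeProbability : ∀ {N} → Fin N → Bool → ℂ^ N → ℝ
  outcomeProbability a b ψ = ∥ projection a b *ᵛ ψ ∥²

  -- Meaningful only for outcomes of nonzero probability.
  collapse : ∀ {N} → Fin N → Bool → ℂ^ N → ℂ^ N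
  collapse a b ψ v =
    (√ (outcomeProbability a b ψ)) ⁻¹ • (projection a b *ᵛ ψ) v

  IsUniform : ∀ {N} → ℂ^ N → Set
  IsUniform {N} ψ = ∀ v → ∣ ψ v ∣² ≈ fromℕ N ⁻¹

  data Action (N : ℕ) : Set where
    stop    : Action N
    evolve  : (t : ℝ) → 0# ≤ t → Action N
    measure : Fin N → Action N

  data Event : Set where
    evolved  : Event
    observed : Bool → Event

  -- Most recent event first.
  History : Set
  History = List Event

  Protocol : ℕ → Set
  Protocol N = History → Action N

  record Config (N : ℕ) : Set where
    constructor config
    field
      history : History
      elapsed : ℝ
      state   : ℂ^ N

  open Config public

  module Run {N : ℕ} (H : Matrix N) (σ : Protocol N) where

    action : Config N → Action N
    action c = σ (history c)

    afterEvolution : ℝ → Config N → Config N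
    afterEvolution t (config h τ ψ) =
      config (evolved ∷ h) (τ + t) (propagator H t *ᵛ ψ)

    afterOutcome : Fin N → Bool → Config N → Config N
    afterOutcome a b (config h τ ψ) =
      config (observed b ∷ h) τ (collapse a b ψ)

    -- The expected value of f at the configuration reached from c after at
    -- most d steps (fewer if the protocol stops earlier).
    expectation : (Config N → ℝ) → ℕ → Config N → ℝ
    continue    : (Config N → ℝ) → ℕ → Config N → Action N → ℝ

    expectation f zero    c = f c
    expectation f (suc d) c = continue f d c (action c)

    continue f d c stop         = f c
    continue f d c (evolve t _) = expectation f d (afterEvolution t c)
    continue f d c (measure a)  = outcome true + outcome false
      where
      outcome : Bool → ℝ
      outcome b = outcomeProbability a b (state c) *
                  expectation f d (afterOutcome a b c)

    stopped : Config N → ℝ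
    stopped c with action c
    ... | stop       = 1#
    ... | evolve _ _ = 0#
    ... | measure _  = 0#

    -- The configurations occurring in a run from c₀ with positive probability.
    data Reachable (c₀ : Config N) : Config N → Set where
      start    : Reachable c₀ c₀
      evolving : ∀ {c t 0≤t} → Reachable c₀ c → action c ≡ evolve t 0≤t →
                 Reachable c₀ (afterEvolution t c)
      outcome  : ∀ {c a} b → Reachable c₀ c → action c ≡ measure a →
                 0# < outcomeProbability a b (state c) →
                 Reachable c₀ (afterOutcome a b c)

  -- The elapsed time after d steps increases with d to the total evolution
  -- time, so by monotone convergence bounding the expectation of the latter
  -- means bounding the expectation of the former for every d.
  record LasVegasUniformMixing {N : ℕ} (H : Matrix N) (u : Fin N)
                               (σ : Protocol N) (bound : ℝ) : Set where
    open Run H σ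

    initial : Config N
    initial = config [] 0# (basis u)

    field
      stopsAlmostSurely : (λ d → expectation stopped d initial) ⟶ 1#
      stopsUniformly    : ∀ c → Reachable initial c → action c ≡ stop →
                          IsUniform (state c)
      expectedTime≤     : ∀ d → expectation elapsed d initial ≤ bound

module Submission where

-- Let U be the propagator at time t of the scaled adjacency matrix of the cone.
-- The span of e₀ and 𝟏 is invariant, whence U₀₀ = cos (t / √n), and the entries
-- U₀ᵥ and Uᵥ₀ with v ≠ 0 are all equal.  Choose t ≤ 2 √n with U₀₀² = 1/(n+1); as
-- the columns of U are unit vectors, all entries of U in the row and the column
-- of the conical vertex then have squared modulus 1/(n+1).  Hence evolving e₀ for
-- time t gives a uniform state, and evolving any e_u for time t and then measuring
-- the vertices one after the other (which takes no time) finds the walk at the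
-- conical vertex with probability 1/(n+1), and otherwise at some other vertex from
-- which to start again.  The expected time is (n+2) t.

-- The protocol does not depend on `u`: even a walk that starts at the conical vertex first evolves
-- and is then searched for. The probability 1/(n + 1) of finding it there is the same from every
-- vertex, so the number of searches is geometric with mean n + 1; the last evolution, after which
-- nothing is measured, adds one more t. A search leaves a basis vector only up to a phase, hence
-- states are followed through conditions on moduli. The entries of an exponential are limits
-- inferior, of which nothing is known until convergence has been shown with an explicit rate. Since
-- factorials outgrow all powers, every series here converges geometrically, and both facts needed
-- about U rest on the same estimates: its corner is a cosine series, and its columns have norm 1 by
-- a Cauchy product. Angles up to 2 suffice because cos 2 ≤ 0; this is the source of the bound on t.
-- Expectations are available only for at most d steps. Expected time and stopping are therefore
-- both controlled by potentials, functions of the phase of the protocol that do not grow on average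
-- in a step.

open import Defs
open import Algebra.Bundles using (CommutativeRing; RawRing)
import Algebra.Properties.CommutativeSemigroup
import Algebra.Properties.Ring
import Algebra.Properties.Semiring.Mult
import Algebra.Properties.Semiring.Mult.TCOptimised
import Algebra.Properties.Semiring.Sum
import Algebra.Solver.Ring
open import Algebra.Solver.Ring.AlmostCommutativeRing
  using (fromCommutativeRing; _-Raw-AlmostCommutative⟶_)
open import Data.Bool using (Bool; true; false)
open import Data.Empty using (⊥-elim)
open import Data.Fin as Fin using (Fin; zero; suc; toℕ)
open import Data.Fin.Properties using (toℕ-fromℕ<; toℕ-injective; toℕ≤pred[n])
open import Data.List using (_∷_; [])
open import Data.Maybe using (Maybe; just; nothing)
open import Data.Nat as ℕ using (ℕ; zero; suc; _≥_; _!)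
import Data.Nat.Properties as ℕ
open import Data.Product using (_×_; _,_; proj₁; proj₂; ∃-syntax)
open import Data.Sum using (inj₁; inj₂)
open import Function using (_∘_)
open import Level using (0ℓ)
open import Relation.Binary using (Poset; IsDecTotalOrder)
open import Relation.Binary.PropositionalEquality as ≡ using (_≡_)
import Relation.Binary.Reasoning.PartialOrder
import Relation.Binary.Reasoning.Setoid
open import Relation.Nullary using (¬_; Dec; yes; no; does)
open import Relation.Nullary.Decidable using (dec-true; dec-false)

-- Coefficients are formal differences of natural numbers, so that the solver
-- cancels terms in a ring whose equality does not compute.
module IntegerSolver {c ℓ} (R : CommutativeRing c ℓ) where

  open CommutativeRing R
  open Algebra.Properties.Ring ring
  open Algebra.Properties.Semiring.Mult semiring
    using (×-homo-+; ×1-homo-*) renaming (_×_ to _·_)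
  open Algebra.Properties.Semiring.Mult.TCOptimised semiring
    using (×ᵤ≈×) renaming (_×_ to _×′_)
  open Algebra.Properties.CommutativeSemigroup +-commutativeSemigroup
    using (interchange)
  open Relation.Binary.Reasoning.Setoid setoid

  -- The solver compares coefficients of normal forms syntactically, so
  -- differences are kept in lowest terms.
  reduce : ℕ × ℕ → ℕ × ℕ
  reduce (suc a , suc b) = reduce (a , b)
  reduce p               = p

  Difference : RawRing 0ℓ 0ℓ
  Difference = record
    { Carrier = ℕ × ℕ
    ; _≈_     = _≡_
    ; _+_     = λ { (a , b) (c , d) → reduce (a ℕ.+ c , b ℕ.+ d) }
    ; _*_     = λ { (a , b) (c , d) →
        reduce (a ℕ.* c ℕ.+ b ℕ.* d , a ℕ.* d ℕ.+ b ℕ.* c) }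
    ; -_      = λ { (a , b) → b , a }
    ; 0#      = 0 , 0
    ; 1#      = 1 , 0
    }

  -- The optimised multiple and the separate case for `zero` make numerals evaluate to plain sums
  -- such as `1# + 1# + 1#`, so that solved identities fit their goals by definition.
  value : ℕ × ℕ → Carrier
  value (a , zero)  = a ×′ 1#
  value (a , suc b) = a ×′ 1# - suc b ×′ 1#

  -[x-y] : ∀ x y → - (x - y) ≈ y - x
  -[x-y] x y = begin
    - (x - y)     ≈⟨ -‿+-comm x (- y) ⟨
    - x + - - y   ≈⟨ +-congˡ (-‿involutive y) ⟩
    - x + y       ≈⟨ +-comm _ _ ⟩
    y - x         ∎

  [a+c]-[b+d] : ∀ a b c d → (a + c) - (b + d) ≈ (a - b) + (c - d)
  [a+c]-[b+d] a b c d = begin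
    (a + c) - (b + d)      ≈⟨ +-congˡ (-‿+-comm b d) ⟨
    (a + c) + (- b + - d)  ≈⟨ interchange a c (- b) (- d) ⟩
    (a - b) + (c - d)      ∎

  x[y-z] : ∀ x y z → x * (y - z) ≈ x * y - x * z
  x[y-z] x y z = trans (distribˡ x y (- z)) (+-congˡ (sym (-‿distribʳ-* x z)))

  [a-b][c-d] : ∀ a b c d →
               (a * c + b * d) - (a * d + b * c) ≈ (a - b) * (c - d)
  [a-b][c-d] a b c d = begin
    (a * c + b * d) - (a * d + b * c)   ≈⟨ [a+c]-[b+d] _ _ _ _ ⟩
    (a * c - a * d) + (b * d - b * c)   ≈⟨ +-cong (x[y-z] a c d) (x[y-z] b d c) ⟨
    a * (c - d) + b * (d - c)           ≈⟨ +-congˡ (*-congˡ (-[x-y] c d)) ⟨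
    a * (c - d) + b * - (c - d)         ≈⟨ +-congˡ (-‿distribʳ-* b _) ⟨
    a * (c - d) - b * (c - d)           ≈⟨ +-congˡ (-‿distribˡ-* b _) ⟩
    a * (c - d) + - b * (c - d)         ≈⟨ distribʳ _ a (- b) ⟨
    (a - b) * (c - d)                   ∎

  value≈ : ∀ p → value p ≈ proj₁ p · 1# - proj₂ p · 1#
  value≈ (a , zero)  = begin
    a ×′ 1#        ≈⟨ ×ᵤ≈× a 1# ⟨
    a · 1#         ≈⟨ +-identityʳ _ ⟨
    a · 1# + 0#    ≈⟨ +-congˡ -0#≈0# ⟨
    a · 1# - 0#    ∎
  value≈ (a , suc b) =
    +-cong (sym (×ᵤ≈× a 1#)) (-‿cong (sym (×ᵤ≈× (suc b) 1#)))

  value-cong : ∀ p q → proj₁ p ℕ.+ proj₂ q ≡ proj₁ q ℕ.+ proj₂ p →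
               value p ≈ value q
  value-cong p@(a , b) q@(c , d) a+d≡c+b = begin
    value p               ≈⟨ value≈ p ⟩
    A - B                 ≈⟨ +-identityʳ _ ⟨
    (A - B) + 0#          ≈⟨ +-congˡ (-‿inverseʳ D) ⟨
    (A - B) + (D - D)     ≈⟨ [a+c]-[b+d] A B D D ⟨
    (A + D) - (B + D)     ≈⟨ +-congʳ (×-homo-+ 1# a d) ⟨
    (a ℕ.+ d) · 1# - (B + D) ≈⟨ +-congʳ (reflexive (≡.cong (_· 1#) a+d≡c+b)) ⟩
    (c ℕ.+ b) · 1# - (B + D) ≈⟨ +-cong (×-homo-+ 1# c b) (-‿cong (+-comm B D)) ⟩
    (C + B) - (D + B)     ≈⟨ [a+c]-[b+d] C D B B ⟩
    (C - D) + (B - B)     ≈⟨ +-congˡ (-‿inverseʳ B) ⟩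
    (C - D) + 0#          ≈⟨ +-identityʳ _ ⟩
    C - D                 ≈⟨ value≈ q ⟨
    value q               ∎
    where
    A = a · 1#
    B = b · 1#
    C = c · 1#
    D = d · 1#

  value-reduce : ∀ p → value (reduce p) ≈ value p
  value-reduce (zero  , _)     = refl
  value-reduce (suc _ , zero)  = refl
  value-reduce (suc a , suc b) = trans (value-reduce (a , b))
    (value-cong (a , b) (suc a , suc b) (ℕ.+-suc a b))

  value-homomorphism : Difference -Raw-AlmostCommutative⟶ fromCommutativeRing R
  value-homomorphism = record
    { ⟦_⟧    = value
    ; +-homo = λ { p@(a , b) q@(c , d) → begin
        value (reduce (a ℕ.+ c , b ℕ.+ d))
          ≈⟨ value-reduce (a ℕ.+ c , b ℕ.+ d) ⟩
        value (a ℕ.+ c , b ℕ.+ d)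
          ≈⟨ value≈ (a ℕ.+ c , b ℕ.+ d) ⟩
        (a ℕ.+ c) · 1# - (b ℕ.+ d) · 1#
          ≈⟨ +-cong (×-homo-+ 1# a c) (-‿cong (×-homo-+ 1# b d)) ⟩
        (a · 1# + c · 1#) - (b · 1# + d · 1#)
          ≈⟨ [a+c]-[b+d] _ _ _ _ ⟩
        (a · 1# - b · 1#) + (c · 1# - d · 1#)
          ≈⟨ +-cong (value≈ p) (value≈ q) ⟨
        value p + value q ∎ }
    ; *-homo = λ { p@(a , b) q@(c , d) → begin
        value (reduce (a ℕ.* c ℕ.+ b ℕ.* d , a ℕ.* d ℕ.+ b ℕ.* c))
          ≈⟨ value-reduce (a ℕ.* c ℕ.+ b ℕ.* d , a ℕ.* d ℕ.+ b ℕ.* c) ⟩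
        value (a ℕ.* c ℕ.+ b ℕ.* d , a ℕ.* d ℕ.+ b ℕ.* c)
          ≈⟨ value≈ (a ℕ.* c ℕ.+ b ℕ.* d , a ℕ.* d ℕ.+ b ℕ.* c) ⟩
        (a ℕ.* c ℕ.+ b ℕ.* d) · 1# - (a ℕ.* d ℕ.+ b ℕ.* c) · 1#
          ≈⟨ +-cong (·-homo-+* a c b d) (-‿cong (·-homo-+* a d b c)) ⟩
        (a · 1# * c · 1# + b · 1# * d · 1#) - (a · 1# * d · 1# + b · 1# * c · 1#)
          ≈⟨ [a-b][c-d] _ _ _ _ ⟩
        (a · 1# - b · 1#) * (c · 1# - d · 1#)
          ≈⟨ *-cong (value≈ p) (value≈ q) ⟨
        value p * value q ∎ }
    ; -‿homo = λ { p@(a , b) → begin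
        value (b , a)           ≈⟨ value≈ (b , a) ⟩
        b · 1# - a · 1#         ≈⟨ -[x-y] _ _ ⟨
        - (a · 1# - b · 1#)     ≈⟨ -‿cong (value≈ p) ⟨
        - value p               ∎ }
    ; 0-homo = refl
    ; 1-homo = refl
    }
    where
    ·-homo-+* : ∀ a c b d → (a ℕ.* c ℕ.+ b ℕ.* d) · 1# ≈
                a · 1# * c · 1# + b · 1# * d · 1#
    ·-homo-+* a c b d = trans (×-homo-+ 1# (a ℕ.* c) (b ℕ.* d))
                              (+-cong (×1-homo-* a c) (×1-homo-* b d))

  _≟_ : (p q : ℕ × ℕ) → Maybe (value p ≈ value q)
  p ≟ q with proj₁ p ℕ.+ proj₂ q ℕ.≟ proj₁ q ℕ.+ proj₂ p
  ... | yes eq = just (value-cong p q eq)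
  ... | no  _  = nothing

  open Algebra.Solver.Ring Difference (fromCommutativeRing R)
    value-homomorphism _≟_ public
    using (solve; _:=_; _:+_; _:*_; _:-_; :-_; con; Polynomial)

  𝟘ᵖ 𝟙ᵖ 𝟚ᵖ : ∀ {m} → Polynomial m
  𝟘ᵖ = con (0 , 0)
  𝟙ᵖ = con (1 , 0)
  𝟚ᵖ = con (2 , 0)

module Development (R : CompleteOrderedField) where

  open CompleteOrderedField R hiding (zero) renaming (Carrier to ℝ)
  open MeasuredWalk R
  open IntegerSolver commutativeRing
  open Algebra.Properties.Ring ring
    using (-0#≈0#; -‿involutive; -‿distribʳ-*; -‿+-comm)
  open Algebra.Properties.Semiring.Mult semiring using (×-homo-+; ×1-homo-*)
  open Algebra.Properties.Semiring.Sum semiring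
    using (sum-cong-≋; ∑-distrib-+; ∑-comm; *-distribˡ-sum; *-distribʳ-sum; sum-replicate-zero)
  module O = IsDecTotalOrder isDecTotalOrder

  -- Ordered fields

  ≤-poset : Poset _ _ _
  ≤-poset = record { isPartialOrder = O.isPartialOrder }

  open Relation.Binary.Reasoning.PartialOrder ≤-poset hiding (start; stop)

  -- Plays the role of ∣x∣ ≤ c; a pair of inequalities spares the case distinctions of an absolute
  -- value.
  infix 4 _∈±_
  _∈±_ : ℝ → ℝ → Set
  x ∈± c = - c ≤ x × x ≤ c

  -- Turns an inequality into a ring identity: one names the difference d, shows it nonnegative, and
  -- leaves the rest to the solver.
  ≤-by : ∀ {x y} d → 0# ≤ d → y ≈ x + d → x ≤ y
  ≤-by {x} {y} d 0≤d y≈x+d = begin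
    x       ≈⟨ +-identityʳ x ⟨
    x + 0#  ≤⟨ +-monoʳ-≤ x 0≤d ⟩
    x + d   ≈⟨ y≈x+d ⟨
    y       ∎

  x≤y⇒0≤y-x : ∀ {x y} → x ≤ y → 0# ≤ y - x
  x≤y⇒0≤y-x {x} {y} x≤y = begin
    0#     ≈⟨ -‿inverseˡ x ⟨
    - x + x ≤⟨ +-monoʳ-≤ (- x) x≤y ⟩
    - x + y ≈⟨ +-comm _ _ ⟩
    y - x ∎

  +-mono-≤ : ∀ {a b c d} → a ≤ b → c ≤ d → a + c ≤ b + d
  +-mono-≤ {a} {b} {c} {d} a≤b c≤d = begin
    a + c ≤⟨ +-monoʳ-≤ a c≤d ⟩
    a + d ≈⟨ +-comm a d ⟩
    d + a ≤⟨ +-monoʳ-≤ d a≤b ⟩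
    d + b ≈⟨ +-comm d b ⟩
    b + d ∎

  +-nonNegative : ∀ {x y} → 0# ≤ x → 0# ≤ y → 0# ≤ x + y
  +-nonNegative {x} {y} 0≤x 0≤y = O.trans 0≤x (≤-by y 0≤y refl)

  -‿anti-≤ : ∀ {x y} → x ≤ y → - y ≤ - x
  -‿anti-≤ {x} {y} x≤y = ≤-by (y - x) (x≤y⇒0≤y-x x≤y)
    (solve 2 (λ x y → :- x := :- y :+ (y :- x)) refl x y)

  *-monoˡ-≤ : ∀ {x y z} → 0# ≤ z → x ≤ y → z * x ≤ z * y
  *-monoˡ-≤ {x} {y} {z} 0≤z x≤y =
    ≤-by (z * (y - x)) (*-nonNegative 0≤z (x≤y⇒0≤y-x x≤y))
      (solve 3 (λ x y z → z :* y := z :* x :+ z :* (y :- x)) refl x y z)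

  *-mono-≤ : ∀ {a b c d} → 0# ≤ a → 0# ≤ d → a ≤ b → c ≤ d → a * c ≤ b * d
  *-mono-≤ {a} {b} {c} {d} 0≤a 0≤d a≤b c≤d = begin
    a * c ≤⟨ *-monoˡ-≤ 0≤a c≤d ⟩
    a * d ≈⟨ *-comm a d ⟩
    d * a ≤⟨ *-monoˡ-≤ 0≤d a≤b ⟩
    d * b ≈⟨ *-comm d b ⟩
    b * d ∎

  x≤0⇒0≤-x : ∀ {x} → x ≤ 0# → 0# ≤ - x
  x≤0⇒0≤-x x≤0 = O.trans (O.reflexive (sym -0#≈0#)) (-‿anti-≤ x≤0)

  0≤x⇒-x≤0 : ∀ {x} → 0# ≤ x → - x ≤ 0#
  0≤x⇒-x≤0 0≤x = O.trans (-‿anti-≤ 0≤x) (O.reflexive -0#≈0#)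

  0≤x² : ∀ x → 0# ≤ x * x
  0≤x² x with O.total 0# x
  ... | inj₁ 0≤x = *-nonNegative 0≤x 0≤x
  ... | inj₂ x≤0 = begin
    0#        ≤⟨ *-nonNegative (x≤0⇒0≤-x x≤0) (x≤0⇒0≤-x x≤0) ⟩
    - x * - x ≈⟨ solve 1 (λ x → :- x :* :- x := x :* x) refl x ⟩
    x * x     ∎

  0≤1 : 0# ≤ 1#
  0≤1 = O.trans (0≤x² 1#) (O.reflexive (*-identityˡ 1#))

  0<1 : 0# < 1#
  0<1 = 0≤1 , 0≉1

  ≰⇒> : ∀ {x y} → ¬ x ≤ y → y < x
  ≰⇒> {x} {y} x≰y with O.total x y
  ... | inj₁ x≤y = ⊥-elim (x≰y x≤y)
  ... | inj₂ y≤x = y≤x , λ y≈x → x≰y (O.reflexive (sym y≈x))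

  <⇒≱ : ∀ {x y} → x < y → ¬ y ≤ x
  <⇒≱ (x≤y , x≉y) y≤x = x≉y (O.antisym x≤y y≤x)

  ≮⇒≥ : ∀ {x y} → ¬ x < y → y ≤ x
  ≮⇒≥ {x} {y} x≮y with y O.≤? x
  ... | yes y≤x = y≤x
  ... | no  y≰x = ⊥-elim (x≮y (≰⇒> y≰x))

  <-≤-trans : ∀ {x y z} → x < y → y ≤ z → x < z
  <-≤-trans x<y y≤z = O.trans (proj₁ x<y) y≤z ,
    λ x≈z → <⇒≱ x<y (O.trans y≤z (O.reflexive (sym x≈z)))

  0<x⇒x≉0 : ∀ {x} → 0# < x → ¬ x ≈ 0#
  0<x⇒x≉0 (_ , 0≉x) x≈0 = 0≉x (sym x≈0)

  0≤x∧x≉0⇒0<x : ∀ {x} → 0# ≤ x → ¬ x ≈ 0# → 0# < x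
  0≤x∧x≉0⇒0<x 0≤x x≉0 = 0≤x , λ 0≈x → x≉0 (sym 0≈x)

  xy≈0⇒y≈0 : ∀ {x y} → ¬ x ≈ 0# → x * y ≈ 0# → y ≈ 0#
  xy≈0⇒y≈0 {x} {y} x≉0 xy≈0 = begin-equality
    y                ≈⟨ *-identityˡ y ⟨
    1# * y           ≈⟨ *-congʳ (⁻¹-inverseʳ x x≉0) ⟨
    x * x ⁻¹ * y     ≈⟨ solve 3 (λ x z y → x :* z :* y := z :* (x :* y)) refl x (x ⁻¹) y ⟩
    x ⁻¹ * (x * y)   ≈⟨ *-congˡ xy≈0 ⟩
    x ⁻¹ * 0#        ≈⟨ zeroʳ _ ⟩
    0#               ∎

  *-cancelˡ : ∀ {x y z} → ¬ x ≈ 0# → x * y ≈ x * z → y ≈ z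
  *-cancelˡ {x} {y} {z} x≉0 xy≈xz = begin-equality
    y            ≈⟨ solve 2 (λ y z → y := (y :- z) :+ z) refl y z ⟩
    (y - z) + z  ≈⟨ +-congʳ (xy≈0⇒y≈0 x≉0 x[y-z]≈0) ⟩
    0# + z       ≈⟨ +-identityˡ z ⟩
    z            ∎
    where
    x[y-z]≈0 : x * (y - z) ≈ 0#
    x[y-z]≈0 = begin-equality
      x * (y - z)    ≈⟨ solve 3 (λ x y z → x :* (y :- z) := x :* y :- x :* z) refl x y z ⟩
      x * y - x * z  ≈⟨ +-congʳ xy≈xz ⟩
      x * z - x * z  ≈⟨ -‿inverseʳ _ ⟩
      0#             ∎

  *-positive : ∀ {x y} → 0# < x → 0# < y → 0# < x * y
  *-positive 0<x 0<y = 0≤x∧x≉0⇒0<x (*-nonNegative (proj₁ 0<x) (proj₁ 0<y))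
    (0<x⇒x≉0 0<y ∘ xy≈0⇒y≈0 (0<x⇒x≉0 0<x))

  *-cancelˡ-≤ : ∀ {x y z} → 0# < x → x * y ≤ x * z → y ≤ z
  *-cancelˡ-≤ {x} {y} {z} 0<x xy≤xz with y O.≤? z
  ... | yes y≤z = y≤z
  ... | no  y≰z with ≰⇒> y≰z
  ...   | z≤y , z≉y = ⊥-elim (z≉y (*-cancelˡ (0<x⇒x≉0 0<x)
                        (O.antisym (*-monoˡ-≤ (proj₁ 0<x) z≤y) xy≤xz)))

  ⁻¹-positive : ∀ {x} → 0# < x → 0# < x ⁻¹
  ⁻¹-positive {x} 0<x = ≰⇒> λ x⁻¹≤0 → <⇒≱ 0<1 (begin
    1#         ≈⟨ ⁻¹-inverseʳ x (0<x⇒x≉0 0<x) ⟨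
    x * x ⁻¹   ≤⟨ *-monoˡ-≤ (proj₁ 0<x) x⁻¹≤0 ⟩
    x * 0#     ≈⟨ zeroʳ x ⟩
    0#         ∎)

  ⁻¹-unique : ∀ {x y} → ¬ x ≈ 0# → x * y ≈ 1# → y ≈ x ⁻¹
  ⁻¹-unique {x} x≉0 xy≈1 = *-cancelˡ x≉0 (trans xy≈1 (sym (⁻¹-inverseʳ x x≉0)))

  x²-injective : ∀ {x y} → 0# ≤ x → 0# ≤ y → x * x ≤ y * y → x ≤ y
  x²-injective {x} {y} 0≤x 0≤y x²≤y² with x O.≤? y
  ... | yes x≤y = x≤y
  ... | no  x≰y = ⊥-elim (<⇒≱ (≰⇒> x≰y) (*-cancelˡ-≤ 0<x+y (begin
    (x + y) * x           ≈⟨ solve 2 (λ x y → (x :+ y) :* x := x :* x :+ x :* y) refl x y ⟩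
    x * x + x * y         ≤⟨ +-mono-≤ x²≤y² O.refl ⟩
    y * y + x * y         ≈⟨ solve 2 (λ x y → y :* y :+ x :* y := (x :+ y) :* y) refl x y ⟩
    (x + y) * y           ∎)))
    where
    0<x+y : 0# < x + y
    0<x+y = <-≤-trans (0≤x∧x≉0⇒0<x 0≤x (λ x≈0 →
        x≰y (O.trans (O.reflexive x≈0) 0≤y)))
      (≤-by y 0≤y refl)

  ∈±-cong : ∀ {x y c} → x ≈ y → x ∈± c → y ∈± c
  ∈±-cong x≈y (l , u) =
    O.trans l (O.reflexive x≈y) , O.trans (O.reflexive (sym x≈y)) u

  ∈±-weaken : ∀ {x c d} → c ≤ d → x ∈± c → x ∈± d
  ∈±-weaken c≤d (l , u) = O.trans (-‿anti-≤ c≤d) l , O.trans u c≤d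

  ∈±⇒0≤ : ∀ {x c} → x ∈± c → 0# ≤ c
  ∈±⇒0≤ {x} {c} (l , u) with O.total 0# c
  ... | inj₁ 0≤c = 0≤c
  ... | inj₂ c≤0 = O.trans (x≤0⇒0≤-x c≤0) (O.trans l u)

  0∈± : ∀ {c} → 0# ≤ c → 0# ∈± c
  0∈± 0≤c = 0≤x⇒-x≤0 0≤c , 0≤c

  ∈±-self : ∀ {x} → 0# ≤ x → x ∈± x
  ∈±-self 0≤x = O.trans (0≤x⇒-x≤0 0≤x) 0≤x , O.refl

  +-∈± : ∀ {x y c d} → x ∈± c → y ∈± d → x + y ∈± c + d
  +-∈± {c = c} {d} (l₁ , u₁) (l₂ , u₂) =
    O.trans (O.reflexive (sym (-‿+-comm c d))) (+-mono-≤ l₁ l₂) , +-mono-≤ u₁ u₂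

  -‿∈± : ∀ {x c} → x ∈± c → - x ∈± c
  -‿∈± (l , u) = -‿anti-≤ u , O.trans (-‿anti-≤ l) (O.reflexive (-‿involutive _))

  -- No distinction of signs is needed: 2(cd - xy) and 2(cd + xy) are sums of products of the
  -- nonnegative numbers c ± x and d ± y.
  *-∈± : ∀ {x y c d} → x ∈± c → y ∈± d → x * y ∈± c * d
  *-∈± {x} {y} {c} {d} (l₁ , u₁) (l₂ , u₂) = lower , upper
    where
    0≤c-x : 0# ≤ c - x
    0≤c-x = x≤y⇒0≤y-x u₁
    0≤c+x : 0# ≤ x - - c
    0≤c+x = x≤y⇒0≤y-x l₁
    0≤d-y : 0# ≤ d - y
    0≤d-y = x≤y⇒0≤y-x u₂
    0≤d+y : 0# ≤ y - - d
    0≤d+y = x≤y⇒0≤y-x l₂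
    0<2 : 0# < 1# + 1#
    0<2 = <-≤-trans 0<1 (≤-by 1# 0≤1 refl)
    upper : x * y ≤ c * d
    upper = *-cancelˡ-≤ 0<2
      (≤-by ((c - x) * (y - - d) + (x - - c) * (d - y))
        (+-nonNegative (*-nonNegative 0≤c-x 0≤d+y) (*-nonNegative 0≤c+x 0≤d-y))
        (solve 4 (λ x y c d → 𝟚ᵖ :* (c :* d) := 𝟚ᵖ :* (x :* y) :+
            ((c :- x) :* (y :- :- d) :+ (x :- :- c) :* (d :- y)))
          refl x y c d))
    lower : - (c * d) ≤ x * y
    lower = *-cancelˡ-≤ 0<2
      (≤-by ((c - x) * (d - y) + (x - - c) * (y - - d))
        (+-nonNegative (*-nonNegative 0≤c-x 0≤d-y) (*-nonNegative 0≤c+x 0≤d+y))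
        (solve 4 (λ x y c d → 𝟚ᵖ :* (x :* y) := 𝟚ᵖ :* (:- (c :* d)) :+
            ((c :- x) :* (d :- y) :+ (x :- :- c) :* (y :- :- d)))
          refl x y c d))

  bounded : ∀ x → ∃[ c ] x ∈± c
  bounded x with O.total 0# x
  ... | inj₁ 0≤x = x , ∈±-self 0≤x
  ... | inj₂ x≤0 = - x , ∈±-cong (-‿involutive x) (-‿∈± (∈±-self (x≤0⇒0≤-x x≤0)))

  0≤fromℕ : ∀ n → 0# ≤ fromℕ n
  0≤fromℕ zero    = O.refl
  0≤fromℕ (suc n) = +-nonNegative 0≤1 (0≤fromℕ n)

  0<fromℕ : ∀ n → 0# < fromℕ (suc n)
  0<fromℕ n = <-≤-trans 0<1 (≤-by (fromℕ n) (0≤fromℕ n) refl)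

  fromℕ-+ : ∀ m n → fromℕ (m ℕ.+ n) ≈ fromℕ m + fromℕ n
  fromℕ-+ = ×-homo-+ 1#

  fromℕ-* : ∀ m n → fromℕ (m ℕ.* n) ≈ fromℕ m * fromℕ n
  fromℕ-* = ×1-homo-*

  fromℕ-mono : ∀ {m n} → m ℕ.≤ n → fromℕ m ≤ fromℕ n
  fromℕ-mono {m} {n} m≤n = ≤-by (fromℕ (n ℕ.∸ m)) (0≤fromℕ (n ℕ.∸ m))
    (trans (reflexive (≡.cong fromℕ (≡.sym (ℕ.m+[n∸m]≡n m≤n)))) (fromℕ-+ m _))

  -- The shift by one keeps the denominator positive without a side condition, and makes `ι n` the
  -- probability 1/(n + 1) of the walk.
  ι : ℕ → ℝ
  ι k = fromℕ (suc k) ⁻¹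

  0<ι : ∀ k → 0# < ι k
  0<ι k = ⁻¹-positive (0<fromℕ k)

  fromℕ*ι : ∀ k → fromℕ (suc k) * ι k ≈ 1#
  fromℕ*ι k = ⁻¹-inverseʳ _ (0<x⇒x≉0 (0<fromℕ k))

  ι-anti : ∀ {j k} → j ℕ.≤ k → ι k ≤ ι j
  ι-anti {j} {k} j≤k = *-cancelˡ-≤ (0<fromℕ j) (*-cancelˡ-≤ (0<fromℕ k) (begin
    fromℕ (suc k) * (fromℕ (suc j) * ι k) ≈⟨ solve 3 (λ a b c → a :* (b :* c) := b :* (a :* c)) refl _ _ _ ⟩
    fromℕ (suc j) * (fromℕ (suc k) * ι k) ≈⟨ *-congˡ (fromℕ*ι k) ⟩
    fromℕ (suc j) * 1#                    ≤⟨ *-mono-≤ (0≤fromℕ (suc j)) 0≤1 j≤k′ O.refl ⟩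
    fromℕ (suc k) * 1#                    ≈⟨ *-congˡ (fromℕ*ι j) ⟨
    fromℕ (suc k) * (fromℕ (suc j) * ι j) ∎))
    where
    j≤k′ : fromℕ (suc j) ≤ fromℕ (suc k)
    j≤k′ = fromℕ-mono (ℕ.s≤s j≤k)

  ι≤1 : ∀ k → ι k ≤ 1#
  ι≤1 k = begin
    ι k            ≤⟨ ι-anti {0} {k} ℕ.z≤n ⟩
    ι 0            ≈⟨ solve 1 (λ i → i := (𝟙ᵖ :+ 𝟘ᵖ) :* i) refl (ι 0) ⟩
    fromℕ 1 * ι 0  ≈⟨ fromℕ*ι 0 ⟩
    1#             ∎

  h : ℝ
  h = ι 1

  h+h≈1 : h + h ≈ 1#
  h+h≈1 = trans (solve 1 (λ h → h :+ h := (𝟙ᵖ :+ (𝟙ᵖ :+ 𝟘ᵖ)) :* h) refl h) (fromℕ*ι 1)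

  infixr 8 _^_
  _^_ : ℝ → ℕ → ℝ
  x ^ zero  = 1#
  x ^ suc k = x * x ^ k

  ^-nonNegative : ∀ {x} → 0# ≤ x → ∀ k → 0# ≤ x ^ k
  ^-nonNegative 0≤x zero    = 0≤1
  ^-nonNegative 0≤x (suc k) = *-nonNegative 0≤x (^-nonNegative 0≤x k)

  *-^ : ∀ x y k → (x * y) ^ k ≈ x ^ k * y ^ k
  *-^ x y zero    = sym (*-identityˡ 1#)
  *-^ x y (suc k) = trans (*-congˡ (*-^ x y k))
    (solve 4 (λ x y a b → (x :* y) :* (a :* b) := (x :* a) :* (y :* b)) refl x y _ _)

  ^-cong : ∀ {x y} k → x ≈ y → x ^ k ≈ y ^ k
  ^-cong zero    x≈y = refl
  ^-cong (suc k) x≈y = *-cong x≈y (^-cong k x≈y)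

  0≤h : 0# ≤ h
  0≤h = proj₁ (0<ι 1)

  0≤h^ : ∀ k → 0# ≤ h ^ k
  0≤h^ = ^-nonNegative 0≤h

  -- Induction with k + 2 ≤ 2(k + 1). This links geometric decay to the Archimedean axiom, and
  -- absorbs the factor m in `square⇝1`.
  h^-bound : ∀ k → h ^ k * fromℕ (suc k) ≤ 1#
  h^-bound zero    = O.reflexive (solve 0 (𝟙ᵖ :* (𝟙ᵖ :+ 𝟘ᵖ) := 𝟙ᵖ) refl)
  h^-bound (suc k) = begin
    h * h ^ k * (1# + N)           ≤⟨ ≤-by (h * h ^ k * fromℕ k) (*-nonNegative (0≤h^ (suc k)) (0≤fromℕ k))
      (solve 3 (λ h x k → (h :+ h) :* (x :* (𝟙ᵖ :+ k)) := h :* x :* (𝟙ᵖ :+ (𝟙ᵖ :+ k)) :+ h :* x :* k) refl h (h ^ k) (fromℕ k)) ⟩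
    (h + h) * (h ^ k * N)          ≤⟨ *-mono-≤ (+-nonNegative 0≤h 0≤h) 0≤1 (O.reflexive h+h≈1) (h^-bound k) ⟩
    1# * 1#                        ≈⟨ *-identityˡ 1# ⟩
    1#                             ∎
    where
    N : ℝ
    N = fromℕ (suc k)

  -- If x were positive, some N would satisfy K ≤ xN, whereas the hypothesis at N and `h^-bound`
  -- give x(N + 1) ≤ K.
  ≤h^⇒≤0 : ∀ {x K} → (∀ k → x ≤ K * h ^ k) → x ≤ 0#
  ≤h^⇒≤0 {x} {K} x≤ = ≮⇒≥ λ 0<x →
    let N , Kx⁻¹≤N = archimedean (K * x ⁻¹)
        0≤K = begin
          0#       ≤⟨ proj₁ 0<x ⟩
          x        ≤⟨ x≤ 0 ⟩
          K * 1#   ≈⟨ *-identityʳ K ⟩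
          K        ∎
        K≤xN = begin
          K              ≈⟨ *-identityʳ K ⟨
          K * 1#         ≈⟨ *-congˡ (⁻¹-inverseʳ x (0<x⇒x≉0 0<x)) ⟨
          K * (x * x ⁻¹) ≈⟨ solve 3 (λ K x y → K :* (x :* y) := x :* (K :* y)) refl K x (x ⁻¹) ⟩
          x * (K * x ⁻¹) ≤⟨ *-monoˡ-≤ (proj₁ 0<x) Kx⁻¹≤N ⟩
          x * fromℕ N    ∎
        x+K≤K = begin
          x + K                         ≤⟨ +-mono-≤ O.refl K≤xN ⟩
          x + x * fromℕ N               ≈⟨ solve 2 (λ x n → x :+ x :* n := x :* (𝟙ᵖ :+ n)) refl x (fromℕ N) ⟩
          x * fromℕ (suc N)             ≤⟨ *-mono-≤ (proj₁ 0<x) (0≤fromℕ (suc N)) (x≤ N) O.refl ⟩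
          K * h ^ N * fromℕ (suc N)     ≈⟨ *-assoc _ _ _ ⟩
          K * (h ^ N * fromℕ (suc N))   ≤⟨ *-monoˡ-≤ 0≤K (h^-bound N) ⟩
          K * 1#                        ≈⟨ *-identityʳ K ⟩
          K                             ∎
    in <⇒≱ 0<x (begin
          x             ≈⟨ solve 2 (λ x K → x := (x :+ K) :- K) refl x K ⟩
          (x + K) - K   ≤⟨ +-mono-≤ x+K≤K O.refl ⟩
          K - K         ≈⟨ -‿inverseʳ K ⟩
          0#            ∎)

  -- Convergence at a geometric rate

  ∑ : ℕ → (ℕ → ℝ) → ℝ
  ∑ m f = Σ {m} (λ k → f (toℕ k))

  ∑-cong : ∀ m {f g : ℕ → ℝ} → (∀ k → f k ≈ g k) → ∑ m f ≈ ∑ m g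
  ∑-cong m f≈g = sum-cong-≋ {m} (λ k → f≈g (toℕ k))

  ∑-last : ∀ m f → ∑ (suc m) f ≈ ∑ m f + f m
  ∑-last zero    f = +-comm _ _
  ∑-last (suc m) f = trans (+-congˡ (∑-last m (f ∘ suc))) (sym (+-assoc _ _ _))

  ∑-increment : ∀ m f → f m ≈ ∑ (suc m) f - ∑ m f
  ∑-increment m f = trans (solve 2 (λ s x → x := (s :+ x) :- s) refl (∑ m f) (f m))
    (+-congʳ (sym (∑-last m f)))

  Σ-∈± : ∀ {N} {f : Fin N → ℝ} {c} → (∀ v → f v ∈± c) → Σ f ∈± fromℕ N * c
  Σ-∈± {zero}          f∈ = 0∈± (O.reflexive (sym (zeroˡ _)))
  Σ-∈± {suc N} {f} {c} f∈ = ∈±-weaken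
    (O.reflexive (solve 2 (λ c n → c :+ n :* c := (𝟙ᵖ :+ n) :* c) refl c (fromℕ N)))
    (+-∈± (f∈ zero) (Σ-∈± (f∈ ∘ suc)))

  Σ-nonNegative : ∀ {N} {f : Fin N → ℝ} → (∀ v → 0# ≤ f v) → 0# ≤ Σ f
  Σ-nonNegative {zero}  0≤f = O.refl
  Σ-nonNegative {suc N} 0≤f = +-nonNegative (0≤f zero) (Σ-nonNegative (0≤f ∘ suc))

  Σ-neg : ∀ {N} (f : Fin N → ℝ) → Σ (λ v → - f v) ≈ - Σ f
  Σ-neg {zero}  f = sym -0#≈0#
  Σ-neg {suc N} f = trans (+-congˡ (Σ-neg (f ∘ suc))) (-‿+-comm _ _)

  -- Monotone sequences need not converge constructively, so limits come with a
  -- geometric rate.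
  infix 4 _⇝_
  _⇝_ : (ℕ → ℝ) → ℝ → Set
  a ⇝ l = ∃[ K ] (∀ m → a m - l ∈± K * h ^ m)

  ⇝-cong : ∀ {a b l} → (∀ m → a m ≈ b m) → a ⇝ l → b ⇝ l
  ⇝-cong a≈b (K , a-l∈) = K , λ m → ∈±-cong (+-congʳ (a≈b m)) (a-l∈ m)

  ⇝-const : ∀ c → (λ _ → c) ⇝ c
  ⇝-const c = 0# , λ m → ∈±-cong (sym (-‿inverseʳ c)) (0∈± (O.reflexive (sym (zeroˡ _))))

  ⇝-+ : ∀ {a b l k} → a ⇝ l → b ⇝ k → (λ m → a m + b m) ⇝ l + k
  ⇝-+ {a} {b} {l} {k} (K , a-l∈) (L , b-k∈) = K + L , λ m →
    ∈±-weaken (O.reflexive (sym (distribʳ _ K L)))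
      (∈±-cong (solve 4 (λ a b l k → (a :- l) :+ (b :- k) := (a :+ b) :- (l :+ k)) refl (a m) (b m) l k)
        (+-∈± (a-l∈ m) (b-k∈ m)))

  ⇝-neg : ∀ {a l} → a ⇝ l → (λ m → - a m) ⇝ - l
  ⇝-neg {a} {l} (K , a-l∈) = K , λ m →
    ∈±-cong (sym (-‿+-comm (a m) (- l))) (-‿∈± (a-l∈ m))

  h^≤1 : ∀ m → h ^ m ≤ 1#
  h^≤1 m = begin
    h ^ m                    ≤⟨ ≤-by (h ^ m * fromℕ m) (*-nonNegative (0≤h^ m) (0≤fromℕ m))
      (solve 2 (λ x n → x :* (𝟙ᵖ :+ n) := x :+ x :* n) refl (h ^ m) (fromℕ m)) ⟩
    h ^ m * fromℕ (suc m)    ≤⟨ h^-bound m ⟩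
    1#                       ∎

  ⇝-bounded : ∀ {a l} → a ⇝ l → ∃[ c ] (∀ m → a m ∈± c)
  ⇝-bounded {a} {l} (K , a-l∈) with bounded l
  ... | c , l∈ = K + c , λ m →
    ∈±-cong (solve 2 (λ a l → (a :- l) :+ l := a) refl (a m) l)
      (+-∈± (∈±-weaken (O.trans (*-monoˡ-≤ 0≤K (h^≤1 m)) (O.reflexive (*-identityʳ K))) (a-l∈ m)) l∈)
    where
    0≤K : 0# ≤ K
    0≤K = O.trans (∈±⇒0≤ (a-l∈ 0)) (O.reflexive (*-identityʳ K))

  ⇝-* : ∀ {a b l k} → a ⇝ l → b ⇝ k → (λ m → a m * b m) ⇝ l * k
  ⇝-* {a} {b} {l} {k} (K , a-l∈) b⇝k@(L , b-k∈) = K * c + d * L , λ m →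
    ∈±-weaken (O.reflexive (solve 5 (λ K c d L x → K :* x :* c :+ d :* (L :* x) := (K :* c :+ d :* L) :* x) refl K c d L (h ^ m)))
      (∈±-cong (solve 4 (λ a b l k → (a :- l) :* b :+ l :* (b :- k) := a :* b :- l :* k) refl (a m) (b m) l k)
        (+-∈± (*-∈± (a-l∈ m) (proj₂ (⇝-bounded b⇝k) m)) (*-∈± (proj₂ (bounded l)) (b-k∈ m))))
    where
    c d : ℝ
    c = proj₁ (⇝-bounded b⇝k)
    d = proj₁ (bounded l)

  ⇝-Σ : ∀ {N} {a : Fin N → ℕ → ℝ} {l : Fin N → ℝ} → (∀ v → a v ⇝ l v) →
        (λ m → Σ (λ v → a v m)) ⇝ Σ l
  ⇝-Σ {zero}  a⇝l = ⇝-const 0#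
  ⇝-Σ {suc N} a⇝l = ⇝-+ (a⇝l zero) (⇝-Σ (a⇝l ∘ suc))

  ⇝-≤ : ∀ {a l c} → a ⇝ l → (∀ m → a m ≤ c) → l ≤ c
  ⇝-≤ {a} {l} {c} (K , a-l∈) a≤c =
    ≤-by (- (l - c)) (x≤0⇒0≤-x (≤h^⇒≤0 {K = K} λ m → begin
      l - c               ≈⟨ solve 3 (λ l c a → l :- c := (a :- c) :- (a :- l)) refl l c (a m) ⟩
      (a m - c) - (a m - l) ≤⟨ +-mono-≤ (a-c≤0 m) (proj₂ (-‿∈± (a-l∈ m))) ⟩
      0# + K * h ^ m      ≈⟨ +-identityˡ _ ⟩
      K * h ^ m           ∎))
      (solve 2 (λ l c → c := l :+ :- (l :- c)) refl l c)
    where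
    a-c≤0 : ∀ m → a m - c ≤ 0#
    a-c≤0 m = O.trans (+-mono-≤ (a≤c m) O.refl) (O.reflexive (-‿inverseʳ c))

  ⇝-∈± : ∀ {a l c} → a ⇝ l → (∀ m → a m ∈± c) → l ∈± c
  ⇝-∈± {l = l} a⇝l a∈ =
    O.trans (-‿anti-≤ (⇝-≤ (⇝-neg a⇝l) (proj₂ ∘ -‿∈± ∘ a∈))) (O.reflexive (-‿involutive l)) ,
    ⇝-≤ a⇝l (proj₂ ∘ a∈)

  ⇝-unique : ∀ {a l k} → a ⇝ l → a ⇝ k → l ≈ k
  ⇝-unique {a} {l} {k} a⇝l a⇝k = begin-equality
    l            ≈⟨ solve 2 (λ l k → l := (l :+ :- k) :+ k) refl l k ⟩
    (l - k) + k  ≈⟨ +-congʳ (O.antisym (proj₂ l-k∈) (O.trans (O.reflexive (sym -0#≈0#)) (proj₁ l-k∈))) ⟩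
    0# + k       ≈⟨ +-identityˡ k ⟩
    k            ∎
    where
    l-k∈ : l - k ∈± 0#
    l-k∈ = ⇝-∈± (⇝-+ a⇝l (⇝-neg a⇝k)) (λ m → ∈±-cong (sym (-‿inverseʳ (a m))) (0∈± O.refl))

  ⇝-subsequence : ∀ {a l} {s : ℕ → ℕ} → (∀ m → m ℕ.≤ s m) → a ⇝ l → (a ∘ s) ⇝ l
  ⇝-subsequence {a} {l} {s} m≤s (K , a-l∈) = K , λ m →
    ∈±-weaken (*-monoˡ-≤ 0≤K (h^-anti (m≤s m))) (a-l∈ (s m))
    where
    0≤K : 0# ≤ K
    0≤K = O.trans (∈±⇒0≤ (a-l∈ 0)) (O.reflexive (*-identityʳ K))
    h^-anti : ∀ {j k} → j ℕ.≤ k → h ^ k ≤ h ^ j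
    h^-anti {k = k} ℕ.z≤n = h^≤1 k
    h^-anti (ℕ.s≤s j≤k)   = *-monoˡ-≤ 0≤h (h^-anti j≤k)

  -- The increments from m on add up to at most K q^m / (1 - q), and 1 / (1 - q) ≤ 2 because q ≤
  -- 1/2.
  geometric-tail : ∀ {a : ℕ → ℝ} {q K} → 0# ≤ q → q ≤ h → 0# ≤ K →
                   (∀ m → a (suc m) - a m ∈± K * q ^ m) →
                   ∀ {m n} → m ℕ.≤ n → a n - a m ∈± (K + K) * q ^ m
  geometric-tail {a} {q} {K} 0≤q q≤h 0≤K step {m} {n} m≤n =
    ≡.subst (λ i → a i - a m ∈± (K + K) * q ^ m) (ℕ.m∸n+n≡m m≤n) (tail (n ℕ.∸ m))
    where
    -- The subtracted power makes the induction close: one more increment K x is paid for by 2K (x -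
    -- q x).
    go : ∀ n → a (n ℕ.+ m) - a m ∈± (K + K) * (q ^ m - q ^ (n ℕ.+ m))
    go zero    = ∈±-cong (sym (-‿inverseʳ (a m)))
      (0∈± (O.reflexive (solve 2 (λ K x → 𝟘ᵖ := (K :+ K) :* (x :- x)) refl K (q ^ m))))
    go (suc n) = ∈±-cong
      (solve 3 (λ x y z → (x :- y) :+ (y :- z) := x :- z) refl (a (suc n ℕ.+ m)) (a (n ℕ.+ m)) (a m))
      (∈±-weaken
        (≤-by ((K + K) * (x * (h - q))) (*-nonNegative (+-nonNegative 0≤K 0≤K)
            (*-nonNegative (^-nonNegative 0≤q (n ℕ.+ m)) (x≤y⇒0≤y-x q≤h)))
          (begin-equality
            (K + K) * (q ^ m - q * x)
              -- The summand with 1 - (h + h) is singled out because its vanishing is not a ring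
              -- identity.
              ≈⟨ solve 5 (λ K p q x h → (K :+ K) :* (p :- q :* x) :=
                   K :* x :* (𝟙ᵖ :- (h :+ h)) :+ (K :* x :+ (K :+ K) :* (p :- x) :+ (K :+ K) :* (x :* (h :- q))))
                   refl K (q ^ m) q x h ⟩
            K * x * (1# - (h + h)) + rest
              ≈⟨ +-congʳ (trans (*-congˡ (trans (+-congˡ (-‿cong h+h≈1)) (-‿inverseʳ 1#))) (zeroʳ _)) ⟩
            0# + rest
              ≈⟨ +-identityˡ rest ⟩
            rest ∎))
        (+-∈± (step (n ℕ.+ m)) (go n)))
      where
      x : ℝ
      x = q ^ (n ℕ.+ m)
      rest : ℝ
      rest = (K * x + (K + K) * (q ^ m - x)) + (K + K) * (x * (h - q))

    tail : ∀ n → a (n ℕ.+ m) - a m ∈± (K + K) * q ^ m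
    tail n = ∈±-weaken
      (*-monoˡ-≤ (+-nonNegative 0≤K 0≤K)
        (≤-by (q ^ (n ℕ.+ m)) (^-nonNegative 0≤q (n ℕ.+ m))
          (solve 2 (λ x y → x := (x :- y) :+ y) refl (q ^ m) (q ^ (n ℕ.+ m)))))
      (go n)

  -- The limit is the supremum of the eventual lower bounds of a. For every m, a m minus the tail
  -- bound is one of them, and a m plus the tail bound exceeds them all, which encloses the
  -- supremum.
  cauchy⇒⇝lim : ∀ {a K} → 0# ≤ K → (∀ m → a (suc m) - a m ∈± K * h ^ m) → a ⇝ lim a
  cauchy⇒⇝lim {a} {K} 0≤K step = K + K , λ m → lower m , upper m
    where
    L : ℕ → ℝ
    L m = (K + K) * h ^ m

    tail : ∀ {m n} → m ℕ.≤ n → a n - a m ∈± L m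
    tail = geometric-tail {a = a} 0≤h O.refl 0≤K step

    Eventually : ℝ → Set
    Eventually x = ∃[ N ] (∀ m → N ℕ.≤ m → x ≤ a m)

    below : ∀ m → Eventually (a m - L m)
    below m = m , λ n m≤n → begin
      a m - L m             ≤⟨ +-mono-≤ O.refl (proj₁ (tail m≤n)) ⟩
      a m + (a n - a m)     ≈⟨ solve 2 (λ x y → x :+ (y :- x) := y) refl (a m) (a n) ⟩
      a n                   ∎

    above : ∀ m x → Eventually x → x ≤ a m + L m
    above m x (N , x≤a) = begin
      x                     ≤⟨ x≤a (N ℕ.+ m) (ℕ.m≤m+n N m) ⟩
      a n                   ≈⟨ solve 2 (λ x y → y := x :+ (y :- x)) refl (a m) (a n) ⟩
      a m + (a n - a m)     ≤⟨ +-mono-≤ O.refl (proj₂ (tail (ℕ.m≤n+m m N))) ⟩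
      a m + L m             ∎
      where
      n : ℕ
      n = N ℕ.+ m

    lower : ∀ m → - L m ≤ a m - lim a
    lower m = ≤-by (a m + L m - lim a)
      (x≤y⇒0≤y-x (sup-least Eventually (_ , below 0) _ (above m)))
      (solve 3 (λ a L l → a :- l := :- L :+ (a :+ L :- l)) refl (a m) (L m) (lim a))

    upper : ∀ m → a m - lim a ≤ L m
    upper m = ≤-by (lim a - (a m - L m))
      (x≤y⇒0≤y-x (sup-upper Eventually (_ , below 0) (_ , above 0) _ (below m)))
      (solve 3 (λ a L l → L := (a :- l) :+ (l :- (a :- L))) refl (a m) (L m) (lim a))

  -- The exponential series

  ε : ℕ → ℝ
  ε k = fromℕ (k !) ⁻¹

  0<k! : ∀ k → 0# < fromℕ (k !)
  0<k! zero    = 0<fromℕ 0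
  0<k! (suc k) = 0≤x∧x≉0⇒0<x (0≤fromℕ (suc k !))
    (0<x⇒x≉0 (*-positive (0<fromℕ k) (0<k! k)) ∘ trans (sym (fromℕ-* (suc k) (k !))))

  0<ε : ∀ k → 0# < ε k
  0<ε k = ⁻¹-positive (0<k! k)

  ε-zero : ε 0 ≈ 1#
  ε-zero = sym (⁻¹-unique (0<x⇒x≉0 (0<k! 0)) (solve 0 ((𝟙ᵖ :+ 𝟘ᵖ) :* 𝟙ᵖ := 𝟙ᵖ) refl))

  ε-suc : ∀ k → ε (suc k) ≈ ι k * ε k
  ε-suc k = sym (⁻¹-unique (0<x⇒x≉0 (0<k! (suc k))) (begin-equality
    fromℕ (suc k !) * (ι k * ε k)            ≈⟨ *-congʳ (fromℕ-* (suc k) (k !)) ⟩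
    fromℕ (suc k) * fromℕ (k !) * (ι k * ε k) ≈⟨ solve 4 (λ a b c d → a :* b :* (c :* d) := (a :* c) :* (b :* d)) refl _ _ _ _ ⟩
    (fromℕ (suc k) * ι k) * (fromℕ (k !) * ε k) ≈⟨ *-cong (fromℕ*ι k) (⁻¹-inverseʳ _ (0<x⇒x≉0 (0<k! k))) ⟩
    1# * 1#                                  ≈⟨ *-identityˡ 1# ⟩
    1#                                       ∎))

  fromℕ*ε : ∀ k → fromℕ (suc k) * ε (suc k) ≈ ε k
  fromℕ*ε k = begin-equality
    fromℕ (suc k) * ε (suc k)     ≈⟨ *-congˡ (ε-suc k) ⟩
    fromℕ (suc k) * (ι k * ε k)   ≈⟨ *-assoc _ _ _ ⟨
    fromℕ (suc k) * ι k * ε k     ≈⟨ *-congʳ (fromℕ*ι k) ⟩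
    1# * ε k                      ≈⟨ *-identityˡ _ ⟩
    ε k                           ∎

  -- The bound is the sum of the values up to N, which replaces their maximum and needs no
  -- comparisons.
  eventually-decreasing⇒bounded : ∀ N (u : ℕ → ℝ) → (∀ k → 0# ≤ u k) →
    (∀ k → N ℕ.≤ k → u (suc k) ≤ u k) → ∃[ K ] (∀ k → u k ≤ K)
  eventually-decreasing⇒bounded zero    u 0≤u dec = u 0 , go
    where
    go : ∀ k → u k ≤ u 0
    go zero    = O.refl
    go (suc k) = O.trans (dec k ℕ.z≤n) (go k)
  eventually-decreasing⇒bounded (suc N) u 0≤u dec = u 0 + K , λ
    { zero    → ≤-by K 0≤K refl
    ; (suc k) → O.trans (proj₂ shifted k) (≤-by (u 0) (0≤u 0) (+-comm _ _)) }
    where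
    shifted : ∃[ K ] (∀ k → u (suc k) ≤ K)
    shifted = eventually-decreasing⇒bounded N (u ∘ suc) (0≤u ∘ suc)
      (λ k N≤k → dec (suc k) (ℕ.s≤s N≤k))
    K : ℝ
    K = proj₁ shifted
    0≤K : 0# ≤ K
    0≤K = O.trans (0≤u 1) (proj₂ shifted 0)

  -- Terms are estimated with ratio 1/4, although limits are only claimed with ratio 1/2: the Cauchy
  -- product costs a factor m, and m (1/4)^m ≤ (1/2)^m.
  q : ℝ
  q = h * h

  0≤q : 0# ≤ q
  0≤q = *-nonNegative 0≤h 0≤h

  q≤h : q ≤ h
  q≤h = O.trans (*-monoˡ-≤ 0≤h (O.trans (O.reflexive (sym (*-identityʳ h))) (h^≤1 1)))
                (O.reflexive (*-identityʳ h))

  -- The quotient of consecutive terms is L/(k + 1), which is at most 1 from some k on by the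
  -- Archimedean axiom.
  power/factorial-bounded : ∀ {L} → 0# ≤ L → ∃[ K ] (∀ k → L ^ k * ε k ≤ K)
  power/factorial-bounded {L} 0≤L = eventually-decreasing⇒bounded N u 0≤u dec
    where
    N : ℕ
    N = proj₁ (archimedean L)
    u : ℕ → ℝ
    u k = L ^ k * ε k
    0≤u : ∀ k → 0# ≤ u k
    0≤u k = *-nonNegative (^-nonNegative 0≤L k) (proj₁ (0<ε k))
    dec : ∀ k → N ℕ.≤ k → u (suc k) ≤ u k
    dec k N≤k = begin
      L * L ^ k * ε (suc k)    ≈⟨ *-congˡ (ε-suc k) ⟩
      L * L ^ k * (ι k * ε k)  ≈⟨ solve 4 (λ a b c d → a :* b :* (c :* d) := b :* d :* (a :* c)) refl _ _ _ _ ⟩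
      u k * (L * ι k)          ≤⟨ *-monoˡ-≤ (0≤u k) Lι≤1 ⟩
      u k * 1#                 ≈⟨ *-identityʳ _ ⟩
      u k                      ∎
      where
      Lι≤1 : L * ι k ≤ 1#
      Lι≤1 = begin
        L * ι k               ≤⟨ *-mono-≤ 0≤L (proj₁ (0<ι k)) (O.trans (proj₂ (archimedean L)) (fromℕ-mono (ℕ.m≤n⇒m≤1+n N≤k))) O.refl ⟩
        fromℕ (suc k) * ι k   ≈⟨ fromℕ*ι k ⟩
        1#                    ∎

  -- The boundedness just shown is applied to 4L: L^k / k! is q^k times (4L)^k / k!.
  power/factorial-geometric : ∀ {L} → 0# ≤ L →
    ∃[ K ] (0# ≤ K × (∀ k → L ^ k * ε k ≤ K * q ^ k))
  power/factorial-geometric {L} 0≤L = K , 0≤K , λ k → begin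
    L ^ k * ε k                ≈⟨ *-congʳ (^-cong k L≈) ⟩
    (q * L′) ^ k * ε k         ≈⟨ *-congʳ (*-^ q L′ k) ⟩
    q ^ k * L′ ^ k * ε k       ≈⟨ *-assoc _ _ _ ⟩
    q ^ k * (L′ ^ k * ε k)     ≤⟨ *-monoˡ-≤ (^-nonNegative 0≤q k) (proj₂ bound k) ⟩
    q ^ k * K                  ≈⟨ *-comm _ _ ⟩
    K * q ^ k                  ∎
    where
    L′ : ℝ
    L′ = (1# + 1#) * ((1# + 1#) * L)
    0≤2 : 0# ≤ 1# + 1#
    0≤2 = +-nonNegative 0≤1 0≤1
    0≤L′ : 0# ≤ L′
    0≤L′ = *-nonNegative 0≤2 (*-nonNegative 0≤2 0≤L)
    bound : ∃[ K ] (∀ k → L′ ^ k * ε k ≤ K)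
    bound = power/factorial-bounded 0≤L′
    K : ℝ
    K = proj₁ bound
    0≤K : 0# ≤ K
    0≤K = O.trans (*-nonNegative 0≤1 (proj₁ (0<ε 0))) (proj₂ bound 0)
    L≈ : L ≈ q * L′
    L≈ = begin-equality
      L                          ≈⟨ solve 1 (λ L → L := 𝟙ᵖ :* 𝟙ᵖ :* L) refl L ⟩
      1# * 1# * L                ≈⟨ *-congʳ (*-cong h+h≈1 h+h≈1) ⟨
      (h + h) * (h + h) * L      ≈⟨ solve 2 (λ h L → (h :+ h) :* (h :+ h) :* L := h :* h :* (𝟚ᵖ :* (𝟚ᵖ :* L))) refl h L ⟩
      q * L′                     ∎

  -- The sums of w j k over j + k < m and over j + k = p. Both split off the row j = 0, so that
  -- inductions pass from w to `w ∘ suc`.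
  triangle diagonal : ℕ → (ℕ → ℕ → ℝ) → ℝ
  triangle zero    w = 0#
  triangle (suc m) w = ∑ (suc m) (w 0) + triangle m (w ∘ suc)
  diagonal zero    w = w 0 0
  diagonal (suc p) w = w 0 (suc p) + diagonal p (w ∘ suc)

  triangle-suc : ∀ m w → triangle (suc m) w ≈ triangle m w + diagonal m w
  triangle-suc zero    w = solve 1 (λ x → x :+ 𝟘ᵖ :+ 𝟘ᵖ := 𝟘ᵖ :+ x) refl (w 0 0)
  triangle-suc (suc m) w = trans
    (+-cong (∑-last (suc m) (w 0)) (triangle-suc m (w ∘ suc)))
    (solve 4 (λ a b c d → (a :+ b) :+ (c :+ d) := (a :+ c) :+ (b :+ d)) refl _ _ _ _)

  -- On the diagonal j + k = p the weight a + p is (a + j) + k, and the hypothesis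
  -- makes these two parts cancel between neighbours.
  diagonal-telescopes : ∀ a p w →
    (∀ j k → (a + fromℕ (suc j)) * w (suc j) k ≈ - (fromℕ (suc k) * w j (suc k))) →
    (a + fromℕ p) * diagonal p w ≈ a * w 0 p
  diagonal-telescopes a zero    w skew = *-congʳ (+-identityʳ a)
  diagonal-telescopes a (suc p) w skew = begin-equality
    (a + (1# + P)) * (x + D)
      ≈⟨ solve 4 (λ a p x d → (a :+ (𝟙ᵖ :+ p)) :* (x :+ d) := (a :+ (𝟙ᵖ :+ p)) :* x :+ ((a :+ 𝟙ᵖ) :+ p) :* d) refl a P x D ⟩
    (a + (1# + P)) * x + ((a + 1#) + P) * D
      ≈⟨ +-congˡ (diagonal-telescopes (a + 1#) p (w ∘ suc) (λ j k →
           trans (*-congʳ (+-assoc a 1# _)) (skew (suc j) k))) ⟩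
    (a + (1# + P)) * x + (a + 1#) * w 1 p
      ≈⟨ +-congˡ (trans (*-congʳ (+-congˡ (sym (+-identityʳ 1#)))) (skew 0 p)) ⟩
    (a + (1# + P)) * x - (1# + P) * x
      ≈⟨ solve 3 (λ a p x → (a :+ (𝟙ᵖ :+ p)) :* x :- (𝟙ᵖ :+ p) :* x := a :* x) refl a P x ⟩
    a * x ∎
    where
    P x D : ℝ
    P = fromℕ p
    x = w 0 (suc p)
    D = diagonal p (w ∘ suc)

  -- In row j the triangle misses a tail that starts at column m - j and is at most 2K q^j q^(m -
  -- j); there are m rows. The number n of columns is kept separate because the induction removes a
  -- row but no column.
  square-triangle : ∀ {K w} → 0# ≤ K → (∀ j k → w j k ∈± K * q ^ j * q ^ k) →
    ∀ {m n} → m ℕ.≤ n →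
    ∑ m (λ j → ∑ n (w j)) - triangle m w ∈± fromℕ m * ((K + K) * q ^ m)
  square-triangle {K} {w} 0≤K w∈ {zero} m≤n =
    ∈±-cong (sym (-‿inverseʳ 0#)) (0∈± (O.reflexive (sym (zeroˡ _))))
  square-triangle {K} {w} 0≤K w∈ {suc m} {n} m<n = ∈±-weaken
    (O.reflexive (solve 4 (λ q K n x → (K :+ K) :* (q :* x) :+ n :* ((K :* q :+ K :* q) :* x) :=
       (𝟙ᵖ :+ n) :* ((K :+ K) :* (q :* x))) refl q K (fromℕ m) (q ^ m)))
    (∈±-cong
      (solve 4 (λ a b c d → (a :- b) :+ (c :- d) := (a :+ c) :- (b :+ d)) refl
         (∑ n (w 0)) (∑ (suc m) (w 0)) (∑ m (λ j → ∑ n (w (suc j)))) (triangle m (w ∘ suc)))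
      (+-∈±
        (geometric-tail {a = λ i → ∑ i (w 0)} 0≤q q≤h 0≤K
          (λ i → ∈±-cong
            (∑-increment i (w 0))
            (∈±-weaken (O.reflexive (*-congʳ (*-identityʳ K))) (w∈ 0 i)))
          m<n)
        (square-triangle {K * q} {w ∘ suc} (*-nonNegative 0≤K 0≤q)
          (λ j k → ∈±-weaken (O.reflexive (*-congʳ (sym (*-assoc K q _)))) (w∈ (suc j) k))
          (ℕ.<⇒≤ m<n))))

  -- The Cauchy product argument for exp(-x) exp(x) = 1.
  square⇝1 : ∀ {K w} → 0# ≤ K → (∀ j k → w j k ∈± K * q ^ j * q ^ k) →
    w 0 0 ≈ 1# →
    (∀ j k → fromℕ (suc j) * w (suc j) k ≈ - (fromℕ (suc k) * w j (suc k))) →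
    (λ m → ∑ m (λ j → ∑ m (w j))) ⇝ 1#
  square⇝1 {K} {w} 0≤K w∈ w00≈1 skew = (K + K) + 1# , λ m → ∈±-weaken
    (O.reflexive (solve 2 (λ K x → (K :+ K) :* x :+ x := (K :+ K :+ 𝟙ᵖ) :* x) refl K (h ^ m)))
    (∈±-cong (solve 3 (λ s t o → (s :- t) :+ (t :- o) := s :- o) refl _ (triangle m w) 1#)
      (+-∈± (∈±-weaken (error m) (square-triangle 0≤K w∈ {m} {m} ℕ.≤-refl)) (triangle-1 m)))
    where
    skew′ : ∀ j k → (0# + fromℕ (suc j)) * w (suc j) k ≈ - (fromℕ (suc k) * w j (suc k))
    skew′ j k = trans (*-congʳ (+-identityˡ _)) (skew j k)

    diagonal≈0 : ∀ p → diagonal (suc p) w ≈ 0#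
    diagonal≈0 p = xy≈0⇒y≈0 (0<x⇒x≉0 (0<fromℕ p) ∘ trans (sym (+-identityˡ _)))
      (trans (diagonal-telescopes 0# (suc p) w skew′) (zeroˡ _))

    triangle≈1 : ∀ m → triangle (suc m) w ≈ 1#
    triangle≈1 zero    = trans (solve 1 (λ x → x :+ 𝟘ᵖ :+ 𝟘ᵖ := x) refl (w 0 0)) w00≈1
    triangle≈1 (suc m) = trans (triangle-suc (suc m) w)
      (trans (+-cong (triangle≈1 m) (diagonal≈0 m)) (+-identityʳ 1#))

    triangle-1 : ∀ m → triangle m w - 1# ∈± h ^ m
    triangle-1 zero    = ∈±-cong (sym (+-identityˡ (- 1#))) (-‿∈± (∈±-self 0≤1))
    triangle-1 (suc m) = ∈±-cong
      (sym (trans (+-congʳ (triangle≈1 m)) (-‿inverseʳ 1#))) (0∈± (0≤h^ (suc m)))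

    error : ∀ m → fromℕ m * ((K + K) * q ^ m) ≤ (K + K) * h ^ m
    error m = begin
      fromℕ m * ((K + K) * q ^ m)             ≈⟨ *-congˡ (*-congˡ (*-^ h h m)) ⟩
      fromℕ m * ((K + K) * (h ^ m * h ^ m))   ≈⟨ solve 3 (λ n K x → n :* ((K :+ K) :* (x :* x)) := (K :+ K) :* x :* (x :* n)) refl (fromℕ m) K (h ^ m) ⟩
      (K + K) * h ^ m * (h ^ m * fromℕ m)     ≤⟨ *-monoˡ-≤ (*-nonNegative (+-nonNegative 0≤K 0≤K) (0≤h^ m))
        (O.trans (*-monoˡ-≤ (0≤h^ m) (fromℕ-mono (ℕ.n≤1+n m))) (h^-bound m)) ⟩
      (K + K) * h ^ m * 1#                    ≈⟨ *-identityʳ _ ⟩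
      (K + K) * h ^ m                         ∎

  -- Exponentials of skew-Hermitian matrices

  re-Σᶜ : ∀ {N} (f : Fin N → ℂ) → re (Σᶜ f) ≡ Σ (re ∘ f)
  re-Σᶜ {zero}  f = ≡.refl
  re-Σᶜ {suc N} f = ≡.cong (re (f zero) +_) (re-Σᶜ (f ∘ suc))

  im-Σᶜ : ∀ {N} (f : Fin N → ℂ) → im (Σᶜ f) ≡ Σ (im ∘ f)
  im-Σᶜ {zero}  f = ≡.refl
  im-Σᶜ {suc N} f = ≡.cong (im (f zero) +_) (im-Σᶜ (f ∘ suc))

  Σ-cong : ∀ {N} {f g : Fin N → ℝ} → (∀ v → f v ≈ g v) → Σ f ≈ Σ g
  Σ-cong = sum-cong-≋

  Σ-single : ∀ {N} (a : Fin N) {f : Fin N → ℝ} →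
             (∀ v → ¬ v ≡ a → f v ≈ 0#) → Σ f ≈ f a
  Σ-single {suc N} zero {f} f≈0 = begin-equality
    f zero + Σ (f ∘ suc)           ≈⟨ +-congˡ (Σ-cong (λ v → f≈0 (suc v) λ ())) ⟩
    f zero + Σ {N} (λ _ → 0#)      ≈⟨ +-congˡ (sum-replicate-zero N) ⟩
    f zero + 0#                    ≈⟨ +-identityʳ _ ⟩
    f zero                         ∎
  Σ-single {suc N} (suc a) {f} f≈0 = begin-equality
    f zero + Σ (f ∘ suc)           ≈⟨ +-congʳ (f≈0 zero λ ()) ⟩
    0# + Σ (f ∘ suc)               ≈⟨ +-identityˡ _ ⟩
    Σ (f ∘ suc)                    ≈⟨ Σ-single a (λ v v≢a → f≈0 (suc v) (λ { ≡.refl → v≢a ≡.refl })) ⟩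
    f (suc a)                      ∎

  Σᶜ-cong : ∀ {N} {f g : Fin N → ℂ} → (∀ v → f v ≈ᶜ g v) → Σᶜ f ≈ᶜ Σᶜ g
  Σᶜ-cong {f = f} {g} f≈g rewrite re-Σᶜ f | re-Σᶜ g | im-Σᶜ f | im-Σᶜ g =
    Σ-cong (proj₁ ∘ f≈g) , Σ-cong (proj₂ ∘ f≈g)

  Σᶜ-single : ∀ {N} (a : Fin N) {f : Fin N → ℂ} →
              (∀ v → ¬ v ≡ a → f v ≈ᶜ 0ᶜ) → Σᶜ f ≈ᶜ f a
  Σᶜ-single a {f} f≈0 rewrite re-Σᶜ f | im-Σᶜ f =
    Σ-single a (λ v → proj₁ ∘ f≈0 v) , Σ-single a (λ v → proj₂ ∘ f≈0 v)

  basis-diagonal : ∀ {N} (v : Fin N) → basis v v ≡ 1ᶜ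
  basis-diagonal v rewrite dec-true (v Fin.≟ v) ≡.refl = ≡.refl

  basis-off : ∀ {N} {v w : Fin N} → ¬ v ≡ w → basis v w ≡ 0ᶜ
  basis-off {v = v} {w} v≢w rewrite dec-false (v Fin.≟ w) v≢w = ≡.refl

  -- Bounding both parts avoids moduli at the price of a factor 2 in products, which the geometric
  -- estimates absorb.
  infix 4 _∈±ᶜ_
  _∈±ᶜ_ : ℂ → ℝ → Set
  z ∈±ᶜ c = re z ∈± c × im z ∈± c

  ∈±ᶜ-weaken : ∀ {z c d} → c ≤ d → z ∈±ᶜ c → z ∈±ᶜ d
  ∈±ᶜ-weaken c≤d (r , i) = ∈±-weaken c≤d r , ∈±-weaken c≤d i

  *ᶜ-∈±ᶜ : ∀ {z w c d} → z ∈±ᶜ c → w ∈±ᶜ d → z *ᶜ w ∈±ᶜ c * d + c * d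
  *ᶜ-∈±ᶜ (zr , zi) (wr , wi) =
    +-∈± (*-∈± zr wr) (-‿∈± (*-∈± zi wi)) , +-∈± (*-∈± zr wi) (*-∈± zi wr)

  Σᶜ-∈±ᶜ : ∀ {N} {f : Fin N → ℂ} {c} → (∀ v → f v ∈±ᶜ c) → Σᶜ f ∈±ᶜ fromℕ N * c
  Σᶜ-∈±ᶜ {f = f} f∈ rewrite re-Σᶜ f | im-Σᶜ f =
    Σ-∈± (proj₁ ∘ f∈) , Σ-∈± (proj₂ ∘ f∈)

  Fin-bounded : ∀ {N} (f : Fin N → ℝ) → ∃[ c ] (0# ≤ c × (∀ v → f v ∈± c))
  Fin-bounded {zero}  f = 0# , O.refl , λ ()
  Fin-bounded {suc N} f with bounded (f zero) | Fin-bounded (f ∘ suc)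
  ... | b , f₀∈ | c , 0≤c , f∈ = b + c , +-nonNegative 0≤b 0≤c , λ
    { zero    → ∈±-weaken (≤-by c 0≤c refl) f₀∈
    ; (suc v) → ∈±-weaken (≤-by b 0≤b (+-comm b c)) (f∈ v) }
    where
    0≤b : 0# ≤ b
    0≤b = ∈±⇒0≤ f₀∈

  matrix-bounded : ∀ {N} (M : Matrix N) → ∃[ c ] (0# ≤ c × (∀ v w → M v w ∈±ᶜ c))
  matrix-bounded M = c , 0≤c , λ v w →
    ∈±-weaken (O.trans (row≤ re v) (≤-by (max im) (0≤max im) refl)) (proj₂ (proj₂ (row re v)) w) ,
    ∈±-weaken (O.trans (row≤ im v) (≤-by (max re) (0≤max re) (+-comm _ _))) (proj₂ (proj₂ (row im v)) w)
    where
    row : ∀ (part : ℂ → ℝ) v → ∃[ c ] (0# ≤ c × (∀ w → part (M v w) ∈± c))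
    row part v = Fin-bounded (λ w → part (M v w))
    rows : ∀ (part : ℂ → ℝ) → ∃[ c ] (0# ≤ c × (∀ v → proj₁ (row part v) ∈± c))
    rows part = Fin-bounded (λ v → proj₁ (row part v))
    max : (ℂ → ℝ) → ℝ
    max part = proj₁ (rows part)
    0≤max : ∀ part → 0# ≤ max part
    0≤max part = proj₁ (proj₂ (rows part))
    row≤ : ∀ part v → proj₁ (row part v) ≤ max part
    row≤ part v = proj₂ (proj₂ (proj₂ (rows part)) v)
    c : ℝ
    c = max re + max im
    0≤c : 0# ≤ c
    0≤c = +-nonNegative (0≤max re) (0≤max im)

  1ᶜ∈± : 1ᶜ ∈±ᶜ 1#
  1ᶜ∈± = ∈±-self 0≤1 , 0∈± 0≤1

  0ᶜ∈± : 0ᶜ ∈±ᶜ 1#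
  0ᶜ∈± = 0∈± 0≤1 , 0∈± 0≤1

  power-bounded : ∀ {N} (M : Matrix N) →
    ∃[ L ] (0# ≤ L × (∀ k v w → (M ^ᵐ k) v w ∈±ᶜ L ^ k))
  power-bounded {N} M = L , 0≤L , go
    where
    c : ℝ
    c = proj₁ (matrix-bounded M)
    -- A matrix product has N summands, and each complex product contributes a factor 2.
    L : ℝ
    L = fromℕ N * (c + c)
    0≤L : 0# ≤ L
    0≤L = *-nonNegative (0≤fromℕ N) (+-nonNegative (proj₁ (proj₂ (matrix-bounded M))) (proj₁ (proj₂ (matrix-bounded M))))
    I∈ : ∀ {N} (v w : Fin N) → I v w ∈±ᶜ 1#
    I∈ v w with does (v Fin.≟ w)
    ... | true  = 1ᶜ∈±
    ... | false = 0ᶜ∈±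
    go : ∀ k v w → (M ^ᵐ k) v w ∈±ᶜ L ^ k
    go zero    v w = I∈ v w
    go (suc k) v w = ∈±ᶜ-weaken
      (O.reflexive (solve 3 (λ n c x → n :* (c :* x :+ c :* x) := n :* (c :+ c) :* x) refl (fromℕ N) c (L ^ k)))
      (Σᶜ-∈±ᶜ (λ x → *ᶜ-∈±ᶜ (proj₂ (proj₂ (matrix-bounded M)) v x) (go k x w)))

  term : ∀ {N} → Matrix N → ℕ → Matrix N
  term M k v w = ε k • (M ^ᵐ k) v w

  term-bounded : ∀ {N} (M : Matrix N) →
    ∃[ K ] (0# ≤ K × (∀ k v w → term M k v w ∈±ᶜ K * q ^ k))
  term-bounded M = K , proj₁ (proj₂ geo) , λ k v w →
    part k (proj₁ (proj₂ (proj₂ (power-bounded M)) k v w)) ,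
    part k (proj₂ (proj₂ (proj₂ (power-bounded M)) k v w))
    where
    L : ℝ
    L = proj₁ (power-bounded M)
    geo : ∃[ K ] (0# ≤ K × (∀ k → L ^ k * ε k ≤ K * q ^ k))
    geo = power/factorial-geometric (proj₁ (proj₂ (power-bounded M)))
    K : ℝ
    K = proj₁ geo
    part : ∀ k {x} → x ∈± L ^ k → ε k * x ∈± K * q ^ k
    part k x∈ = ∈±-weaken (O.trans (O.reflexive (*-comm (ε k) (L ^ k))) (proj₂ (proj₂ geo) k))
      (*-∈± (∈±-self (proj₁ (0<ε k))) x∈)

  q^≤h^ : ∀ k → q ^ k ≤ h ^ k
  q^≤h^ k = begin
    q ^ k          ≈⟨ *-^ h h k ⟩
    h ^ k * h ^ k  ≤⟨ *-monoˡ-≤ (0≤h^ k) (h^≤1 k) ⟩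
    h ^ k * 1#     ≈⟨ *-identityʳ _ ⟩
    h ^ k          ∎

  series-increment : ∀ {f K} → 0# ≤ K → (∀ k → f k ∈± K * q ^ k) →
                     ∀ m → ∑ (suc m) f - ∑ m f ∈± K * h ^ m
  series-increment {f} 0≤K f∈ m = ∈±-cong (∑-increment m f)
    (∈±-weaken (*-monoˡ-≤ 0≤K (q^≤h^ m)) (f∈ m))

  series⇝lim : ∀ {f K} → 0# ≤ K → (∀ k → f k ∈± K * q ^ k) →
               (λ m → ∑ m f) ⇝ lim (λ m → ∑ m f)
  series⇝lim 0≤K f∈ = cauchy⇒⇝lim 0≤K (series-increment 0≤K f∈)

  module _ {N} (M : Matrix N) (v w : Fin N) where

    -- The limit in `exp` is taken of parts of complex sums, which agree only pointwise with sums of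
    -- parts. Hence the Cauchy criterion is applied to the former, and afterwards the sequence is
    -- exchanged, not the limit.
    exp-part : ∀ {part : ℂ → ℝ} {K} →
      (∀ m → part (expSum M m v w) ≡ ∑ m (λ k → part (term M k v w))) →
      0# ≤ K → (∀ k → part (term M k v w) ∈± K * q ^ k) →
      (λ m → ∑ m (λ k → part (term M k v w))) ⇝ lim (λ m → part (expSum M m v w))
    exp-part {K = K} partial 0≤K term∈ = ⇝-cong (λ m → reflexive (partial m))
      (cauchy⇒⇝lim 0≤K (λ m → ≡.subst₂ (λ x y → x - y ∈± K * h ^ m)
        (≡.sym (partial (suc m))) (≡.sym (partial m)) (series-increment 0≤K term∈ m)))

    exp-re : (λ m → ∑ m (λ k → re (term M k v w))) ⇝ re (exp M v w)
    exp-re = exp-part {re} (λ m → re-Σᶜ {m} (λ k → term M (toℕ k) v w))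
      (proj₁ (proj₂ (term-bounded M))) (λ k → proj₁ (proj₂ (proj₂ (term-bounded M)) k v w))

    exp-im : (λ m → ∑ m (λ k → im (term M k v w))) ⇝ im (exp M v w)
    exp-im = exp-part {im} (λ m → im-Σᶜ {m} (λ k → term M (toℕ k) v w))
      (proj₁ (proj₂ (term-bounded M))) (λ k → proj₂ (proj₂ (proj₂ (term-bounded M)) k v w))

  -- The real inner product of ℂ = ℝ², that is, the real part of the Hermitian one; it is enough for
  -- norms of columns.
  dot : ℂ → ℂ → ℝ
  dot z w = re z * re w + im z * im w

  ⟨_,_⟩ : ∀ {N} → ℂ^ N → ℂ^ N → ℝ
  ⟨ ψ , φ ⟩ = Σ (λ v → dot (ψ v) (φ v))

  IsSkewHermitian : ∀ {N} → Matrix N → Set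
  IsSkewHermitian M = ∀ v w → re (M v w) ≈ - re (M w v) × im (M v w) ≈ im (M w v)

  dot-Σˡ : ∀ {N} (f : Fin N → ℂ) z → dot (Σᶜ f) z ≈ Σ (λ w → dot (f w) z)
  dot-Σˡ f z rewrite re-Σᶜ f | im-Σᶜ f = begin-equality
    Σ (re ∘ f) * re z + Σ (im ∘ f) * im z
      ≈⟨ +-cong (*-distribʳ-sum (re z) (re ∘ f)) (*-distribʳ-sum (im z) (im ∘ f)) ⟩
    Σ (λ w → re (f w) * re z) + Σ (λ w → im (f w) * im z)
      ≈⟨ ∑-distrib-+ (λ w → re (f w) * re z) (λ w → im (f w) * im z) ⟨
    Σ (λ w → dot (f w) z) ∎

  dot-comm : ∀ z w → dot z w ≈ dot w z
  dot-comm z w = +-cong (*-comm _ _) (*-comm _ _)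

  skew-adjoint : ∀ {N} {M : Matrix N} → IsSkewHermitian M →
                 ∀ ψ φ → ⟨ M *ᵛ ψ , φ ⟩ ≈ - ⟨ ψ , M *ᵛ φ ⟩
  skew-adjoint {N} {M} skew ψ φ = begin-equality
    Σ (λ v → dot ((M *ᵛ ψ) v) (φ v))
      ≈⟨ Σ-cong (λ v → dot-Σˡ (λ w → M v w *ᶜ ψ w) (φ v)) ⟩
    Σ (λ v → Σ (λ w → dot (M v w *ᶜ ψ w) (φ v)))
      ≈⟨ ∑-comm (λ v w → dot (M v w *ᶜ ψ w) (φ v)) ⟩
    Σ (λ w → Σ (λ v → dot (M v w *ᶜ ψ w) (φ v)))
      ≈⟨ Σ-cong (λ w → Σ-cong (λ v → entry w v)) ⟩
    Σ (λ w → Σ (λ v → - dot (M w v *ᶜ φ v) (ψ w)))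
      ≈⟨ Σ-cong (λ w → Σ-neg (λ v → dot (M w v *ᶜ φ v) (ψ w))) ⟩
    Σ (λ w → - Σ (λ v → dot (M w v *ᶜ φ v) (ψ w)))
      ≈⟨ Σ-neg (λ w → Σ (λ v → dot (M w v *ᶜ φ v) (ψ w))) ⟩
    - Σ (λ w → Σ (λ v → dot (M w v *ᶜ φ v) (ψ w)))
      ≈⟨ -‿cong (Σ-cong (λ w → trans (dot-comm (ψ w) ((M *ᵛ φ) w)) (dot-Σˡ (λ v → M w v *ᶜ φ v) (ψ w)))) ⟨
    - ⟨ ψ , M *ᵛ φ ⟩ ∎
    where
    entry : ∀ w v → dot (M v w *ᶜ ψ w) (φ v) ≈ - dot (M w v *ᶜ φ v) (ψ w)
    entry w v = begin-equality
      (re m * re x - im m * im x) * re y + (re m * im x + im m * re x) * im y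
        ≈⟨ +-cong (*-congʳ (+-cong (*-congʳ r) (-‿cong (*-congʳ i)))) (*-congʳ (+-cong (*-congʳ r) (*-congʳ i))) ⟩
      (- re m′ * re x - im m′ * im x) * re y + (- re m′ * im x + im m′ * re x) * im y
        ≈⟨ solve 6 (λ a b c d e f →
             (:- a :* c :- b :* d) :* e :+ (:- a :* d :+ b :* c) :* f :=
             :- ((a :* e :- b :* f) :* c :+ (a :* f :+ b :* e) :* d))
           refl (re m′) (im m′) (re x) (im x) (re y) (im y) ⟩
      - dot (m′ *ᶜ y) x ∎
      where
      m m′ x y : ℂ
      m  = M v w
      m′ = M w v
      x  = ψ w
      y  = φ v
      r : re m ≈ - re m′
      r = proj₁ (skew v w)
      i : im m ≈ im m′
      i = proj₂ (skew v w)

  ∑-*-∑ : ∀ m n f g → ∑ m f * ∑ n g ≈ ∑ m (λ j → ∑ n (λ k → f j * g k))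
  ∑-*-∑ m n f g = trans (*-distribʳ-sum {m} (∑ n g) (f ∘ toℕ))
    (∑-cong m (λ j → *-distribˡ-sum {n} (f j) (g ∘ toℕ)))

  ∑-distrib : ∀ m (f g : ℕ → ℝ) → ∑ m (λ k → f k + g k) ≈ ∑ m f + ∑ m g
  ∑-distrib m f g = ∑-distrib-+ {m} (f ∘ toℕ) (g ∘ toℕ)

  Σ-∑∑-swap : ∀ {N} m n (F : Fin N → ℕ → ℕ → ℝ) →
    Σ (λ v → ∑ m (λ j → ∑ n (F v j))) ≈ ∑ m (λ j → ∑ n (λ k → Σ (λ v → F v j k)))
  Σ-∑∑-swap m n F = trans (∑-comm (λ v (j : Fin m) → ∑ n (F v (toℕ j))))
    (∑-cong m (λ j → ∑-comm (λ v (k : Fin n) → F v j (toℕ k))))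

  -- The squared norm of column u is the limit of the double sums of the inner products ⟨ t j , t k
  -- ⟩, where t k is that column of M^k / k!. Moving one factor M across the inner product costs a
  -- sign, and with the factorials this becomes the skewness hypothesis of `square⇝1`. Thus no
  -- inverse or adjoint of the exponential has to be formed.
  exp-unitary : ∀ {N} {M : Matrix N} → IsSkewHermitian M →
                ∀ u → Σ (λ v → ∣ exp M v u ∣²) ≈ 1#
  exp-unitary {N} {M} skew u = ⇝-unique
    (⇝-cong norm≈ (⇝-Σ (λ v → ⇝-+ (⇝-* (exp-re M v u) (exp-re M v u)) (⇝-* (exp-im M v u) (exp-im M v u)))))
    (square⇝1 {K′} {w} 0≤K′ w∈ w00 w-skew)
    where
    K : ℝ
    K = proj₁ (term-bounded M)
    0≤K : 0# ≤ K
    0≤K = proj₁ (proj₂ (term-bounded M))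

    t : ℕ → ℂ^ N
    t k v = term M k v u
    c : ℕ → ℂ^ N
    c k v = (M ^ᵐ k) v u
    w : ℕ → ℕ → ℝ
    w j k = ⟨ t j , t k ⟩

    t∈ : ∀ k v → t k v ∈±ᶜ K * q ^ k
    t∈ k v = proj₂ (proj₂ (term-bounded M)) k v u

    K′ : ℝ
    K′ = fromℕ N * (K * K + K * K)
    0≤K′ : 0# ≤ K′
    0≤K′ = *-nonNegative (0≤fromℕ N) (+-nonNegative (*-nonNegative 0≤K 0≤K) (*-nonNegative 0≤K 0≤K))

    w∈ : ∀ j k → w j k ∈± K′ * q ^ j * q ^ k
    w∈ j k = ∈±-weaken
      (O.reflexive (solve 4 (λ n K x y → n :* (K :* x :* (K :* y) :+ K :* x :* (K :* y)) := n :* (K :* K :+ K :* K) :* x :* y)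
        refl (fromℕ N) K (q ^ j) (q ^ k)))
      (Σ-∈± (λ v → +-∈± (*-∈± (proj₁ (t∈ j v)) (proj₁ (t∈ k v))) (*-∈± (proj₂ (t∈ j v)) (proj₂ (t∈ k v)))))

    w≈ : ∀ j k → w j k ≈ ε j * ε k * ⟨ c j , c k ⟩
    w≈ j k = begin-equality
      w j k
        ≈⟨ Σ-cong (λ v → solve 6 (λ e f a b c d → e :* a :* (f :* b) :+ e :* c :* (f :* d) := e :* f :* (a :* b :+ c :* d))
             refl (ε j) (ε k) (re (c j v)) (re (c k v)) (im (c j v)) (im (c k v))) ⟩
      Σ (λ v → ε j * ε k * dot (c j v) (c k v))
        ≈⟨ *-distribˡ-sum (ε j * ε k) (λ v → dot (c j v) (c k v)) ⟨
      ε j * ε k * ⟨ c j , c k ⟩ ∎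

    w00 : w 0 0 ≈ 1#
    w00 = begin-equality
      w 0 0                          ≈⟨ w≈ 0 0 ⟩
      ε 0 * ε 0 * ⟨ c 0 , c 0 ⟩      ≈⟨ *-cong (*-cong ε-zero ε-zero) ⟨c₀,c₀⟩ ⟩
      1# * 1# * 1#                   ≈⟨ solve 0 (𝟙ᵖ :* 𝟙ᵖ :* 𝟙ᵖ := 𝟙ᵖ) refl ⟩
      1#                             ∎
      where
      ⟨c₀,c₀⟩ : ⟨ c 0 , c 0 ⟩ ≈ 1#
      ⟨c₀,c₀⟩ = begin-equality
        ⟨ c 0 , c 0 ⟩
          ≈⟨ Σ-single u (λ v v≢u → trans (reflexive (≡.cong ∣_∣² (basis-off v≢u)))
               (solve 0 (𝟘ᵖ :* 𝟘ᵖ :+ 𝟘ᵖ :* 𝟘ᵖ := 𝟘ᵖ) refl)) ⟩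
        ∣ basis u u ∣²
          ≈⟨ reflexive (≡.cong ∣_∣² (basis-diagonal u)) ⟩
        1# * 1# + 0# * 0#
          ≈⟨ solve 0 (𝟙ᵖ :* 𝟙ᵖ :+ 𝟘ᵖ :* 𝟘ᵖ := 𝟙ᵖ) refl ⟩
        1# ∎

    w-skew : ∀ j k → fromℕ (suc j) * w (suc j) k ≈ - (fromℕ (suc k) * w j (suc k))
    w-skew j k = begin-equality
      fromℕ (suc j) * w (suc j) k
        ≈⟨ *-congˡ (w≈ (suc j) k) ⟩
      fromℕ (suc j) * (ε (suc j) * ε k * ⟨ M *ᵛ c j , c k ⟩)
        ≈⟨ solve 4 (λ n e f g → n :* (e :* f :* g) := (n :* e) :* f :* g) refl (fromℕ (suc j)) (ε (suc j)) (ε k) _ ⟩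
      (fromℕ (suc j) * ε (suc j)) * ε k * ⟨ M *ᵛ c j , c k ⟩
        ≈⟨ *-cong (*-cong (fromℕ*ε j) (sym (fromℕ*ε k))) (skew-adjoint skew (c j) (c k)) ⟩
      ε j * (fromℕ (suc k) * ε (suc k)) * - ⟨ c j , M *ᵛ c k ⟩
        ≈⟨ solve 4 (λ n e f g → e :* (n :* f) :* :- g := :- (n :* (e :* f :* g))) refl (fromℕ (suc k)) (ε j) (ε (suc k)) _ ⟩
      - (fromℕ (suc k) * (ε j * ε (suc k) * ⟨ c j , c (suc k) ⟩))
        ≈⟨ -‿cong (*-congˡ (w≈ j (suc k))) ⟨
      - (fromℕ (suc k) * w j (suc k)) ∎

    norm≈ : ∀ m → Σ (λ v → ∑ m (λ k → re (t k v)) * ∑ m (λ k → re (t k v)) + ∑ m (λ k → im (t k v)) * ∑ m (λ k → im (t k v)))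
                ≈ ∑ m (λ j → ∑ m (w j))
    norm≈ m = trans
      (Σ-cong (λ v → begin-equality
        ∑ m (λ k → re (t k v)) * ∑ m (λ k → re (t k v)) + ∑ m (λ k → im (t k v)) * ∑ m (λ k → im (t k v))
          ≈⟨ +-cong (∑-*-∑ m m (λ k → re (t k v)) (λ k → re (t k v))) (∑-*-∑ m m (λ k → im (t k v)) (λ k → im (t k v))) ⟩
        ∑ m (λ j → ∑ m (λ k → re (t j v) * re (t k v))) + ∑ m (λ j → ∑ m (λ k → im (t j v) * im (t k v)))
          ≈⟨ ∑-distrib m (λ j → ∑ m (λ k → re (t j v) * re (t k v))) (λ j → ∑ m (λ k → im (t j v) * im (t k v))) ⟨
        ∑ m (λ j → ∑ m (λ k → re (t j v) * re (t k v)) + ∑ m (λ k → im (t j v) * im (t k v)))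
          ≈⟨ ∑-cong m (λ j → ∑-distrib m (λ k → re (t j v) * re (t k v)) (λ k → im (t j v) * im (t k v))) ⟨
        ∑ m (λ j → ∑ m (λ k → dot (t j v) (t k v))) ∎))
      (Σ-∑∑-swap m m (λ v j k → dot (t j v) (t k v)))

  -- Square roots and the cosine

  -- The solution s is the supremum of the points where f is at least y. A deviation of f s from y
  -- by Lδ is impossible: below y, the Lipschitz condition keeps all those points at distance δ from
  -- s; above y, s + δ is still one of them.
  intermediate-value : ∀ (f : ℝ → ℝ) {T L y} → 0# ≤ T → 0# < L →
    (∀ {a b} → 0# ≤ a → a ≤ b → b ≤ T → f a - f b ∈± L * (b - a)) →
    y ≤ f 0# → f T ≤ y → ∃[ x ] (0# ≤ x × x ≤ T × f x ≈ y)
  intermediate-value f {T} {L} {y} 0≤T 0<L lipschitz y≤f0 fT≤y =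
    s , 0≤s , s≤T , O.antisym fs≤y y≤fs
    where
    S : ℝ → Set
    S t = 0# ≤ t × t ≤ T × y ≤ f t
    S-inhabited : ∃[ t ] S t
    S-inhabited = 0# , O.refl , 0≤T , y≤f0
    s : ℝ
    s = sup S
    ≤s : ∀ t → S t → t ≤ s
    ≤s = sup-upper S S-inhabited (T , λ t → proj₁ ∘ proj₂)
    0≤s : 0# ≤ s
    0≤s = ≤s 0# (proj₂ S-inhabited)
    s≤T : s ≤ T
    s≤T = sup-least S S-inhabited T (λ t → proj₁ ∘ proj₂)

    L*[z*L⁻¹] : ∀ z → L * (z * L ⁻¹) ≈ z
    L*[z*L⁻¹] z = begin-equality
      L * (z * L ⁻¹) ≈⟨ solve 3 (λ l z k → l :* (z :* k) := z :* (l :* k)) refl L z (L ⁻¹) ⟩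
      z * (L * L ⁻¹) ≈⟨ *-congˡ (⁻¹-inverseʳ L (0<x⇒x≉0 0<L)) ⟩
      z * 1#         ≈⟨ *-identityʳ z ⟩
      z              ∎

    0<y-x : ∀ {x y} → x < y → 0# < y - x
    0<y-x {x} {y} (x≤y , x≉y) = x≤y⇒0≤y-x x≤y , λ 0≈y-x → x≉y (begin-equality
      x            ≈⟨ +-identityˡ x ⟨
      0# + x       ≈⟨ +-congʳ 0≈y-x ⟩
      (y - x) + x  ≈⟨ solve 2 (λ x y → (y :- x) :+ x := y) refl x y ⟩
      y            ∎)

    x+δ≰x : ∀ {x δ} → 0# < δ → ¬ x + δ ≤ x
    x+δ≰x {x} {δ} 0<δ x+δ≤x = <⇒≱ 0<δ (≤-by (x - (x + δ)) (x≤y⇒0≤y-x x+δ≤x)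
      (solve 2 (λ x d → 𝟘ᵖ := d :+ (x :- (x :+ d))) refl x δ))

    y≤fs : y ≤ f s
    y≤fs = ≮⇒≥ λ fs<y →
      let δ = (y - f s) * L ⁻¹
          0<δ = *-positive (0<y-x fs<y) (⁻¹-positive 0<L)
          t≤s-δ = λ t (t∈S : S t) → ≤-by (s - t - δ)
            (x≤y⇒0≤y-x (*-cancelˡ-≤ 0<L (begin
              L * δ         ≈⟨ L*[z*L⁻¹] (y - f s) ⟩
              y - f s       ≤⟨ +-mono-≤ (proj₂ (proj₂ t∈S)) O.refl ⟩
              f t - f s     ≤⟨ proj₂ (lipschitz (proj₁ t∈S) (≤s t t∈S) s≤T) ⟩
              L * (s - t)   ∎)))
            (solve 3 (λ s t d → s :- d := t :+ (s :- t :- d)) refl s t δ)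
      in x+δ≰x 0<δ (≤-by (s - δ - s) (x≤y⇒0≤y-x (sup-least S S-inhabited (s - δ) t≤s-δ))
           (solve 2 (λ s d → s := (s :+ d) :+ (s :- d :- s)) refl s δ))

    fs≤y : f s ≤ y
    fs≤y = ≮⇒≥ λ y<fs →
      let δ = (f s - y) * L ⁻¹
          0<δ = *-positive (0<y-x y<fs) (⁻¹-positive 0<L)
          s≤s+δ = ≤-by δ (proj₁ 0<δ) refl
          -- As f has to come down to y before T, there is room for δ to the right of s.
          s+δ≤T = ≤-by (T - s - δ)
            (x≤y⇒0≤y-x (*-cancelˡ-≤ 0<L (begin
              L * δ         ≈⟨ L*[z*L⁻¹] (f s - y) ⟩
              f s - y       ≤⟨ +-mono-≤ O.refl (-‿anti-≤ fT≤y) ⟩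
              f s - f T     ≤⟨ proj₂ (lipschitz 0≤s s≤T O.refl) ⟩
              L * (T - s)   ∎)))
            (solve 3 (λ s t d → t := s :+ d :+ (t :- s :- d)) refl s T δ)
          y≤f[s+δ] = ≤-by (f s - y - (f s - f (s + δ)))
            (x≤y⇒0≤y-x (begin
              f s - f (s + δ)   ≤⟨ proj₂ (lipschitz 0≤s s≤s+δ s+δ≤T) ⟩
              L * (s + δ - s)   ≈⟨ *-congˡ (solve 2 (λ s d → s :+ d :- s := d) refl s δ) ⟩
              L * δ             ≈⟨ L*[z*L⁻¹] (f s - y) ⟩
              f s - y           ∎))
            (solve 3 (λ a b c → b := c :+ (a :- c :- (a :- b))) refl (f s) (f (s + δ)) y)
      in x+δ≰x 0<δ (≤s (s + δ) (O.trans 0≤s s≤s+δ , s+δ≤T , y≤f[s+δ]))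

  -- A root is found first and then identified with the supremum, since no z with z² ≤ x exceeds it.
  -- The square is negated because `intermediate-value` wants a function that starts high, and 1 + x
  -- is a valid right end because (1 + x)² ≥ x.
  √-square : ∀ {x} → 0# ≤ x → 0# ≤ √ x × (√ x) * (√ x) ≈ x
  √-square {x} 0≤x = O.trans 0≤r (O.reflexive r≈√x) ,
    trans (*-cong (sym r≈√x) (sym r≈√x)) r²≈x
    where
    0≤1+x : 0# ≤ 1# + x
    0≤1+x = +-nonNegative 0≤1 0≤x
    0<2[1+x] : 0# < (1# + x) + (1# + x)
    0<2[1+x] = <-≤-trans 0<1 (≤-by (x + (1# + x)) (+-nonNegative 0≤x 0≤1+x) (+-assoc 1# x _))
    lipschitz : ∀ {a b} → 0# ≤ a → a ≤ b → b ≤ 1# + x →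
                - (a * a) - - (b * b) ∈± ((1# + x) + (1# + x)) * (b - a)
    lipschitz {a} {b} 0≤a a≤b b≤ = ∈±-cong
      (solve 2 (λ a b → (a :+ b) :* (b :- a) := :- (a :* a) :- :- (b :* b)) refl a b)
      (*-∈± (∈±-weaken (+-mono-≤ (O.trans a≤b b≤) b≤) (∈±-self (+-nonNegative 0≤a (O.trans 0≤a a≤b))))
            (∈±-self (x≤y⇒0≤y-x a≤b)))
    root : ∃[ r ] (0# ≤ r × r ≤ 1# + x × - (r * r) ≈ - x)
    root = intermediate-value (λ z → - (z * z))
      0≤1+x 0<2[1+x] lipschitz
      (O.trans (0≤x⇒-x≤0 0≤x) (O.reflexive (solve 0 (𝟘ᵖ := :- (𝟘ᵖ :* 𝟘ᵖ)) refl)))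
      (≤-by (1# + x + x * x) (+-nonNegative 0≤1+x (0≤x² x))
        (solve 1 (λ x → :- x := :- ((𝟙ᵖ :+ x) :* (𝟙ᵖ :+ x)) :+ (𝟙ᵖ :+ x :+ x :* x)) refl x))
    r : ℝ
    r = proj₁ root
    0≤r : 0# ≤ r
    0≤r = proj₁ (proj₂ root)
    r²≈x : r * r ≈ x
    r²≈x = trans (sym (-‿involutive _)) (trans (-‿cong (proj₂ (proj₂ (proj₂ root)))) (-‿involutive x))
    z≤r : ∀ z → z * z ≤ x → z ≤ r
    z≤r z z²≤x with O.total 0# z
    ... | inj₁ 0≤z = x²-injective 0≤z 0≤r (O.trans z²≤x (O.reflexive (sym r²≈x)))
    ... | inj₂ z≤0 = O.trans z≤0 0≤r
    r≈√x : r ≈ √ x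
    r≈√x = O.antisym
      (sup-upper _ (r , O.reflexive r²≈x) (r , z≤r) r (O.reflexive r²≈x))
      (sup-least _ (r , O.reflexive r²≈x) r z≤r)

  three four : ℝ
  three = 1# + 1# + 1#
  four  = 1# + 1# + 1# + 1#

  𝟛ᵖ 𝟜ᵖ : ∀ {m} → Polynomial m
  𝟛ᵖ = con (3 , 0)
  𝟜ᵖ = con (4 , 0)

  0≤three : 0# ≤ three
  0≤three = +-nonNegative (+-nonNegative 0≤1 0≤1) 0≤1

  0≤four : 0# ≤ four
  0≤four = +-nonNegative 0≤three 0≤1

  -- cos √x = Σ γ x k / k!
  γ : ℝ → ℕ → ℝ
  γ x zero          = 1#
  γ x (suc zero)    = 0#
  γ x (suc (suc k)) = - x * γ x k

  cosTerm : ℝ → ℕ → ℝ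
  cosTerm x k = ε k * γ x k

  -- The corner entries of the powers of the generator depend only on x = t²/n, so x itself is the
  -- variable; a root is taken once, when t is chosen.
  cos√ : ℝ → ℝ
  cos√ x = lim (λ m → ∑ m (cosTerm x))

  module _ {x} (0≤x : 0# ≤ x) (x≤4 : x ≤ four) where

    -- Powers of 2 would do here, as x ≤ 4. Powers of 3 leave the slack for `γ-lipschitz`, where two
    -- steps multiply the bound by 1 + 4, which is at most 9 but not at most 4.
    γ-bounded : ∀ k → γ x k ∈± three ^ k
    γ-bounded zero          = ∈±-self 0≤1
    γ-bounded (suc zero)    = 0∈± (^-nonNegative 0≤three 1)
    γ-bounded (suc (suc k)) = ∈±-weaken
      (≤-by ((four + 1#) * p) (*-nonNegative (+-nonNegative 0≤four 0≤1) (^-nonNegative 0≤three k))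
        (solve 1 (λ p → 𝟛ᵖ :* (𝟛ᵖ :* p) := 𝟜ᵖ :* p :+ (𝟜ᵖ :+ 𝟙ᵖ) :* p) refl p))
      (*-∈± (-‿∈± (∈±-weaken x≤4 (∈±-self 0≤x))) (γ-bounded k))
      where
      p : ℝ
      p = three ^ k

    γ-lipschitz : ∀ {y} → x ≤ y → y ≤ four → ∀ k → γ x k - γ y k ∈± three ^ k * (y - x)
    γ-lipschitz {y} x≤y y≤4 = go
      where
      d : ℝ
      d = y - x
      0≤d : 0# ≤ d
      0≤d = x≤y⇒0≤y-x x≤y
      go : ∀ k → γ x k - γ y k ∈± three ^ k * d
      go zero          = ∈±-cong (sym (-‿inverseʳ 1#)) (0∈± (*-nonNegative 0≤1 0≤d))
      go (suc zero)    = ∈±-cong (sym (-‿inverseʳ 0#)) (0∈± (*-nonNegative (^-nonNegative 0≤three 1) 0≤d))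
      go (suc (suc k)) = ∈±-weaken
        (≤-by (four * (p * d)) (*-nonNegative 0≤four (*-nonNegative (^-nonNegative 0≤three k) 0≤d))
          (solve 2 (λ p d → 𝟛ᵖ :* (𝟛ᵖ :* p) :* d := (d :* p :+ 𝟜ᵖ :* (p :* d)) :+ 𝟜ᵖ :* (p :* d)) refl p d))
        (∈±-cong
          (solve 4 (λ x y g g′ → (y :- x) :* g :+ :- y :* (g :- g′) := :- x :* g :- :- y :* g′)
            refl x y (γ x k) (γ y k))
          (+-∈± (*-∈± (∈±-self 0≤d) (γ-bounded k))
                (*-∈± (-‿∈± (∈±-weaken y≤4 (∈±-self (O.trans 0≤x x≤y)))) (go k))))
        where
        p : ℝ
        p = three ^ k

  cosK : ℝ
  cosK = proj₁ (power/factorial-geometric 0≤three)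

  0≤cosK : 0# ≤ cosK
  0≤cosK = proj₁ (proj₂ (power/factorial-geometric 0≤three))

  ε*three^ : ∀ k → ε k * three ^ k ≤ cosK * q ^ k
  ε*three^ k = O.trans (O.reflexive (*-comm _ _)) (proj₂ (proj₂ (power/factorial-geometric 0≤three)) k)

  cos√-converges : ∀ {x} → 0# ≤ x → x ≤ four → (λ m → ∑ m (cosTerm x)) ⇝ cos√ x
  cos√-converges 0≤x x≤4 = series⇝lim 0≤cosK (λ k →
    ∈±-weaken (ε*three^ k) (*-∈± (∈±-self (proj₁ (0<ε k))) (γ-bounded 0≤x x≤4 k)))

  -- The termwise estimates are summed by `geometric-tail` from index 0 and passed to the limit. The
  -- additional `1#` makes the constant positive, as `intermediate-value` requires.
  cos√-lipschitz : ∀ {x y} → 0# ≤ x → x ≤ y → y ≤ four →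
                   cos√ x - cos√ y ∈± (cosK + cosK + 1#) * (y - x)
  cos√-lipschitz {x} {y} 0≤x x≤y y≤4 = ⇝-∈±
    (⇝-+ (cos√-converges 0≤x (O.trans x≤y y≤4)) (⇝-neg (cos√-converges (O.trans 0≤x x≤y) y≤4)))
    (λ m → ∈±-weaken
      (≤-by d 0≤d (solve 2 (λ K d → (K :+ K :+ 𝟙ᵖ) :* d := (K :* d :+ K :* d) :* 𝟙ᵖ :+ d) refl cosK d))
      (∈±-cong (difference m)
        (geometric-tail {a = λ m → ∑ m f} 0≤q q≤h (*-nonNegative 0≤cosK 0≤d) step {0} {m} ℕ.z≤n)))
    where
    d : ℝ
    d = y - x
    0≤d : 0# ≤ d
    0≤d = x≤y⇒0≤y-x x≤y
    f : ℕ → ℝ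
    f k = ε k * (γ x k - γ y k)
    step : ∀ m → ∑ (suc m) f - ∑ m f ∈± cosK * d * q ^ m
    step m = ∈±-cong
      (∑-increment m f)
      (∈±-weaken
        (begin
          ε m * (three ^ m * d)   ≈⟨ *-assoc _ _ _ ⟨
          ε m * three ^ m * d     ≈⟨ *-comm _ _ ⟩
          d * (ε m * three ^ m)   ≤⟨ *-monoˡ-≤ 0≤d (ε*three^ m) ⟩
          d * (cosK * q ^ m)      ≈⟨ solve 3 (λ d K q → d :* (K :* q) := K :* d :* q) refl d cosK (q ^ m) ⟩
          cosK * d * q ^ m        ∎)
        (*-∈± (∈±-self (proj₁ (0<ε m))) (γ-lipschitz 0≤x (O.trans x≤y y≤4) x≤y y≤4 m)))
    difference : ∀ m → ∑ m f - 0# ≈ ∑ m (cosTerm x) - ∑ m (cosTerm y)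
    difference m = begin-equality
      ∑ m f - 0#
        ≈⟨ trans (+-congˡ -0#≈0#) (+-identityʳ _) ⟩
      ∑ m f
        ≈⟨ ∑-cong m (λ k → solve 3 (λ e a b → e :* (a :- b) := e :* a :+ :- (e :* b)) refl (ε k) (γ x k) (γ y k)) ⟩
      ∑ m (λ k → cosTerm x k + - cosTerm y k)
        ≈⟨ ∑-distrib m (cosTerm x) (λ k → - cosTerm y k) ⟩
      ∑ m (cosTerm x) + ∑ m (λ k → - cosTerm y k)
        ≈⟨ +-congˡ (Σ-neg {m} (cosTerm y ∘ toℕ)) ⟩
      ∑ m (cosTerm x) - ∑ m (cosTerm y) ∎

  cos√0≈1 : cos√ 0# ≈ 1#
  -- The shift by `suc` skips the empty partial sum, the only one that differs from 1.
  cos√0≈1 = ⇝-unique (⇝-subsequence {s = suc} ℕ.n≤1+n (cos√-converges O.refl 0≤four))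
    (⇝-cong (λ m → sym (partial m)) (⇝-const 1#))
    where
    γ0 : ∀ k → γ 0# (suc k) ≈ 0#
    γ0 zero    = refl
    γ0 (suc k) = trans (*-congʳ -0#≈0#) (zeroˡ _)
    partial : ∀ m → ∑ (suc m) (cosTerm 0#) ≈ 1#
    partial m = begin-equality
      ε 0 * 1# + ∑ m (cosTerm 0# ∘ suc)
        ≈⟨ +-cong (trans (*-identityʳ _) ε-zero) (∑-cong m (λ k → trans (*-congˡ (γ0 k)) (zeroʳ (ε (suc k))))) ⟩
      1# + ∑ m (λ _ → 0#)
        ≈⟨ +-congˡ (sum-replicate-zero m) ⟩
      1# + 0#
        ≈⟨ +-identityʳ 1# ⟩
      1# ∎

  -- After the first five terms, whose sum is at most 0, the series is grouped
  -- into blocks of four starting at multiples of four.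
  cos√4≤0 : cos√ four ≤ 0#
  cos√4≤0 = ⇝-≤ (⇝-subsequence m≤s (cos√-converges 0≤four O.refl)) (proj₁ ∘ block)
    where
    f : ℕ → ℝ
    f = cosTerm four
    a : ℕ → ℝ
    a k = four * (ι k * ι (suc k))

    f-step : ∀ k → f (suc (suc k)) ≈ - (a k * f k)
    f-step k = begin-equality
      ε (suc (suc k)) * (- four * γ four k)
        ≈⟨ *-congʳ (trans (ε-suc (suc k)) (*-congˡ (ε-suc k))) ⟩
      ι (suc k) * (ι k * ε k) * (- four * γ four k)
        ≈⟨ solve 4 (λ i j e g → j :* (i :* e) :* (:- 𝟜ᵖ :* g) := :- (𝟜ᵖ :* (i :* j) :* (e :* g))) refl (ι k) (ι (suc k)) (ε k) (γ four k) ⟩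
      - (a k * f k) ∎

    0≤a : ∀ k → 0# ≤ a k
    0≤a k = *-nonNegative 0≤four (*-nonNegative (proj₁ (0<ι k)) (proj₁ (0<ι (suc k))))

    a≤1 : ∀ k → a (suc k) ≤ 1#
    a≤1 k = begin
      four * (ι (suc k) * ι (suc (suc k)))
        ≤⟨ *-monoˡ-≤ 0≤four (*-mono-≤ (proj₁ (0<ι (suc k))) 0≤h (ι-anti {1} {suc k} (ℕ.s≤s ℕ.z≤n)) (ι-anti {1} {suc (suc k)} (ℕ.s≤s ℕ.z≤n))) ⟩
      four * (h * h)
        ≈⟨ solve 1 (λ h → 𝟜ᵖ :* (h :* h) := (h :+ h) :* (h :+ h)) refl h ⟩
      (h + h) * (h + h)
        ≈⟨ *-cong h+h≈1 h+h≈1 ⟩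
      1# * 1#
        ≈⟨ *-identityˡ 1# ⟩
      1# ∎

    f0≈1 : f 0 ≈ 1#
    f0≈1 = trans (*-identityʳ _) ε-zero
    f1≈0 : f 1 ≈ 0#
    f1≈0 = zeroʳ _

    f-zero : ∀ k → f k ≈ 0# → f (suc (suc k)) ≈ 0#
    f-zero k fk≈0 = trans (f-step k) (trans (-‿cong (trans (*-congˡ fk≈0) (zeroʳ _))) -0#≈0#)

    f-double : ∀ k → f (4 ℕ.+ k) ≈ a (2 ℕ.+ k) * (a k * f k)
    f-double k = trans (f-step (2 ℕ.+ k)) (trans (-‿cong (*-congˡ (f-step k)))
      (solve 2 (λ b x → :- (b :* :- x) := b :* x) refl (a (2 ℕ.+ k)) (a k * f k)))

    a0≈2 : a 0 ≈ 1# + 1#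
    a0≈2 = begin-equality
      four * (ι 0 * h)
        ≈⟨ solve 2 (λ i h → 𝟜ᵖ :* (i :* h) := ((𝟙ᵖ :+ 𝟘ᵖ) :* i) :* ((h :+ h) :+ (h :+ h))) refl (ι 0) h ⟩
      (fromℕ 1 * ι 0) * ((h + h) + (h + h))
        ≈⟨ *-cong (fromℕ*ι 0) (+-cong h+h≈1 h+h≈1) ⟩
      1# * (1# + 1#)
        ≈⟨ *-identityˡ _ ⟩
      1# + 1# ∎

    -- The value is 1/3, but 1/2 is enough to bound the first terms by 1 - 2 + 1 = 0.
    a2≤h : a 2 ≤ h
    a2≤h = begin
      four * (ι 2 * ι 3)
        ≈⟨ solve 2 (λ i j → 𝟜ᵖ :* (i :* j) := ((𝟙ᵖ :+ (𝟙ᵖ :+ (𝟙ᵖ :+ (𝟙ᵖ :+ 𝟘ᵖ)))) :* j) :* i) refl (ι 2) (ι 3) ⟩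
      (fromℕ 4 * ι 3) * ι 2
        ≈⟨ *-congʳ (fromℕ*ι 3) ⟩
      1# * ι 2
        ≈⟨ *-identityˡ _ ⟩
      ι 2
        ≤⟨ ι-anti {1} {2} (ℕ.s≤s ℕ.z≤n) ⟩
      h ∎

    p : ℕ → ℕ
    p zero    = 4
    p (suc j) = 4 ℕ.+ p j

    m≤p : ∀ m → m ℕ.≤ p m
    m≤p zero    = ℕ.z≤n
    m≤p (suc m) = ℕ.s≤s (ℕ.m≤n⇒m≤1+n (ℕ.m≤n⇒m≤1+n (ℕ.m≤n⇒m≤1+n (m≤p m))))

    m≤s : ∀ m → m ℕ.≤ suc (p m)
    m≤s m = ℕ.m≤n⇒m≤1+n (m≤p m)

    -- With k = p j and f k ≥ 0, the next two even terms add up to -(1 - a (k + 2)) a k f k ≤ 0, and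
    -- the odd ones vanish.
    block : ∀ j → ∑ (suc (p j)) f ≤ 0# × 0# ≤ f (p j) × f (suc (p j)) ≈ 0#
    block zero = sum≤0 , 0≤f4 , f-zero 3 (f-zero 1 f1≈0)
      where
      0≤f4 : 0# ≤ f 4
      0≤f4 = O.trans (*-nonNegative (0≤a 2) (*-nonNegative (0≤a 0) (O.trans 0≤1 (O.reflexive (sym f0≈1)))))
                     (O.reflexive (sym (f-double 0)))
      f2≈-2 : f 2 ≈ - (1# + 1#)
      f2≈-2 = trans (f-step 0) (-‿cong (trans (*-cong a0≈2 f0≈1) (*-identityʳ _)))
      f4≤1 : f 4 ≤ 1#
      f4≤1 = begin
        f 4                        ≈⟨ f-double 0 ⟩
        a 2 * (a 0 * f 0)          ≈⟨ *-congˡ (trans (*-cong a0≈2 f0≈1) (*-identityʳ _)) ⟩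
        a 2 * (1# + 1#)            ≤⟨ *-mono-≤ (0≤a 2) (+-nonNegative 0≤1 0≤1) a2≤h O.refl ⟩
        h * (1# + 1#)              ≈⟨ solve 1 (λ h → h :* 𝟚ᵖ := h :+ h) refl h ⟩
        h + h                      ≈⟨ h+h≈1 ⟩
        1#                         ∎
      sum≤0 : ∑ 5 f ≤ 0#
      sum≤0 = begin
        f 0 + (f 1 + (f 2 + (f 3 + (f 4 + 0#))))
          ≤⟨ +-mono-≤ (O.reflexive f0≈1) (+-mono-≤ (O.reflexive f1≈0) (+-mono-≤ (O.reflexive f2≈-2)
               (+-mono-≤ (O.reflexive (f-zero 1 f1≈0)) (+-mono-≤ f4≤1 O.refl)))) ⟩
        1# + (0# + (- (1# + 1#) + (0# + (1# + 0#))))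
          ≈⟨ solve 0 (𝟙ᵖ :+ (𝟘ᵖ :+ (:- 𝟚ᵖ :+ (𝟘ᵖ :+ (𝟙ᵖ :+ 𝟘ᵖ)))) := 𝟘ᵖ) refl ⟩
        0# ∎
    block (suc j) with block j
    ... | sum≤0 , 0≤f , f≈0 = sum′≤0 , 0≤f′ , f-zero (3 ℕ.+ k) (f-zero (1 ℕ.+ k) f≈0)
      where
      k : ℕ
      k = p j
      0≤f′ : 0# ≤ f (4 ℕ.+ k)
      0≤f′ = O.trans (*-nonNegative (0≤a (2 ℕ.+ k)) (*-nonNegative (0≤a k) 0≤f)) (O.reflexive (sym (f-double k)))
      sum′≤0 : ∑ (5 ℕ.+ k) f ≤ 0#
      sum′≤0 = begin
        ∑ (5 ℕ.+ k) f
          ≈⟨ trans (∑-last (4 ℕ.+ k) f) (+-congʳ (trans (∑-last (3 ℕ.+ k) f) (+-congʳ (trans (∑-last (2 ℕ.+ k) f) (+-congʳ (∑-last (1 ℕ.+ k) f)))))) ⟩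
        ∑ (1 ℕ.+ k) f + f (1 ℕ.+ k) + f (2 ℕ.+ k) + f (3 ℕ.+ k) + f (4 ℕ.+ k)
          ≈⟨ +-cong (+-cong (+-cong (+-congˡ f≈0) (f-step k)) (f-zero (1 ℕ.+ k) f≈0)) (f-double k) ⟩
        ∑ (1 ℕ.+ k) f + 0# + - (a k * f k) + 0# + a (2 ℕ.+ k) * (a k * f k)
          ≤⟨ ≤-by ((1# - a (2 ℕ.+ k)) * (a k * f k))
               (*-nonNegative (x≤y⇒0≤y-x (a≤1 (1 ℕ.+ k))) (*-nonNegative (0≤a k) 0≤f))
               (solve 3 (λ s x b → s := (s :+ 𝟘ᵖ :+ :- x :+ 𝟘ᵖ :+ b :* x) :+ (𝟙ᵖ :- b) :* x) refl
                 (∑ (1 ℕ.+ k) f) (a k * f k) (a (2 ℕ.+ k))) ⟩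
        ∑ (1 ℕ.+ k) f
          ≤⟨ sum≤0 ⟩
        0# ∎

  -- The right end 4 is the square of the angle 2, at which the cosine has already become
  -- nonpositive.
  cos√-surjective : ∀ {y} → 0# ≤ y → y ≤ 1# →
                    ∃[ x ] (0# ≤ x × x ≤ four × cos√ x ≈ y)
  cos√-surjective 0≤y y≤1 = intermediate-value cos√ 0≤four
    (<-≤-trans 0<1 (≤-by (cosK + cosK) (+-nonNegative 0≤cosK 0≤cosK) (+-comm _ _)))
    cos√-lipschitz
    (O.trans y≤1 (O.reflexive (sym cos√0≈1)))
    (O.trans cos√4≤0 0≤y)

  -- The walk on the cone

  ℂ-commutativeRing : CommutativeRing _ _
  ℂ-commutativeRing = record
    { Carrier = ℂ
    ; _≈_     = _≈ᶜ_
    ; _+_     = _+ᶜ_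
    ; _*_     = _*ᶜ_
    ; -_      = -ᶜ_
    ; 0#      = 0ᶜ
    ; 1#      = 1ᶜ
    ; isCommutativeRing = record
      { isRing = record
        { +-isAbelianGroup = record
          { isGroup = record
            { isMonoid = record
              { isSemigroup = record
                { isMagma = record
                  { isEquivalence = record
                    { refl  = refl , refl
                    ; sym   = λ (r , i) → sym r , sym i
                    ; trans = λ (r , i) (r′ , i′) → trans r r′ , trans i i′
                    }
                  ; ∙-cong = λ (r , i) (r′ , i′) → +-cong r r′ , +-cong i i′
                  }
                ; assoc = λ z w u → +-assoc _ _ _ , +-assoc _ _ _
                }
              ; identity = (λ z → +-identityˡ _ , +-identityˡ _) , (λ z → +-identityʳ _ , +-identityʳ _)
              }
            ; inverse = (λ z → -‿inverseˡ _ , -‿inverseˡ _) , (λ z → -‿inverseʳ _ , -‿inverseʳ _)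
            ; ⁻¹-cong = λ (r , i) → -‿cong r , -‿cong i
            }
          ; comm = λ z w → +-comm _ _ , +-comm _ _
          }
        ; *-cong = λ (r , i) (r′ , i′) →
            +-cong (*-cong r r′) (-‿cong (*-cong i i′)) ,
            +-cong (*-cong r i′) (*-cong i r′)
        ; *-assoc = λ z w u →
            solve 6 (λ a b c d e f → (a :* c :- b :* d) :* e :- (a :* d :+ b :* c) :* f :=
                                     a :* (c :* e :- d :* f) :- b :* (c :* f :+ d :* e))
              refl (re z) (im z) (re w) (im w) (re u) (im u) ,
            solve 6 (λ a b c d e f → (a :* c :- b :* d) :* f :+ (a :* d :+ b :* c) :* e :=
                                     a :* (c :* f :+ d :* e) :+ b :* (c :* e :- d :* f))
              refl (re z) (im z) (re w) (im w) (re u) (im u)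
        ; *-identity =
            (λ z → solve 2 (λ a b → 𝟙ᵖ :* a :- 𝟘ᵖ :* b := a) refl (re z) (im z) ,
                   solve 2 (λ a b → 𝟙ᵖ :* b :+ 𝟘ᵖ :* a := b) refl (re z) (im z)) ,
            (λ z → solve 2 (λ a b → a :* 𝟙ᵖ :- b :* 𝟘ᵖ := a) refl (re z) (im z) ,
                   solve 2 (λ a b → a :* 𝟘ᵖ :+ b :* 𝟙ᵖ := b) refl (re z) (im z))
        ; distrib =
            (λ z w u →
              solve 6 (λ a b c d e f → a :* (c :+ e) :- b :* (d :+ f) := (a :* c :- b :* d) :+ (a :* e :- b :* f))
                refl (re z) (im z) (re w) (im w) (re u) (im u) ,
              solve 6 (λ a b c d e f → a :* (d :+ f) :+ b :* (c :+ e) := (a :* d :+ b :* c) :+ (a :* f :+ b :* e))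
                refl (re z) (im z) (re w) (im w) (re u) (im u)) ,
            (λ z w u →
              solve 6 (λ a b c d e f → (c :+ e) :* a :- (d :+ f) :* b := (c :* a :- d :* b) :+ (e :* a :- f :* b))
                refl (re z) (im z) (re w) (im w) (re u) (im u) ,
              solve 6 (λ a b c d e f → (c :+ e) :* b :+ (d :+ f) :* a := (c :* b :+ d :* a) :+ (e :* b :+ f :* a))
                refl (re z) (im z) (re w) (im w) (re u) (im u))
        }
      ; *-comm = λ z w →
          solve 4 (λ a b c d → a :* c :- b :* d := c :* a :- d :* b) refl (re z) (im z) (re w) (im w) ,
          solve 4 (λ a b c d → a :* d :+ b :* c := c :* b :+ d :* a) refl (re z) (im z) (re w) (im w)
      }
    }

  module C where
    open CommutativeRing ℂ-commutativeRing public
    open Algebra.Properties.Semiring.Sum (CommutativeRing.semiring ℂ-commutativeRing) public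
    open Relation.Binary.Reasoning.Setoid (CommutativeRing.setoid ℂ-commutativeRing) public

  ∣∣²-cong : ∀ {z w} → z ≈ᶜ w → ∣ z ∣² ≈ ∣ w ∣²
  ∣∣²-cong (r , i) = +-cong (*-cong r r) (*-cong i i)

  module _ {N} (M : Matrix N) where

    exp-cong : ∀ {v w v′ w′} → (∀ k → (M ^ᵐ k) v w ≈ᶜ (M ^ᵐ k) v′ w′) →
               exp M v w ≈ᶜ exp M v′ w′
    exp-cong {v} {w} {v′} {w′} M^k≈ =
      ⇝-unique (exp-re M v w) (⇝-cong (λ m → ∑-cong m (λ k → *-congˡ {ε k} (sym (proj₁ (M^k≈ k))))) (exp-re M v′ w′)) ,
      ⇝-unique (exp-im M v w) (⇝-cong (λ m → ∑-cong m (λ k → *-congˡ {ε k} (sym (proj₂ (M^k≈ k))))) (exp-im M v′ w′))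

    exp≈cos√ : ∀ {v w x} → 0# ≤ x → x ≤ four → (∀ k → (M ^ᵐ k) v w ≈ᶜ γ x k +i 0#) →
               exp M v w ≈ᶜ cos√ x +i 0#
    exp≈cos√ {v} {w} 0≤x x≤4 M^k≈ =
      ⇝-unique (exp-re M v w) (⇝-cong (λ m → ∑-cong m (λ k → *-congˡ {ε k} (sym (proj₁ (M^k≈ k))))) (cos√-converges 0≤x x≤4)) ,
      ⇝-unique (exp-im M v w) (⇝-cong (λ m → sym (trans
        (∑-cong m {g = λ _ → 0#} (λ k → trans (*-congˡ (proj₂ (M^k≈ k))) (zeroʳ (ε k))))
        (sum-replicate-zero m))) (⇝-const 0#))

  -- The interface between the analysis and the protocol, in terms of moduli only: column 0 makes
  -- the final state uniform, row 0 gives the success probability from every vertex, and unit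
  -- columns keep states normalized.
  record MixingTime {n} (H : Matrix (suc n)) : Set where
    field
      time      : ℝ
      0≤time    : 0# ≤ time
      time≤     : time ≤ (1# + 1#) * √ (fromℕ n)
      to-cone   : ∀ v → ∣ propagator H time v zero ∣² ≈ ι n
      from-cone : ∀ v → ∣ propagator H time zero v ∣² ≈ ι n
      unitary   : ∀ u → Σ (λ v → ∣ propagator H time v u ∣²) ≈ 1#

  module Cone {n} (A : Matrix n) (hermitian : IsHermitian A) (kernel : IsEigenvector A 0ᶜ 𝟏) where

    H : Matrix (suc n)
    H = ((fromℕ n ⁻¹) +i 0#) •ᵐ cone A

    cone-hermitian : ∀ v w → cone A v w ≈ᶜ conj (cone A w v)
    cone-hermitian zero    zero    = refl , sym -0#≈0#
    cone-hermitian zero    (suc j) = refl , sym -0#≈0#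
    cone-hermitian (suc i) zero    = refl , sym -0#≈0#
    cone-hermitian (suc i) (suc j) = hermitian i j

    module Generator (t : ℝ) where

      M : Matrix (suc n)
      M = (0# +i (- t)) •ᵐ H

      c : ℂ
      c = (0# +i (- t)) *ᶜ ((fromℕ n ⁻¹) +i 0#)

      M≈ : ∀ v w → M v w ≈ᶜ c *ᶜ cone A v w
      M≈ v w = C.sym (C.*-assoc (0# +i (- t)) ((fromℕ n ⁻¹) +i 0#) (cone A v w))

      M-skew : IsSkewHermitian M
      M-skew v w =
        trans (solve 4 (λ t s a b → 𝟘ᵖ :* (s :* a :- 𝟘ᵖ :* b) :- :- t :* (s :* b :+ 𝟘ᵖ :* a) := t :* (s :* b))
                refl t ν (re a) (im a))
          (trans (*-congˡ (*-congˡ (proj₂ (cone-hermitian v w))))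
            (solve 4 (λ t s a b → t :* (s :* :- b) := :- (𝟘ᵖ :* (s :* a :- 𝟘ᵖ :* b) :- :- t :* (s :* b :+ 𝟘ᵖ :* a)))
              refl t ν (re a′) (im a′))) ,
        trans (solve 4 (λ t s a b → 𝟘ᵖ :* (s :* b :+ 𝟘ᵖ :* a) :+ :- t :* (s :* a :- 𝟘ᵖ :* b) := :- t :* (s :* a))
                refl t ν (re a) (im a))
          (trans (*-congˡ (*-congˡ (proj₁ (cone-hermitian v w))))
            (solve 4 (λ t s a b → :- t :* (s :* a) := 𝟘ᵖ :* (s :* b :+ 𝟘ᵖ :* a) :+ :- t :* (s :* a :- 𝟘ᵖ :* b))
              refl t ν (re a′) (im a′)))
        where
        ν : ℝ
        ν = fromℕ n ⁻¹
        a a′ : ℂ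
        a = cone A v w
        a′ = cone A w v

      nᶜ : ℂ
      nᶜ = fromℕ n +i 0#

      -- The entries (0,0) and (v,0), or (0,v), of the powers of M for v ≠ 0.
      γᶜ δᶜ : ℕ → ℂ
      γᶜ zero    = 1ᶜ
      γᶜ (suc k) = nᶜ *ᶜ (c *ᶜ δᶜ k)
      δᶜ zero    = 0ᶜ
      δᶜ (suc k) = c *ᶜ γᶜ k

      Σᶜ-const : ∀ m z → Σᶜ {m} (λ _ → z) ≈ᶜ (fromℕ m +i 0#) *ᶜ z
      Σᶜ-const zero    z = C.sym (C.zeroˡ z)
      Σᶜ-const (suc m) z = C.trans (C.+-congˡ {z} (Σᶜ-const m z))
        (solve 3 (λ m a b → a :+ (m :* a :- 𝟘ᵖ :* b) := (𝟙ᵖ :+ m) :* a :- 𝟘ᵖ :* b) refl (fromℕ m) (re z) (im z) ,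
         solve 3 (λ m a b → b :+ (m :* b :+ 𝟘ᵖ :* a) := (𝟙ᵖ :+ m) :* b :+ 𝟘ᵖ :* a) refl (fromℕ m) (re z) (im z))

      row-sum : ∀ i → Σᶜ (λ j → A i j) ≈ᶜ 0ᶜ
      row-sum i = C.trans (Σᶜ-cong (λ j → C.sym (C.*-identityʳ (A i j))))
        (C.trans (proj₂ kernel i) (C.zeroˡ 1ᶜ))

      Σᶜ-conj : ∀ {m} (f : Fin m → ℂ) → Σᶜ (λ i → conj (f i)) ≈ᶜ conj (Σᶜ f)
      Σᶜ-conj {zero}  f = refl , sym -0#≈0#
      Σᶜ-conj {suc m} f = +-congˡ (proj₁ (Σᶜ-conj (f ∘ suc))) ,
        trans (+-congˡ (proj₂ (Σᶜ-conj (f ∘ suc)))) (-‿+-comm _ _)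

      -- Hermitian symmetry carries the kernel vector over to the left side of A, which is what the
      -- entries in row 0 of the powers require.
      column-sum : ∀ j → Σᶜ (λ i → A i j) ≈ᶜ 0ᶜ
      column-sum j = C.trans (Σᶜ-cong (λ i → hermitian i j)) (C.trans (Σᶜ-conj (A j))
        (proj₁ (row-sum j) , trans (-‿cong (proj₂ (row-sum j))) -0#≈0#))

      M-row-zero : ∀ (ψ : ℂ^ (suc n)) →
                   (M *ᵛ ψ) zero ≈ᶜ c *ᶜ Σᶜ (λ j → ψ (suc j))
      M-row-zero ψ = C.begin
        M zero zero *ᶜ ψ zero +ᶜ Σᶜ (λ j → M zero (suc j) *ᶜ ψ (suc j))
          C.≈⟨ C.+-cong
               (C.trans (C.*-congʳ {ψ zero} (C.trans (M≈ zero zero) (C.zeroʳ c))) (C.zeroˡ (ψ zero)))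
               (Σᶜ-cong (λ j → C.*-congʳ {ψ (suc j)} (C.trans (M≈ zero (suc j)) (C.*-identityʳ c)))) ⟩
        0ᶜ +ᶜ Σᶜ (λ j → c *ᶜ ψ (suc j))
          C.≈⟨ C.+-identityˡ (Σᶜ (λ j → c *ᶜ ψ (suc j))) ⟩
        Σᶜ (λ j → c *ᶜ ψ (suc j))
          C.≈⟨ C.*-distribˡ-sum c (λ j → ψ (suc j)) ⟨
        c *ᶜ Σᶜ (λ j → ψ (suc j)) C.∎

      M-row-suc : ∀ (ψ : ℂ^ (suc n)) i →
                  (M *ᵛ ψ) (suc i) ≈ᶜ c *ᶜ ψ zero +ᶜ Σᶜ (λ j → c *ᶜ (A i j *ᶜ ψ (suc j)))
      M-row-suc ψ i = C.+-cong
        (C.*-congʳ {ψ zero} (C.trans (M≈ (suc i) zero) (C.*-identityʳ c)))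
        (Σᶜ-cong (λ j → C.trans (C.*-congʳ {ψ (suc j)} (M≈ (suc i) (suc j))) (C.*-assoc c (A i j) (ψ (suc j)))))

      -- Off the conical vertex the column is constant, so its contribution through A vanishes with
      -- the row sums and only the edges at the conical vertex count.
      column : ∀ k → (M ^ᵐ k) zero zero ≈ᶜ γᶜ k × (∀ i → (M ^ᵐ k) (suc i) zero ≈ᶜ δᶜ k)
      column zero    = C.refl , λ i → C.refl
      column (suc k) = top , rest
        where
        ψ : ℂ^ (suc n)
        ψ v = (M ^ᵐ k) v zero
        ψ-top : ψ zero ≈ᶜ γᶜ k
        ψ-top = proj₁ (column k)
        ψ-rest : ∀ i → ψ (suc i) ≈ᶜ δᶜ k
        ψ-rest = proj₂ (column k)
        top : (M *ᵛ ψ) zero ≈ᶜ γᶜ (suc k)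
        top = C.begin
          (M *ᵛ ψ) zero                    C.≈⟨ M-row-zero ψ ⟩
          c *ᶜ Σᶜ (λ j → ψ (suc j))        C.≈⟨ C.*-congˡ {c} (Σᶜ-cong ψ-rest) ⟩
          c *ᶜ Σᶜ {n} (λ _ → δᶜ k)         C.≈⟨ C.*-congˡ {c} (Σᶜ-const n (δᶜ k)) ⟩
          c *ᶜ (nᶜ *ᶜ δᶜ k)                C.≈⟨ C.*-assoc c nᶜ (δᶜ k) ⟨
          (c *ᶜ nᶜ) *ᶜ δᶜ k                C.≈⟨ C.*-congʳ {δᶜ k} (C.*-comm c nᶜ) ⟩
          (nᶜ *ᶜ c) *ᶜ δᶜ k                C.≈⟨ C.*-assoc nᶜ c (δᶜ k) ⟩
          nᶜ *ᶜ (c *ᶜ δᶜ k)                C.∎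
        rest : ∀ i → (M *ᵛ ψ) (suc i) ≈ᶜ δᶜ (suc k)
        rest i = C.begin
          (M *ᵛ ψ) (suc i)
            C.≈⟨ M-row-suc ψ i ⟩
          c *ᶜ ψ zero +ᶜ Σᶜ (λ j → c *ᶜ (A i j *ᶜ ψ (suc j)))
            C.≈⟨ C.+-cong (C.*-congˡ {c} ψ-top) (Σᶜ-cong (λ j → C.*-congˡ {c} (C.*-congˡ {A i j} (ψ-rest j)))) ⟩
          c *ᶜ γᶜ k +ᶜ Σᶜ (λ j → c *ᶜ (A i j *ᶜ δᶜ k))
            C.≈⟨ C.+-congˡ {c *ᶜ γᶜ k} (C.*-distribˡ-sum c (λ j → A i j *ᶜ δᶜ k)) ⟨
          c *ᶜ γᶜ k +ᶜ c *ᶜ Σᶜ (λ j → A i j *ᶜ δᶜ k)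
            C.≈⟨ C.+-congˡ {c *ᶜ γᶜ k} (C.*-congˡ {c} (C.*-distribʳ-sum (δᶜ k) (λ j → A i j))) ⟨
          c *ᶜ γᶜ k +ᶜ c *ᶜ (Σᶜ (λ j → A i j) *ᶜ δᶜ k)
            C.≈⟨ C.+-congˡ {c *ᶜ γᶜ k} (C.*-congˡ {c} (C.trans (C.*-congʳ {δᶜ k} (row-sum i)) (C.zeroˡ (δᶜ k)))) ⟩
          c *ᶜ γᶜ k +ᶜ c *ᶜ 0ᶜ
            C.≈⟨ C.+-congˡ {c *ᶜ γᶜ k} (C.zeroʳ c) ⟩
          c *ᶜ γᶜ k +ᶜ 0ᶜ
            C.≈⟨ C.+-identityʳ (c *ᶜ γᶜ k) ⟩
          c *ᶜ γᶜ k C.∎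

      -- The column of a vertex l ≠ 0 need not be constant off the conical vertex. Since the columns
      -- of A sum to 0, its top entry and the sum of its other entries nevertheless obey a closed
      -- recursion, the one of δᶜ and γᶜ. This spares a transposition of the powers.
      row : ∀ l k → (M ^ᵐ k) zero (suc l) ≈ᶜ δᶜ k × Σᶜ (λ i → (M ^ᵐ k) (suc i) (suc l)) ≈ᶜ γᶜ k
      row l zero    = C.refl , C.trans
        (Σᶜ-single l (λ i i≢l → C.reflexive (basis-off {v = suc i} {suc l} (λ { ≡.refl → i≢l ≡.refl }))))
        (C.reflexive (basis-diagonal (suc l)))
      row l (suc k) = top , rest
        where
        ψ : ℂ^ (suc n)
        ψ v = (M ^ᵐ k) v (suc l)
        top : (M *ᵛ ψ) zero ≈ᶜ δᶜ (suc k)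
        top = C.trans (M-row-zero ψ) (C.*-congˡ {c} (proj₂ (row l k)))
        columns : Σᶜ (λ i → Σᶜ (λ j → c *ᶜ (A i j *ᶜ ψ (suc j)))) ≈ᶜ 0ᶜ
        columns = C.begin
          Σᶜ (λ i → Σᶜ (λ j → c *ᶜ (A i j *ᶜ ψ (suc j))))
            C.≈⟨ C.∑-comm (λ i j → c *ᶜ (A i j *ᶜ ψ (suc j))) ⟩
          Σᶜ (λ j → Σᶜ (λ i → c *ᶜ (A i j *ᶜ ψ (suc j))))
            C.≈⟨ Σᶜ-cong (λ j → C.begin
                 Σᶜ (λ i → c *ᶜ (A i j *ᶜ ψ (suc j)))   C.≈⟨ C.*-distribˡ-sum c (λ i → A i j *ᶜ ψ (suc j)) ⟨
                 c *ᶜ Σᶜ (λ i → A i j *ᶜ ψ (suc j))     C.≈⟨ C.*-congˡ {c} (C.*-distribʳ-sum (ψ (suc j)) (λ i → A i j)) ⟨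
                 c *ᶜ (Σᶜ (λ i → A i j) *ᶜ ψ (suc j))   C.≈⟨ C.*-congˡ {c} (C.trans (C.*-congʳ {ψ (suc j)} (column-sum j)) (C.zeroˡ (ψ (suc j)))) ⟩
                 c *ᶜ 0ᶜ                                C.≈⟨ C.zeroʳ c ⟩
                 0ᶜ                                     C.∎) ⟩
          Σᶜ {n} (λ _ → 0ᶜ)
            C.≈⟨ C.sum-replicate-zero n ⟩
          0ᶜ C.∎
        rest : Σᶜ (λ i → (M *ᵛ ψ) (suc i)) ≈ᶜ γᶜ (suc k)
        rest = C.begin
          Σᶜ (λ i → (M *ᵛ ψ) (suc i))
            C.≈⟨ Σᶜ-cong (M-row-suc ψ) ⟩
          Σᶜ (λ i → c *ᶜ ψ zero +ᶜ Σᶜ (λ j → c *ᶜ (A i j *ᶜ ψ (suc j))))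
            C.≈⟨ C.∑-distrib-+ (λ _ → c *ᶜ ψ zero) (λ i → Σᶜ (λ j → c *ᶜ (A i j *ᶜ ψ (suc j)))) ⟩
          Σᶜ {n} (λ _ → c *ᶜ ψ zero) +ᶜ Σᶜ (λ i → Σᶜ (λ j → c *ᶜ (A i j *ᶜ ψ (suc j))))
            C.≈⟨ C.+-cong (Σᶜ-const n (c *ᶜ ψ zero)) columns ⟩
          nᶜ *ᶜ (c *ᶜ ψ zero) +ᶜ 0ᶜ
            C.≈⟨ C.+-identityʳ (nᶜ *ᶜ (c *ᶜ ψ zero)) ⟩
          nᶜ *ᶜ (c *ᶜ ψ zero)
            C.≈⟨ C.*-congˡ {nᶜ} (C.*-congˡ {c} (proj₁ (row l k))) ⟩
          nᶜ *ᶜ (c *ᶜ δᶜ k) C.∎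

      -- Two steps multiply by n c², and c = -it/n makes this -t²/n = -x, the factor in the
      -- recursion of γ.
      γᶜ≈γ : ∀ {x} → fromℕ n * fromℕ n ⁻¹ ≈ 1# → t * t ≈ x * fromℕ n →
             ∀ k → γᶜ k ≈ᶜ γ x k +i 0#
      γᶜ≈γ {x} nν≈1 t²≈xn zero = C.refl
      γᶜ≈γ {x} nν≈1 t²≈xn (suc zero) =
        C.trans (C.*-congˡ {nᶜ} (C.zeroʳ c)) (C.zeroʳ nᶜ)
      γᶜ≈γ {x} nν≈1 t²≈xn (suc (suc k)) =
        trans (solve 5 (λ n t v a b →
                let cr = 𝟘ᵖ :* v :- :- t :* 𝟘ᵖ
                    ci = 𝟘ᵖ :* 𝟘ᵖ :+ :- t :* v
                    dr = cr :* a :- ci :* b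
                    di = cr :* b :+ ci :* a
                in n :* (cr :* dr :- ci :* di) :- 𝟘ᵖ :* (cr :* di :+ ci :* dr) := :- (t :* t :* (n :* v :* v)) :* a)
                refl (fromℕ n) t ν (re (γᶜ k)) (im (γᶜ k)))
          (*-cong (-‿cong factor) (proj₁ (γᶜ≈γ {x} nν≈1 t²≈xn k))) ,
        trans (solve 5 (λ n t v a b →
                let cr = 𝟘ᵖ :* v :- :- t :* 𝟘ᵖ
                    ci = 𝟘ᵖ :* 𝟘ᵖ :+ :- t :* v
                    dr = cr :* a :- ci :* b
                    di = cr :* b :+ ci :* a
                in n :* (cr :* di :+ ci :* dr) :+ 𝟘ᵖ :* (cr :* dr :- ci :* di) := :- (t :* t :* (n :* v :* v)) :* b)
                refl (fromℕ n) t ν (re (γᶜ k)) (im (γᶜ k)))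
          (trans (*-congˡ (proj₂ (γᶜ≈γ {x} nν≈1 t²≈xn k))) (zeroʳ _))
        where
        ν : ℝ
        ν = fromℕ n ⁻¹
        factor : t * t * (fromℕ n * ν * ν) ≈ x
        factor = begin-equality
          t * t * (fromℕ n * ν * ν)            ≈⟨ *-congʳ t²≈xn ⟩
          x * fromℕ n * (fromℕ n * ν * ν)      ≈⟨ solve 3 (λ x n v → x :* n :* (n :* v :* v) := x :* ((n :* v) :* (n :* v))) refl x (fromℕ n) ν ⟩
          x * ((fromℕ n * ν) * (fromℕ n * ν))  ≈⟨ *-congˡ (*-cong nν≈1 nν≈1) ⟩
          x * (1# * 1#)                        ≈⟨ solve 1 (λ x → x :* (𝟙ᵖ :* 𝟙ᵖ) := x) refl x ⟩
          x                                    ∎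

  mixingTime : ∀ {n} (A : Matrix (suc n)) hermitian kernel → MixingTime (Cone.H A hermitian kernel)
  mixingTime {n′} A hermitian kernel = record
    { time      = t
    ; 0≤time    = *-nonNegative (proj₁ √x) (proj₁ √n)
    ; time≤     = *-mono-≤ (proj₁ √x) (proj₁ √n) √x≤2 O.refl
    ; to-cone   = λ { zero → corner ; (suc j) → trans (∣∣²-cong (side j)) first }
    ; from-cone = λ { zero → corner ; (suc l) → trans (∣∣²-cong (mirror l)) first }
    ; unitary   = unitary
    }
    where
    open Cone A hermitian kernel
    n : ℕ
    n = suc n′
    √ι : 0# ≤ √ (ι n) × (√ (ι n)) * (√ (ι n)) ≈ ι n
    √ι = √-square (proj₁ (0<ι n))
    √ι≤1 : √ (ι n) ≤ 1#
    √ι≤1 = x²-injective (proj₁ √ι) 0≤1 (begin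
      (√ (ι n)) * (√ (ι n)) ≈⟨ proj₂ √ι ⟩
      ι n                   ≤⟨ ι≤1 n ⟩
      1#                    ≈⟨ *-identityˡ 1# ⟨
      1# * 1#               ∎)
    angle : ∃[ x ] (0# ≤ x × x ≤ four × cos√ x ≈ √ (ι n))
    angle = cos√-surjective (proj₁ √ι) √ι≤1
    x : ℝ
    x = proj₁ angle
    0≤x : 0# ≤ x
    0≤x = proj₁ (proj₂ angle)
    x≤4 : x ≤ four
    x≤4 = proj₁ (proj₂ (proj₂ angle))
    √x : 0# ≤ √ x × (√ x) * (√ x) ≈ x
    √x = √-square 0≤x
    √n : 0# ≤ √ (fromℕ n) × (√ (fromℕ n)) * (√ (fromℕ n)) ≈ fromℕ n
    √n = √-square (0≤fromℕ n)
    √x≤2 : √ x ≤ 1# + 1#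
    √x≤2 = x²-injective (proj₁ √x) (+-nonNegative 0≤1 0≤1)
      (O.trans (O.reflexive (proj₂ √x)) (O.trans x≤4 (O.reflexive (solve 0 (𝟜ᵖ := 𝟚ᵖ :* 𝟚ᵖ) refl))))
    -- The angle t/√n has to be √x.
    t : ℝ
    t = (√ x) * (√ (fromℕ n))
    t²≈xn : t * t ≈ x * fromℕ n
    t²≈xn = trans (solve 2 (λ a b → a :* b :* (a :* b) := (a :* a) :* (b :* b)) refl (√ x) (√ (fromℕ n)))
      (*-cong (proj₂ √x) (proj₂ √n))

    open Generator t

    U : Matrix (suc n)
    U = propagator H t

    unitary : ∀ u → Σ (λ v → ∣ U v u ∣²) ≈ 1#
    unitary = exp-unitary {M = M} M-skew

    corner : ∣ U zero zero ∣² ≈ ι n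
    corner = begin-equality
      ∣ U zero zero ∣²
        ≈⟨ ∣∣²-cong (exp≈cos√ M 0≤x x≤4 (λ k → C.trans (proj₁ (column k)) (γᶜ≈γ {x} (⁻¹-inverseʳ _ (0<x⇒x≉0 (0<fromℕ n′))) t²≈xn k))) ⟩
      cos√ x * cos√ x + 0# * 0#
        ≈⟨ solve 1 (λ c → c :* c :+ 𝟘ᵖ :* 𝟘ᵖ := c :* c) refl (cos√ x) ⟩
      cos√ x * cos√ x
        ≈⟨ *-cong (proj₂ (proj₂ (proj₂ angle))) (proj₂ (proj₂ (proj₂ angle))) ⟩
      (√ (ι n)) * (√ (ι n))
        ≈⟨ proj₂ √ι ⟩
      ι n ∎

    side : ∀ j → U (suc j) zero ≈ᶜ U (suc zero) zero
    side j = exp-cong M (λ k → C.trans (proj₂ (column k) j) (C.sym (proj₂ (column k) zero)))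

    mirror : ∀ l → U zero (suc l) ≈ᶜ U (suc zero) zero
    mirror l = exp-cong M (λ k → C.trans (proj₁ (row l k)) (C.sym (proj₂ (column k) zero)))

    Σ-const : ∀ m z → Σ {m} (λ _ → z) ≈ fromℕ m * z
    Σ-const zero    z = sym (zeroˡ z)
    Σ-const (suc m) z = trans (+-congˡ (Σ-const m z))
      (solve 2 (λ m z → z :+ m :* z := (𝟙ᵖ :+ m) :* z) refl (fromℕ m) z)

    -- Vertex 1, which exists as n is positive, represents all entries compared by `side` and
    -- `mirror`. The norm of column 0 gives n s = 1 - 1/(n + 1).
    first : ∣ U (suc zero) zero ∣² ≈ ι n
    first = *-cancelˡ (0<x⇒x≉0 (0<fromℕ n′)) (begin-equality
      fromℕ n * s
        ≈⟨ solve 2 (λ i z → z := (i :+ z) :- i) refl (ι n) (fromℕ n * s) ⟩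
      (ι n + fromℕ n * s) - ι n
        ≈⟨ +-congʳ (+-cong corner (trans (Σ-cong (λ j → ∣∣²-cong (side j))) (Σ-const n s))) ⟨
      Σ (λ v → ∣ U v zero ∣²) - ι n
        ≈⟨ +-congʳ (trans (unitary zero) (sym (fromℕ*ι n))) ⟩
      fromℕ (suc n) * ι n - ι n
        ≈⟨ solve 2 (λ n i → (𝟙ᵖ :+ n) :* i :- i := n :* i) refl (fromℕ n) (ι n) ⟩
      fromℕ n * ι n ∎)
      where
      s : ℝ
      s = ∣ U (suc zero) zero ∣²

  -- Measurements and the protocol

  module _ {N} (a : Fin N) (ψ : ℂ^ N) where

    projection-true : ∀ v → (projection a true *ᵛ ψ) v ≈ᶜ basis a v *ᶜ ψ a
    projection-true v = C.trans
      (Σᶜ-single a (λ w w≢a → C.trans (C.*-congʳ {ψ w} (C.trans (C.*-congˡ {basis a v}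
          (C.reflexive (basis-off (w≢a ∘ ≡.sym)))) (C.zeroʳ (basis a v)))) (C.zeroˡ (ψ w))))
      (C.*-congʳ {ψ a} (C.trans (C.*-congˡ {basis a v} (C.reflexive (basis-diagonal a))) (C.*-identityʳ (basis a v))))

    projection-true-on : (projection a true *ᵛ ψ) a ≈ᶜ ψ a
    projection-true-on = C.trans (projection-true a)
      (C.trans (C.*-congʳ {ψ a} (C.reflexive (basis-diagonal a))) (C.*-identityˡ (ψ a)))

    projection-true-off : ∀ {v} → ¬ v ≡ a → (projection a true *ᵛ ψ) v ≈ᶜ 0ᶜ
    projection-true-off {v} v≢a = C.trans (projection-true v)
      (C.trans (C.*-congʳ {ψ a} (C.reflexive (basis-off (v≢a ∘ ≡.sym)))) (C.zeroˡ (ψ a)))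

    -- As P₀ + P₁ = I, the entries for outcome `false` follow from those for outcome `true` without
    -- evaluating another sum.
    projection-sum : ∀ v → (projection a false *ᵛ ψ) v +ᶜ (projection a true *ᵛ ψ) v ≈ᶜ ψ v
    projection-sum v = C.begin
      (projection a false *ᵛ ψ) v +ᶜ (projection a true *ᵛ ψ) v
        C.≈⟨ C.∑-distrib-+ (λ w → projection a false v w *ᶜ ψ w) (λ w → projection a true v w *ᶜ ψ w) ⟨
      Σᶜ (λ w → projection a false v w *ᶜ ψ w +ᶜ projection a true v w *ᶜ ψ w)
        C.≈⟨ Σᶜ-cong (λ w → cancel (I v w) (projection a true v w) (ψ w)) ⟩
      Σᶜ (λ w → I v w *ᶜ ψ w)
        C.≈⟨ Σᶜ-single v (λ w w≢v → C.trans (C.*-congʳ {ψ w} (C.reflexive (basis-off (w≢v ∘ ≡.sym)))) (C.zeroˡ (ψ w))) ⟩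
      I v v *ᶜ ψ v
        C.≈⟨ C.trans (C.*-congʳ {ψ v} (C.reflexive (basis-diagonal v))) (C.*-identityˡ (ψ v)) ⟩
      ψ v C.∎
      where
      cancel : ∀ i p z → (i +ᶜ -ᶜ p) *ᶜ z +ᶜ p *ᶜ z ≈ᶜ i *ᶜ z
      cancel i p z = C.trans (C.sym (C.distribʳ z (i +ᶜ -ᶜ p) p)) (C.*-congʳ {z}
        (C.trans (C.+-assoc i (-ᶜ p) p) (C.trans (C.+-congˡ {i} (C.-‿inverseˡ p)) (C.+-identityʳ i))))

    projection-false-off : ∀ {v} → ¬ v ≡ a → (projection a false *ᵛ ψ) v ≈ᶜ ψ v
    projection-false-off {v} v≢a = C.trans
      (C.sym (C.trans (C.+-congˡ {(projection a false *ᵛ ψ) v} (projection-true-off v≢a)) (C.+-identityʳ _)))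
      (projection-sum v)

    projection-false-on : (projection a false *ᵛ ψ) a ≈ᶜ 0ᶜ
    projection-false-on = C.begin
      z                       C.≈⟨ C.+-identityʳ z ⟨
      z +ᶜ 0ᶜ                 C.≈⟨ C.+-congˡ {z} (C.-‿inverseʳ (ψ a)) ⟨
      z +ᶜ (ψ a +ᶜ -ᶜ ψ a)    C.≈⟨ C.+-assoc z (ψ a) (-ᶜ ψ a) ⟨
      (z +ᶜ ψ a) +ᶜ -ᶜ ψ a    C.≈⟨ C.+-congʳ { -ᶜ ψ a} (C.trans (C.+-congˡ {z} (C.sym projection-true-on)) (projection-sum a)) ⟩
      ψ a +ᶜ -ᶜ ψ a           C.≈⟨ C.-‿inverseʳ (ψ a) ⟩
      0ᶜ                      C.∎
      where
      z : ℂ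
      z = (projection a false *ᵛ ψ) a

  ∣0∣²≈0 : ∀ {z} → z ≈ᶜ 0ᶜ → ∣ z ∣² ≈ 0#
  ∣0∣²≈0 z≈0 = trans (∣∣²-cong z≈0) (solve 0 (𝟘ᵖ :* 𝟘ᵖ :+ 𝟘ᵖ :* 𝟘ᵖ := 𝟘ᵖ) refl)

  0≤∣∣² : ∀ z → 0# ≤ ∣ z ∣²
  0≤∣∣² z = +-nonNegative (0≤x² (re z)) (0≤x² (im z))

  ∣∣²-* : ∀ z w → ∣ z *ᶜ w ∣² ≈ ∣ z ∣² * ∣ w ∣²
  ∣∣²-* z w = solve 4 (λ a b c d → (a :* c :- b :* d) :* (a :* c :- b :* d) :+ (a :* d :+ b :* c) :* (a :* d :+ b :* c) :=
      (a :* a :+ b :* b) :* (c :* c :+ d :* d)) refl (re z) (im z) (re w) (im w)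

  -- A basis vector up to a phase: a measurement that finds the walk at a keeps the phase of its
  -- amplitude there.
  Localized : ∀ {N} → Fin N → ℂ^ N → Set
  Localized a ψ = (∀ v → ¬ v ≡ a → ψ v ≈ᶜ 0ᶜ) × ∥ ψ ∥² ≈ 1#

  localized-on : ∀ {N} {a : Fin N} {ψ} → Localized a ψ → ∣ ψ a ∣² ≈ 1#
  localized-on {a = a} (off , norm) =
    trans (sym (Σ-single a (λ v v≢a → ∣0∣²≈0 (off v v≢a)))) norm

  basis-localized : ∀ {N} (u : Fin N) → Localized u (basis u)
  basis-localized u = off , trans (Σ-single u (λ v v≢u → ∣0∣²≈0 (off v v≢u)))
    (trans (reflexive (≡.cong ∣_∣² (basis-diagonal u))) (solve 0 (𝟙ᵖ :* 𝟙ᵖ :+ 𝟘ᵖ :* 𝟘ᵖ := 𝟙ᵖ) refl))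
    where
    off : ∀ v → ¬ v ≡ u → basis u v ≈ᶜ 0ᶜ
    off v v≢u = C.reflexive (basis-off (v≢u ∘ ≡.sym))

  evolve-localized : ∀ {N} (U : Matrix N) {a ψ} → Localized a ψ → ∀ v → ∣ (U *ᵛ ψ) v ∣² ≈ ∣ U v a ∣²
  evolve-localized U {a} {ψ} loc v = begin-equality
    ∣ (U *ᵛ ψ) v ∣²
      ≈⟨ ∣∣²-cong (Σᶜ-single a (λ w w≢a → C.trans (C.*-congˡ {U v w} (proj₁ loc w w≢a)) (C.zeroʳ (U v w)))) ⟩
    ∣ U v a *ᶜ ψ a ∣²
      ≈⟨ ∣∣²-* (U v a) (ψ a) ⟩
    ∣ U v a ∣² * ∣ ψ a ∣²
      ≈⟨ trans (*-congˡ (localized-on loc)) (*-identityʳ _) ⟩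
    ∣ U v a ∣² ∎

  0≤probability : ∀ {N} (a : Fin N) b ψ → 0# ≤ outcomeProbability a b ψ
  0≤probability a b ψ = Σ-nonNegative (λ v → 0≤∣∣² ((projection a b *ᵛ ψ) v))

  probability-true : ∀ {N} (a : Fin N) ψ → outcomeProbability a true ψ ≈ ∣ ψ a ∣²
  probability-true a ψ = trans
    (Σ-single a (λ v v≢a → ∣0∣²≈0 (projection-true-off a ψ v≢a)))
    (∣∣²-cong (projection-true-on a ψ))

  probability-total : ∀ {N} (a : Fin N) ψ →
    outcomeProbability a true ψ + outcomeProbability a false ψ ≈ ∥ ψ ∥²
  probability-total a ψ = trans
    (sym (∑-distrib-+ (λ v → ∣ (projection a true *ᵛ ψ) v ∣²) (λ v → ∣ (projection a false *ᵛ ψ) v ∣²)))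
    (Σ-cong entry)
    where
    entry : ∀ v → ∣ (projection a true *ᵛ ψ) v ∣² + ∣ (projection a false *ᵛ ψ) v ∣² ≈ ∣ ψ v ∣²
    entry v with v Fin.≟ a
    ... | yes ≡.refl = trans (+-cong (∣∣²-cong (projection-true-on a ψ)) (∣0∣²≈0 (projection-false-on a ψ))) (+-identityʳ _)
    ... | no v≢a = trans (+-cong (∣0∣²≈0 (projection-true-off a ψ v≢a)) (∣∣²-cong (projection-false-off a ψ v≢a))) (+-identityˡ _)

  collapse-norm : ∀ {N} (a : Fin N) b ψ → 0# < outcomeProbability a b ψ → ∥ collapse a b ψ ∥² ≈ 1#
  collapse-norm a b ψ 0<p = begin-equality
    ∥ collapse a b ψ ∥²
      ≈⟨ Σ-cong (λ v → solve 3 (λ r x y → r :* x :* (r :* x) :+ r :* y :* (r :* y) := r :* r :* (x :* x :+ y :* y))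
           refl r (re ((projection a b *ᵛ ψ) v)) (im ((projection a b *ᵛ ψ) v))) ⟩
    Σ (λ v → r * r * ∣ (projection a b *ᵛ ψ) v ∣²)
      ≈⟨ *-distribˡ-sum (r * r) (λ v → ∣ (projection a b *ᵛ ψ) v ∣²) ⟨
    r * r * p
      ≈⟨ *-congˡ (proj₂ (√-square (proj₁ 0<p))) ⟨
    r * r * ((√ p) * (√ p))
      ≈⟨ solve 2 (λ r s → r :* r :* (s :* s) := (s :* r) :* (s :* r)) refl r (√ p) ⟩
    ((√ p) * r) * ((√ p) * r)
      ≈⟨ *-cong √p*r≈1 √p*r≈1 ⟩
    1# * 1#
      ≈⟨ *-identityˡ 1# ⟩
    1# ∎
    where
    p r : ℝ
    p = outcomeProbability a b ψ
    r = (√ p) ⁻¹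
    √p*r≈1 : (√ p) * r ≈ 1#
    √p*r≈1 = ⁻¹-inverseʳ (√ p) (λ √p≈0 → 0<x⇒x≉0 0<p
      (trans (sym (proj₂ (√-square (proj₁ 0<p)))) (trans (*-congʳ √p≈0) (zeroˡ _))))

  collapse-zero : ∀ {N} (a : Fin N) b ψ {v} → (projection a b *ᵛ ψ) v ≈ᶜ 0ᶜ → collapse a b ψ v ≈ᶜ 0ᶜ
  collapse-zero a b ψ (r≈0 , i≈0) = trans (*-congˡ r≈0) (zeroʳ _) , trans (*-congˡ i≈0) (zeroʳ _)

  collapse-localized : ∀ {N} (a : Fin N) ψ → 0# < outcomeProbability a true ψ →
                       Localized a (collapse a true ψ)
  collapse-localized a ψ 0<p =
    (λ v v≢a → collapse-zero a true ψ (projection-true-off a ψ v≢a)) , collapse-norm a true ψ 0<p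

  -- In `ready` the walk sits at some vertex; in `scanning i` the first i vertices have been
  -- measured with outcome `false`; in `conical` the walk was found at vertex 0 and one evolution
  -- remains. A protocol sees only the history, from which `phase` recovers this state.
  data Phase : Set where
    ready conical finished : Phase
    scanning               : ℕ → Phase

  afterEvolve : Phase → Phase
  afterEvolve conical = finished
  afterEvolve _       = scanning 0

  afterMeasure : Bool → Phase → Phase
  afterMeasure true  (scanning zero) = conical
  afterMeasure true  _               = ready
  afterMeasure false (scanning i)    = scanning (suc i)
  -- Only scanning phases measure, so this is a default value.
  afterMeasure false _               = ready

  phase : History → Phase
  phase []               = ready
  phase (evolved ∷ h)    = afterEvolve (phase h)
  phase (observed b ∷ h) = afterMeasure b (phase h)

  -- Scanning phases carry an unbounded number, hence the default `zero` out of range;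
  -- `scanning-bound` excludes that case for states satisfying the invariant.
  vertex : ∀ {n} → ℕ → Fin (suc n)
  vertex {n} i with i ℕ.<? suc n
  ... | yes i<n = Fin.fromℕ< i<n
  ... | no  _   = zero

  toℕ-vertex : ∀ {n i} → i ℕ.≤ n → toℕ (vertex {n} i) ≡ i
  toℕ-vertex {n} {i} i≤n with i ℕ.<? suc n
  ... | yes i<n = toℕ-fromℕ< i<n
  ... | no  i≮n = ⊥-elim (i≮n (ℕ.s≤s i≤n))

  vertex-zero : ∀ {n} → vertex {n} 0 ≡ zero
  vertex-zero {n} = toℕ-injective (toℕ-vertex {n} ℕ.z≤n)

  module Walk {n′} {H : Matrix (suc (suc n′))} (mixing : MixingTime H) where

    n : ℕ
    n = suc n′

    open MixingTime mixing renaming (time to t; 0≤time to 0≤t)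

    act : Phase → Action (suc n)
    act ready        = evolve t 0≤t
    act conical      = evolve t 0≤t
    act finished     = stop
    act (scanning i) = measure (vertex i)

    σ : Protocol (suc n)
    σ h = act (phase h)

    -- Only the first measurement of a scan has a probability that matters, so it is recorded in
    -- `scanning zero`. Afterwards the amplitudes known to vanish suffice.
    Invariant : Phase → ℂ^ (suc n) → Set
    Invariant ready              ψ = ∃[ a ] Localized a ψ
    Invariant conical            ψ = Localized zero ψ
    Invariant finished           ψ = IsUniform ψ
    Invariant (scanning zero)    ψ = ∥ ψ ∥² ≈ 1# × ∣ ψ zero ∣² ≈ ι n
    Invariant (scanning (suc i)) ψ = ∥ ψ ∥² ≈ 1# × (∀ v → toℕ v ℕ.≤ i → ψ v ≈ᶜ 0ᶜ)

    scanning-norm : ∀ i {ψ} → Invariant (scanning i) ψ → ∥ ψ ∥² ≈ 1#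
    scanning-norm zero    = proj₁
    scanning-norm (suc i) = proj₁

    -- A unit vector cannot vanish at all n + 1 vertices, so a scan finds the walk at the last
    -- vertex if not before.
    scanning-bound : ∀ i {ψ} → Invariant (scanning i) ψ → i ℕ.≤ n
    scanning-bound zero    inv = ℕ.z≤n
    scanning-bound (suc i) {ψ} (norm , zeros) = ℕ.≰⇒> (λ n≤i → 0≉1 (trans
      (sym (trans (Σ-cong {g = λ _ → 0#} (λ v → ∣0∣²≈0 (zeros v (ℕ.≤-trans (toℕ≤pred[n] v) n≤i))))
                  (sum-replicate-zero (suc n))))
      norm))

    scanning-zeros : ∀ i {ψ} → Invariant (scanning i) ψ → ∀ v → toℕ v ℕ.< i → ψ v ≈ᶜ 0ᶜ
    scanning-zeros zero    inv v ()
    scanning-zeros (suc i) inv v (ℕ.s≤s v≤i) = proj₂ inv v v≤i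

    evolve-preserves : ∀ p {ψ s 0≤s} → Invariant p ψ → act p ≡ evolve s 0≤s →
                       Invariant (afterEvolve p) (propagator H s *ᵛ ψ)
    evolve-preserves ready   (a , loc) ≡.refl =
      trans (Σ-cong (evolve-localized (propagator H t) loc)) (unitary a) ,
      trans (evolve-localized (propagator H t) loc zero) (from-cone a)
    evolve-preserves conical loc       ≡.refl =
      λ v → trans (evolve-localized (propagator H t) loc v) (to-cone v)

    measure-preserves : ∀ p b {ψ a} → Invariant p ψ → act p ≡ measure a →
                        0# < outcomeProbability a b ψ →
                        Invariant (afterMeasure b p) (collapse a b ψ)
    measure-preserves (scanning zero) true {ψ} inv ≡.refl 0<p =
      ≡.subst (λ a → Localized a (collapse (vertex 0) true ψ)) vertex-zero
        (collapse-localized (vertex 0) ψ 0<p)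
    measure-preserves (scanning (suc i)) true {ψ} inv ≡.refl 0<p =
      vertex (suc i) , collapse-localized (vertex (suc i)) ψ 0<p
    measure-preserves (scanning i) false {ψ} inv ≡.refl 0<p =
      collapse-norm (vertex i) false ψ 0<p , λ v v≤i → zeros v v≤i (v Fin.≟ vertex i)
      where
      zeros : ∀ v → toℕ v ℕ.≤ i → Dec (v ≡ vertex i) → collapse (vertex i) false ψ v ≈ᶜ 0ᶜ
      zeros v v≤i (yes v≡a) = collapse-zero (vertex i) false ψ
        (≡.subst (λ w → (projection (vertex i) false *ᵛ ψ) w ≈ᶜ 0ᶜ) (≡.sym v≡a) (projection-false-on (vertex i) ψ))
      zeros v v≤i (no v≢a)  = collapse-zero (vertex i) false ψ (C.trans (projection-false-off (vertex i) ψ v≢a)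
        (scanning-zeros i inv v (ℕ.≤∧≢⇒< v≤i (λ v≡i →
          v≢a (toℕ-injective (≡.trans v≡i (≡.sym (toℕ-vertex (scanning-bound i inv)))))))))

    -- Invariants of runs and potential functions

    open Run H σ

    module _ {c₀ : Config (suc n)} (start-inv : Invariant (phase (history c₀)) (state c₀)) where

      reachable-invariant : ∀ {c} → Reachable c₀ c → Invariant (phase (history c)) (state c)
      reachable-invariant start                        = start-inv
      reachable-invariant (evolving {c} r eq)          = evolve-preserves (phase (history c)) (reachable-invariant r) eq
      reachable-invariant (outcome {c} b r eq 0<p)     = measure-preserves (phase (history c)) b (reachable-invariant r) eq 0<p

    finished-uniform : ∀ p {ψ} → Invariant p ψ → act p ≡ stop → IsUniform ψ
    finished-uniform finished inv ≡.refl = inv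

    -- Φ d p τ is meant to dominate the expectation of f over at most d further steps, from any
    -- state satisfying the invariant of phase p. There is one inequality for each kind of step, and
    -- quantum states no longer occur in them. Once the conical vertex has been tested, the next
    -- outcome has an unknown probability; hence the arbitrary p.
    record Supermartingale (f : Config (suc n) → ℝ) (Φ : ℕ → Phase → ℝ → ℝ) : Set where
      field
        at-start    : ∀ h τ ψ → f (config h τ ψ) ≤ Φ 0 (phase h) τ
        at-finished : ∀ d h τ ψ → phase h ≡ finished → f (config h τ ψ) ≤ Φ (suc d) finished τ
        at-ready    : ∀ {d τ} → Φ d (scanning 0) (τ + t) ≤ Φ (suc d) ready τ
        at-conical  : ∀ {d τ} → Φ d finished (τ + t) ≤ Φ (suc d) conical τ
        at-scanning-zero : ∀ {d τ} →
          ι n * Φ d conical τ + (1# - ι n) * Φ d (scanning 1) τ ≤ Φ (suc d) (scanning 0) τ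
        at-scanning-suc  : ∀ {d τ i p} → i ℕ.< n → 0# ≤ p → p ≤ 1# →
          p * Φ d ready τ + (1# - p) * Φ d (scanning (2 ℕ.+ i)) τ ≤ Φ (suc d) (scanning (suc i)) τ

    module _ {f Φ} (super : Supermartingale f Φ) where
      open Supermartingale super

      expectation≤ : ∀ d h τ ψ p → phase h ≡ p → Invariant p ψ →
                     expectation f d (config h τ ψ) ≤ Φ d p τ

      outcome≤ : ∀ d h τ ψ p a b → phase h ≡ p → Invariant p ψ → act p ≡ measure a →
                 outcomeProbability a b ψ * expectation f d (afterOutcome a b (config h τ ψ)) ≤
                 outcomeProbability a b ψ * Φ d (afterMeasure b p) τ
      outcome≤ d h τ ψ p a b eq inv actp = weighted (outcomeProbability a b ψ O.≟ 0#)
        where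
        P : ℝ
        P = outcomeProbability a b ψ
        weighted : Dec (P ≈ 0#) → P * expectation f d (afterOutcome a b (config h τ ψ)) ≤ P * Φ d (afterMeasure b p) τ
        -- The collapsed state is meaningless for an impossible outcome, but its weight is zero.
        weighted (yes P≈0) = O.reflexive (trans (trans (*-congʳ P≈0) (zeroˡ _)) (sym (trans (*-congʳ P≈0) (zeroˡ _))))
        weighted (no  P≉0) = *-monoˡ-≤ (0≤probability a b ψ)
          (expectation≤ d (observed b ∷ h) τ (collapse a b ψ) (afterMeasure b p) (≡.cong (afterMeasure b) eq)
            (measure-preserves p b inv actp (0≤x∧x≉0⇒0<x (0≤probability a b ψ) P≉0)))

      measure≤ : ∀ d h τ ψ i → phase h ≡ scanning i → Invariant (scanning i) ψ →
        continue f d (config h τ ψ) (measure (vertex i)) ≤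
        ∣ ψ (vertex i) ∣² * Φ d (afterMeasure true (scanning i)) τ + (1# - ∣ ψ (vertex i) ∣²) * Φ d (scanning (suc i)) τ
      measure≤ d h τ ψ i eq inv = O.trans
        (+-mono-≤ (outcome≤ d h τ ψ (scanning i) (vertex i) true eq inv ≡.refl)
                  (outcome≤ d h τ ψ (scanning i) (vertex i) false eq inv ≡.refl))
        (O.reflexive (+-cong (*-congʳ (probability-true (vertex i) ψ)) (*-congʳ probability-false)))
        where
        a : Fin (suc n)
        a = vertex i
        probability-false : outcomeProbability a false ψ ≈ 1# - ∣ ψ a ∣²
        probability-false = begin-equality
          outcomeProbability a false ψ
            ≈⟨ solve 2 (λ p q → q := (p :+ q) :- p) refl (outcomeProbability a true ψ) (outcomeProbability a false ψ) ⟩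
          (outcomeProbability a true ψ + outcomeProbability a false ψ) - outcomeProbability a true ψ
            ≈⟨ +-cong (trans (probability-total a ψ) (scanning-norm i inv)) (-‿cong (probability-true a ψ)) ⟩
          1# - ∣ ψ a ∣² ∎

      ∣∣²≤norm : ∀ (a : Fin (suc n)) ψ → ∣ ψ a ∣² ≤ ∥ ψ ∥²
      ∣∣²≤norm a ψ = begin
        ∣ ψ a ∣²                       ≈⟨ probability-true a ψ ⟨
        outcomeProbability a true ψ    ≤⟨ ≤-by (outcomeProbability a false ψ) (0≤probability a false ψ) refl ⟩
        outcomeProbability a true ψ + outcomeProbability a false ψ ≈⟨ probability-total a ψ ⟩
        ∥ ψ ∥²                         ∎

      continue≤ : ∀ d h τ ψ p → phase h ≡ p → Invariant p ψ →
                  continue f d (config h τ ψ) (act p) ≤ Φ (suc d) p τ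
      continue≤ d h τ ψ ready              eq inv = O.trans
        (expectation≤ d (evolved ∷ h) (τ + t) _ (scanning 0) (≡.cong afterEvolve eq) (evolve-preserves ready inv ≡.refl))
        at-ready
      continue≤ d h τ ψ conical            eq inv = O.trans
        (expectation≤ d (evolved ∷ h) (τ + t) _ finished (≡.cong afterEvolve eq) (evolve-preserves conical inv ≡.refl))
        at-conical
      continue≤ d h τ ψ finished           eq inv = at-finished d h τ ψ eq
      continue≤ d h τ ψ (scanning zero)    eq inv = O.trans
        (measure≤ d h τ ψ 0 eq inv)
        (O.trans (O.reflexive (+-cong (*-congʳ P≈ι) (*-congʳ (+-congˡ (-‿cong P≈ι))))) at-scanning-zero)
        where
        P≈ι : ∣ ψ (vertex 0) ∣² ≈ ι n
        P≈ι = trans (reflexive (≡.cong (λ v → ∣ ψ v ∣²) vertex-zero)) (proj₂ inv)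
      continue≤ d h τ ψ (scanning (suc i)) eq inv = O.trans
        (measure≤ d h τ ψ (suc i) eq inv)
        (at-scanning-suc (scanning-bound (suc i) {ψ} inv) (0≤∣∣² (ψ (vertex (suc i))))
          (O.trans (∣∣²≤norm (vertex (suc i)) ψ) (O.reflexive (proj₁ inv))))

      expectation≤ zero    h τ ψ p eq inv = ≡.subst (λ p → f (config h τ ψ) ≤ Φ 0 p τ) eq (at-start h τ ψ)
      expectation≤ (suc d) h τ ψ p eq inv =
        ≡.subst (λ p′ → continue f d (config h τ ψ) (act p′) ≤ Φ (suc d) p τ) (≡.sym eq)
          (continue≤ d h τ ψ p eq inv)

    -- The expected evolution time

    N : ℝ
    N = fromℕ n

    0≤N : 0# ≤ N
    0≤N = 0≤fromℕ n

    N+1*ι : (1# + N) * ι n ≈ 1#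
    N+1*ι = fromℕ*ι n

    -- The values r at `ready` and s at `scanning zero` solve r = t + s and s = ι t + (1 - ι) r with
    -- ι = 1/(n + 1). As measuring takes no time, the later scanning phases share the value r.
    timeLeft : Phase → ℝ
    timeLeft ready              = (1# + 1# + N) * t
    timeLeft conical            = t
    timeLeft finished           = 0#
    timeLeft (scanning zero)    = (1# + N) * t
    timeLeft (scanning (suc _)) = (1# + 1# + N) * t

    0≤timeLeft : ∀ p → 0# ≤ timeLeft p
    0≤timeLeft ready              = *-nonNegative (+-nonNegative (+-nonNegative 0≤1 0≤1) 0≤N) 0≤t
    0≤timeLeft conical            = 0≤t
    0≤timeLeft finished           = O.refl
    0≤timeLeft (scanning zero)    = *-nonNegative (+-nonNegative 0≤1 0≤N) 0≤t
    0≤timeLeft (scanning (suc _)) = *-nonNegative (+-nonNegative (+-nonNegative 0≤1 0≤1) 0≤N) 0≤t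

    elapsed-super : Supermartingale elapsed (λ _ p τ → τ + timeLeft p)
    elapsed-super = record
      { at-start    = λ h τ ψ → ≤-by (timeLeft (phase h)) (0≤timeLeft (phase h)) refl
      ; at-finished = λ d h τ ψ eq → O.reflexive (sym (+-identityʳ _))
      ; at-ready    = λ {d} {τ} → O.reflexive
          (solve 3 (λ τ t n → (τ :+ t) :+ (𝟙ᵖ :+ n) :* t := τ :+ (𝟚ᵖ :+ n) :* t) refl τ t N)
      ; at-conical  = O.reflexive (+-identityʳ _)
      ; at-scanning-zero = λ {d} {τ} → O.reflexive (begin-equality
          ι n * (τ + t) + (1# - ι n) * (τ + (1# + 1# + N) * t)
            ≈⟨ solve 4 (λ p τ t n → p :* (τ :+ t) :+ (𝟙ᵖ :- p) :* (τ :+ (𝟚ᵖ :+ n) :* t) :=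
                 τ :+ (𝟚ᵖ :+ n) :* t :- (𝟙ᵖ :+ n) :* p :* t) refl (ι n) τ t N ⟩
          τ + (1# + 1# + N) * t - (1# + N) * ι n * t
            ≈⟨ +-congˡ (-‿cong (*-congʳ N+1*ι)) ⟩
          τ + (1# + 1# + N) * t - 1# * t
            ≈⟨ solve 3 (λ τ t n → τ :+ (𝟚ᵖ :+ n) :* t :- 𝟙ᵖ :* t := τ :+ (𝟙ᵖ :+ n) :* t) refl τ t N ⟩
          τ + (1# + N) * t ∎)
      ; at-scanning-suc = λ {d} {τ} {i} {p} _ _ _ → O.reflexive
          (solve 2 (λ p x → p :* x :+ (𝟙ᵖ :- p) :* x := x) refl p (τ + (1# + 1# + N) * t))
      }

    -- Stopping with probability 1

    stopped-finished : ∀ {h τ ψ} → phase h ≡ finished → stopped (config h τ ψ) ≡ 1#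
    stopped-finished eq rewrite eq = ≡.refl

    stopped≤1 : ∀ c → stopped c ≤ 1#
    stopped≤1 c with action c
    ... | stop       = O.refl
    ... | evolve _ _ = 0≤1
    ... | measure _  = 0≤1

    stopped-super : Supermartingale stopped (λ _ _ _ → 1#)
    stopped-super = record
      { at-start         = λ h τ ψ → stopped≤1 (config h τ ψ)
      ; at-finished      = λ d h τ ψ eq → stopped≤1 (config h τ ψ)
      ; at-ready         = O.refl
      ; at-conical       = O.refl
      ; at-scanning-zero = O.reflexive (solve 1 (λ p → p :* 𝟙ᵖ :+ (𝟙ᵖ :- p) :* 𝟙ᵖ := 𝟙ᵖ) refl (ι n))
      ; at-scanning-suc  = λ {p = p} _ _ _ → O.reflexive (solve 1 (λ p → p :* 𝟙ᵖ :+ (𝟙ᵖ :- p) :* 𝟙ᵖ := 𝟙ᵖ) refl p)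
      }

    -- Chosen so that `ι n * Wᵣ` is N + 3. This pays for one round: the evolution, the first
    -- measurement, at most N further measurements, and at most one step for the final evolution.
    Wᵣ : ℝ
    Wᵣ = (1# + N) * (N + three)

    W : Phase → ℝ
    W ready              = Wᵣ
    W conical            = 1#
    W finished           = 0#
    W (scanning zero)    = Wᵣ - 1#
    W (scanning (suc i)) = Wᵣ + fromℕ (n ℕ.∸ i)

    -- W is an upper bound on the expected number of steps left, and B on W.
    B : ℝ
    B = Wᵣ + N

    2≤Wᵣ : 1# + 1# ≤ Wᵣ
    2≤Wᵣ = ≤-by (1# + N * (N + four)) (+-nonNegative 0≤1 (*-nonNegative 0≤N (+-nonNegative 0≤N 0≤four)))
      (solve 1 (λ n → (𝟙ᵖ :+ n) :* (n :+ 𝟛ᵖ) := 𝟚ᵖ :+ (𝟙ᵖ :+ n :* (n :+ 𝟜ᵖ))) refl N)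

    1≤Wᵣ : 1# ≤ Wᵣ
    1≤Wᵣ = O.trans (≤-by 1# 0≤1 refl) 2≤Wᵣ

    W≤B : ∀ p → W p ≤ B
    W≤B ready              = ≤-by N 0≤N refl
    W≤B conical            = O.trans 1≤Wᵣ (≤-by N 0≤N refl)
    W≤B finished           = +-nonNegative (O.trans 0≤1 1≤Wᵣ) 0≤N
    W≤B (scanning zero)    = ≤-by (1# + N) (+-nonNegative 0≤1 0≤N)
      (solve 2 (λ w n → w :+ n := (w :- 𝟙ᵖ) :+ (𝟙ᵖ :+ n)) refl Wᵣ N)
    W≤B (scanning (suc i)) = +-mono-≤ O.refl (fromℕ-mono (ℕ.m∸n≤m n i))

    0<B : 0# < B
    0<B = <-≤-trans 0<1 (O.trans 1≤Wᵣ (≤-by N 0≤N refl))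

    ω ρ : ℝ
    ω = B ⁻¹
    ρ = 1# - ω

    Bω≈1 : B * ω ≈ 1#
    Bω≈1 = ⁻¹-inverseʳ B (0<x⇒x≉0 0<B)

    0≤ω : 0# ≤ ω
    0≤ω = proj₁ (⁻¹-positive 0<B)

    ω≤1 : ω ≤ 1#
    ω≤1 = *-cancelˡ-≤ 0<B (O.trans (O.reflexive Bω≈1) (O.trans
      (O.trans 1≤Wᵣ (≤-by N 0≤N refl)) (O.reflexive (sym (*-identityʳ B)))))

    0≤ρ^ : ∀ d → 0# ≤ ρ ^ d
    0≤ρ^ = ^-nonNegative (x≤y⇒0≤y-x ω≤1)

    -- As W never exceeds B, losing 1 means losing at least the fraction 1/B. A drift by a constant
    -- thus becomes geometric decay.
    W-1≤ρW : ∀ p → W p - 1# ≤ ρ * W p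
    W-1≤ρW p = ≤-by (ω * (B - W p)) (*-nonNegative 0≤ω (x≤y⇒0≤y-x (W≤B p))) (begin-equality
      ρ * W p
        ≈⟨ solve 3 (λ o w b → (𝟙ᵖ :- o) :* w := w :- b :* o :+ o :* (b :- w)) refl ω (W p) B ⟩
      W p - B * ω + ω * (B - W p)
        ≈⟨ +-congʳ (+-congˡ (-‿cong Bω≈1)) ⟩
      W p - 1# + ω * (B - W p) ∎)

    decay : ∀ p d {x} → x ≤ W p - 1# → x * ρ ^ d - 1# ≤ W p * ρ ^ suc d - 1#
    decay p d {x} x≤ = +-mono-≤ (begin
      x * ρ ^ d            ≈⟨ *-comm _ _ ⟩
      ρ ^ d * x            ≤⟨ *-monoˡ-≤ (0≤ρ^ d) (O.trans x≤ (W-1≤ρW p)) ⟩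
      ρ ^ d * (ρ * W p)   ≈⟨ solve 3 (λ l m w → l :* (m :* w) := w :* (m :* l)) refl (ρ ^ d) ρ (W p) ⟩
      W p * ρ ^ suc d      ∎) O.refl

    -- The probability of still running after d steps is at most W ρ^d. Potentials give upper bounds
    -- only, so this is stated for the negative of `stopped`. Once finished the potential is -1; for
    -- d = 0 it is nonnegative in the other phases because W ≥ 1 there.
    running-super : Supermartingale (λ c → - stopped c) (λ d p _ → W p * ρ ^ d - 1#)
    running-super = record
      { at-start    = λ h τ ψ → start≤ h τ ψ (phase h) ≡.refl
      ; at-finished = λ d h τ ψ eq → O.reflexive (trans (-‿cong (reflexive (stopped-finished {h} {τ} {ψ} eq)))
          (sym (trans (+-congʳ (zeroˡ _)) (+-identityˡ _))))
      ; at-ready    = λ {d} → decay ready d O.refl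
      ; at-conical  = λ {d} → decay conical d (O.reflexive (sym (-‿inverseʳ 1#)))
      ; at-scanning-zero = λ {d} → O.trans
          (O.reflexive (combine (ι n) 1# (Wᵣ + N) (ρ ^ d)))
          (decay (scanning zero) d (scan₀ d))
      ; at-scanning-suc  = λ {d} {τ} {i} {p} i<n 0≤p p≤1 → O.trans
          (O.reflexive (combine p Wᵣ (W (scanning (2 ℕ.+ i))) (ρ ^ d)))
          (decay (scanning (suc i)) d (scanₛ i<n 0≤p))
      }
      where
      combine : ∀ p a b l → p * (a * l - 1#) + (1# - p) * (b * l - 1#) ≈ (p * a + (1# - p) * b) * l - 1#
      combine = solve 4 (λ p a b l → p :* (a :* l :- 𝟙ᵖ) :+ (𝟙ᵖ :- p) :* (b :* l :- 𝟙ᵖ) :=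
                  (p :* a :+ (𝟙ᵖ :- p) :* b) :* l :- 𝟙ᵖ) refl

      scan₀ : ∀ d → ι n * 1# + (1# - ι n) * (Wᵣ + N) ≤ W (scanning zero) - 1#
      scan₀ d = ≤-by ((1# - ι n) + ι n * N) (+-nonNegative (x≤y⇒0≤y-x (ι≤1 n)) (*-nonNegative (proj₁ (0<ι n)) 0≤N))
        (begin-equality
          Wᵣ - 1# - 1#
            ≈⟨ solve 3 (λ w n k → w :- 𝟙ᵖ :- 𝟙ᵖ := w :+ n :- 𝟙ᵖ :* (n :+ 𝟛ᵖ) :+ 𝟙ᵖ) refl Wᵣ N 1# ⟩
          Wᵣ + N - 1# * (N + three) + 1#
            ≈⟨ +-congʳ (+-congˡ (-‿cong (*-congʳ N+1*ι))) ⟨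
          Wᵣ + N - (1# + N) * ι n * (N + three) + 1#
            ≈⟨ solve 2 (λ p n → let w = (𝟙ᵖ :+ n) :* (n :+ 𝟛ᵖ) in
                 w :+ n :- (𝟙ᵖ :+ n) :* p :* (n :+ 𝟛ᵖ) :+ 𝟙ᵖ :=
                 p :* 𝟙ᵖ :+ (𝟙ᵖ :- p) :* (w :+ n) :+ ((𝟙ᵖ :- p) :+ p :* n)) refl (ι n) N ⟩
          ι n * 1# + (1# - ι n) * (Wᵣ + N) + ((1# - ι n) + ι n * N) ∎)

      scanₛ : ∀ {i p} → i ℕ.< n → 0# ≤ p →
        p * Wᵣ + (1# - p) * W (scanning (2 ℕ.+ i)) ≤ W (scanning (suc i)) - 1#
      scanₛ {i} {p} i<n 0≤p = ≤-by (p * m) (*-nonNegative 0≤p (0≤fromℕ (n ℕ.∸ suc i))) (begin-equality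
        Wᵣ + fromℕ (n ℕ.∸ i) - 1#
          -- Here i < n ensures that the truncated difference drops by exactly one.
          ≈⟨ +-congʳ (+-congˡ (reflexive (≡.cong fromℕ (ℕ.+-∸-assoc 1 i<n)))) ⟩
        Wᵣ + (1# + m) - 1#
          ≈⟨ solve 3 (λ w m p → w :+ (𝟙ᵖ :+ m) :- 𝟙ᵖ := p :* w :+ (𝟙ᵖ :- p) :* (w :+ m) :+ p :* m) refl Wᵣ m p ⟩
        p * Wᵣ + (1# - p) * (Wᵣ + m) + p * m ∎)
        where
        m : ℝ
        m = fromℕ (n ℕ.∸ suc i)

      running : ∀ {x} → 1# ≤ x → - 0# ≤ x * 1# - 1#
      running {x} 1≤x = begin
        - 0#        ≈⟨ -0#≈0# ⟩
        0#          ≤⟨ x≤y⇒0≤y-x 1≤x ⟩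
        x - 1#      ≈⟨ +-congʳ (*-identityʳ x) ⟨
        x * 1# - 1# ∎

      start≤ : ∀ h τ ψ p → phase h ≡ p → - stopped (config h τ ψ) ≤ W p * 1# - 1#
      start≤ h τ ψ ready              eq rewrite eq = running 1≤Wᵣ
      start≤ h τ ψ conical            eq rewrite eq = running O.refl
      start≤ h τ ψ finished           eq rewrite eq = O.reflexive (sym (trans (+-congʳ (zeroˡ 1#)) (+-identityˡ _)))
      -- W is Wᵣ - 1 in this phase, which is why Wᵣ ≥ 2 is needed.
      start≤ h τ ψ (scanning zero)    eq rewrite eq = running (≤-by (Wᵣ - 1# - 1#)
        (O.trans (x≤y⇒0≤y-x 2≤Wᵣ) (O.reflexive (solve 1 (λ w → w :- 𝟚ᵖ := w :- 𝟙ᵖ :- 𝟙ᵖ) refl Wᵣ)))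
        (solve 1 (λ w → w :- 𝟙ᵖ := 𝟙ᵖ :+ (w :- 𝟙ᵖ :- 𝟙ᵖ)) refl Wᵣ))
      start≤ h τ ψ (scanning (suc i)) eq rewrite eq = running (O.trans 1≤Wᵣ (≤-by (fromℕ (n ℕ.∸ i)) (0≤fromℕ (n ℕ.∸ i)) refl))

    expectation-neg : ∀ f d c → expectation (λ c → - f c) d c ≈ - expectation f d c
    continue-neg    : ∀ f d c a → continue (λ c → - f c) d c a ≈ - continue f d c a
    expectation-neg f zero    c = refl
    expectation-neg f (suc d) c = continue-neg f d c (action c)
    continue-neg f d c stop         = refl
    continue-neg f d c (evolve t _) = expectation-neg f d (afterEvolution t c)
    continue-neg f d c (measure a)  = trans
      (+-cong (trans (*-congˡ (expectation-neg f d (afterOutcome a true c))) (sym (-‿distribʳ-* _ _)))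
              (trans (*-congˡ (expectation-neg f d (afterOutcome a false c))) (sym (-‿distribʳ-* _ _))))
      (-‿+-comm _ _)

    -- Bernoulli's inequality for 1/ρ in disguise; in the induction (1 - ω)(1 + (d + 1)ω) falls
    -- short of 1 + dω by (d + 1)ω².
    ρ^-bound : ∀ d → ρ ^ d * (1# + fromℕ d * ω) ≤ 1#
    ρ^-bound zero    = O.reflexive (solve 1 (λ o → 𝟙ᵖ :* (𝟙ᵖ :+ 𝟘ᵖ :* o) := 𝟙ᵖ) refl ω)
    ρ^-bound (suc d) = O.trans (≤-by (ρ ^ d * ((1# + D) * (ω * ω)))
      (*-nonNegative (0≤ρ^ d) (*-nonNegative (+-nonNegative 0≤1 (0≤fromℕ d)) (0≤x² ω)))
      (solve 3 (λ l d o → l :* (𝟙ᵖ :+ d :* o) := (𝟙ᵖ :- o) :* l :* (𝟙ᵖ :+ (𝟙ᵖ :+ d) :* o) :+ l :* ((𝟙ᵖ :+ d) :* (o :* o)))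
        refl (ρ ^ d) D ω))
      (ρ^-bound d)
      where
      D : ℝ
      D = fromℕ d

    Wᵣρ^→0 : ∀ e → 0# < e → ∃[ m₀ ] (∀ m → m₀ ℕ.≤ m → Wᵣ * ρ ^ m ≤ e)
    Wᵣρ^→0 e 0<e = m₀ , λ m m₀≤m → begin
      Wᵣ * ρ ^ m
        ≤⟨ *-mono-≤ (O.trans 0≤1 1≤Wᵣ) (0≤ρ^ m) (large m m₀≤m) O.refl ⟩
      e * (1# + fromℕ m * ω) * ρ ^ m
        ≈⟨ solve 3 (λ e x l → e :* x :* l := e :* (l :* x)) refl e (1# + fromℕ m * ω) (ρ ^ m) ⟩
      e * (ρ ^ m * (1# + fromℕ m * ω))
        ≤⟨ *-monoˡ-≤ (proj₁ 0<e) (ρ^-bound m) ⟩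
      e * 1#
        ≈⟨ *-identityʳ e ⟩
      e ∎
      where
      m₀ : ℕ
      -- From m₀ on, e m ω is at least Wᵣ, since ω is the inverse of B.
      m₀ = proj₁ (archimedean (Wᵣ * B * e ⁻¹))
      large : ∀ m → m₀ ℕ.≤ m → Wᵣ ≤ e * (1# + fromℕ m * ω)
      large m m₀≤m = begin
        Wᵣ
          ≈⟨ solve 1 (λ w → w := w :* 𝟙ᵖ :* 𝟙ᵖ) refl Wᵣ ⟩
        Wᵣ * 1# * 1#
          ≈⟨ *-cong (*-congˡ Bω≈1) (⁻¹-inverseʳ e (0<x⇒x≉0 0<e)) ⟨
        Wᵣ * (B * ω) * (e * e ⁻¹)
          ≈⟨ solve 5 (λ w b o e f → w :* (b :* o) :* (e :* f) := e :* (o :* (w :* b :* f))) refl Wᵣ B ω e (e ⁻¹) ⟩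
        e * (ω * (Wᵣ * B * e ⁻¹))
          ≤⟨ *-monoˡ-≤ (proj₁ 0<e) (*-monoˡ-≤ 0≤ω (O.trans (proj₂ (archimedean _)) (fromℕ-mono m₀≤m))) ⟩
        e * (ω * fromℕ m)
          ≤⟨ ≤-by e (proj₁ 0<e) (solve 3 (λ e o m → e :* (𝟙ᵖ :+ m :* o) := e :* (o :* m) :+ e) refl e ω (fromℕ m)) ⟩
        e * (1# + fromℕ m * ω) ∎

    -- The constant 6 is 3 times 2: n + 2 ≤ 3n because n ≥ 1, and t ≤ 2√n.
    mixes : ∀ u → LasVegasUniformMixing H u σ
                    ((1# + 1# + 1# + 1# + 1# + 1#) * (N * (√ N)))
    mixes u = record
      { stopsAlmostSurely = λ e 0<e → proj₁ (Wᵣρ^→0 e 0<e) , λ m m₀≤m →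
          (begin
            1# - e
              ≤⟨ +-mono-≤ O.refl (-‿anti-≤ (proj₂ (Wᵣρ^→0 e 0<e) m m₀≤m)) ⟩
            1# - Wᵣ * ρ ^ m
              ≈⟨ solve 1 (λ x → 𝟙ᵖ :- x := :- (x :- 𝟙ᵖ)) refl (Wᵣ * ρ ^ m) ⟩
            - (Wᵣ * ρ ^ m - 1#)
              ≤⟨ -‿anti-≤ (expectation≤ running-super m [] 0# (basis u) ready ≡.refl (u , basis-localized u)) ⟩
            - expectation (λ c → - stopped c) m (config [] 0# (basis u))
              ≈⟨ trans (-‿cong (expectation-neg stopped m (config [] 0# (basis u)))) (-‿involutive _) ⟩
            expectation stopped m (config [] 0# (basis u)) ∎) ,
          O.trans (expectation≤ stopped-super m [] 0# (basis u) ready ≡.refl (u , basis-localized u))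
            (≤-by e (proj₁ 0<e) refl)
      ; stopsUniformly = λ c r → finished-uniform (phase (history c))
          (reachable-invariant {config [] 0# (basis u)} (u , basis-localized u) r)
      ; expectedTime≤ = λ d → begin
          expectation elapsed d (config [] 0# (basis u))
            ≤⟨ expectation≤ elapsed-super d [] 0# (basis u) ready ≡.refl (u , basis-localized u) ⟩
          0# + (1# + 1# + N) * t
            ≈⟨ +-identityˡ _ ⟩
          (1# + 1# + N) * t
            ≤⟨ *-mono-≤ (+-nonNegative (+-nonNegative 0≤1 0≤1) 0≤N) (*-nonNegative (+-nonNegative 0≤1 0≤1) (proj₁ (√-square 0≤N))) 2+N≤3N time≤ ⟩
          three * N * ((1# + 1#) * √ N)
            ≈⟨ solve 2 (λ n s → 𝟛ᵖ :* n :* (𝟚ᵖ :* s) := con (6 , 0) :* (n :* s)) refl N (√ N) ⟩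
          (1# + 1# + 1# + 1# + 1# + 1#) * (N * (√ N)) ∎
      }
      where
      2+N≤3N : 1# + 1# + N ≤ three * N
      2+N≤3N = ≤-by ((1# + 1#) * fromℕ n′) (*-nonNegative (+-nonNegative 0≤1 0≤1) (0≤fromℕ n′))
        (solve 1 (λ k → 𝟛ᵖ :* (𝟙ᵖ :+ k) := 𝟚ᵖ :+ (𝟙ᵖ :+ k) :+ 𝟚ᵖ :* k) refl (fromℕ n′))

theorem2 : (R : CompleteOrderedField) →
    let open CompleteOrderedField R
        open MeasuredWalk R
    in ∃[ C ] (0# < C ×
      ((n : ℕ) → n ≥ 1 → (A : Matrix n) →
       IsHermitian A → IsSimpleEigenvalue A 0ᶜ → IsEigenvector A 0ᶜ 𝟏 →
       (u : Fin (suc n)) →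
       ∃[ σ ] LasVegasUniformMixing
                (((fromℕ n ⁻¹) +i 0#) •ᵐ cone A) u σ
                (C * (fromℕ n * (√ (fromℕ n))))))
theorem2 R = 1# + 1# + 1# + 1# + 1# + 1# , 0<6 , λ
  { zero    ()
  ; (suc n) _ A hermitian _ kernel u →
      let open Walk (mixingTime A hermitian kernel) in σ , mixes u }
  where
  open CompleteOrderedField R
  open Development R
  0<6 : 0# < 1# + 1# + 1# + 1# + 1# + 1#
  0<6 = <-≤-trans 0<1 (≤-by (1# + 1# + 1# + 1# + 1#)
    (+-nonNegative 0≤four 0≤1) (+-comm _ _))
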